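{- For each $m\ge2$ let $K_m$ be a random variable with $\Pr(K_m=k)=p_k(m)$ for $k=0,\dots,m-1$, let $q_k(m)=\sum_{j=k}^{m-1}p_j(m)$, let $T_m:=K_m/(m-1)\in[0,1]$, and let $\mu_m=\sum_{k=0}^{m-1}p_k(m)\,\delta_{k/(m-1)}$ be the law of $T_m$. Assume that for every $t\in[0,1]$, $q_{\lfloor t(m-1)\rfloor}(m)\to(1+2t)^{ -1/2}$ as $m\to\infty$. Then for every $t\in[0,1)$, with $k_m(t)=\lceil t(m-1)\rceil$, $$\Pr(T_m\ge t)=\sum_{j=k_m(t)}^{m-1}p_j(m)=q_{k_m(t)}(m)\longrightarrow\frac{1}{\sqrt{1+2t}}\qquad(m\to\infty).$$ Assume also that $\Pr(T_m=1)=p_{m-1}(m)\to\frac{1}{\sqrt3}$ as $m\to\infty$. Then $T_m$ converges in distribution to a random variable $T$ (equivalently, $\mu_m$ converges weakly to $\mu$), where $T$ has law $$\mu(dx)=\frac{1}{(1+2x)^{3/2}}\mathbf 1_{[0,1)}(x)\,dx+\frac{1}{\sqrt3}\,\delta_1(dx).$$ Equivalently, $\Pr(T\ge t)=1/\sqrt{1+2t}$ for $0\le t<1$, and $\Pr(T=1)=1/\sqrt3$.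
   Context: For an integer $m\ge2$ let $V_m=\{v_0<v_1<\cdots<v_{m-1}\}$ ($v_0=0$, $v_{m-1}=1$) be an $m$-element chain with Gödel implication $v_p\Rightarrow_G v_q=v_{m-1}$ if $p\le q$ and $v_p\Rightarrow_G v_q=v_q$ if $p>q$. For $n\ge1$, consider the $C_{n-1}$ full bracketings of $p_1\Rightarrow_G\cdots\Rightarrow_G p_n$ in $n$ distinct variables (full binary trees with $n$ ordered leaves), $C_k$ being the Catalan numbers. Let $g_n^{(k)}$ be the number of pairs (bracketing, valuation $\{p_1,\dots,p_n\}\to V_m$) for which the bracketed formula evaluates to $v_k$, and $g_n=\sum_{k=0}^{m-1}g_n^{(k)}=m^nC_{n-1}$. Put $p_k(m):=\lim_{n\to\infty}g_n^{(k)}/g_n$ for $0\le k\le m-1$; these limits exist and $(p_k(m))_{k=0}^{m-1}$ is a probability distribution on $\{0,\dots,m-1\}$. $\delta_y$ denotes the Dirac mass at $y$. -}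

module Defs where

open import Data.Bool.Base using (if_then_else_)
open import Data.Fin.Base as Fin using (Fin; toℕ)
import Data.Fin.Properties as Fin
open import Data.Integer.Base as ℤ using (+_; -[1+_])
import Data.Integer.Properties as ℤ
open import Data.List.Base
  using (List; []; _∷_; _++_; map; concatMap; cartesianProduct; cartesianProductWith; filter; length; allFin; upTo)
open import Data.Nat.Base as ℕ using (ℕ; zero; suc)
open import Data.Nat.ListAction using (sum)
import Data.Nat.Properties as ℕ
open import Data.Product.Base using (Σ-syntax; ∃-syntax; _×_; _,_; proj₁; proj₂)
open import Data.Rational.Base as Rat using (ℚ; 0ℚ; 1ℚ; ½)
import Data.Rational.Properties as Ratₚ
open import Data.Rational.Solver using (module +-*-Solver)
open import Data.Rational.Unnormalised.Base as ℚᵘ using ()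
import Data.Rational.Unnormalised.Properties as ℚᵘ
open import Data.Sum.Base using (_⊎_; inj₁; inj₂)
open import Data.Vec.Base as Vec using (Vec; []; _∷_)
open import Data.Vec.Functional using (foldr)
open import Level using (0ℓ)
open import Relation.Binary.PropositionalEquality
  using (_≡_; refl; sym; trans; cong; cong₂; subst; subst₂)
open import Relation.Nullary.Decidable using (Dec; yes; no; does)
open import Relation.Nullary.Negation using (¬_; contradiction)
open import Relation.Unary using (Pred; Decidable)

-- a / b, with the convention a / 0 = 0.
fraction : ℕ → ℕ → ℚ
fraction a zero    = 0ℚ
fraction a (suc b) = + a Rat./ suc b

module RationalLemmas where
  open Rat
  open Ratₚ

  fraction-mono : ∀ a b c d → a ℕ.* suc d ℕ.≤ c ℕ.* suc b →
                  fraction a (suc b) ≤ fraction c (suc d)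
  fraction-mono a b c d ad≤cb = toℚᵘ-cancel-≤ (ℚᵘ.≤-trans
    (ℚᵘ.≤-reflexive (toℚᵘ-fromℚᵘ (ℚᵘ.mkℚᵘ (+ a) b)))
    (ℚᵘ.≤-trans
      (ℚᵘ.*≤* (subst₂ ℤ._≤_ (ℤ.pos-* a (suc d)) (ℤ.pos-* c (suc b)) (ℤ.+≤+ ad≤cb)))
      (ℚᵘ.≤-reflexive (ℚᵘ.≃-sym (toℚᵘ-fromℚᵘ (ℚᵘ.mkℚᵘ (+ c) d))))))

  0≤fraction : ∀ a b → 0ℚ ≤ fraction a b
  0≤fraction a zero    = ≤-refl
  0≤fraction a (suc b) = fraction-mono 0 0 a b ℕ.z≤n

  fraction≤1 : ∀ {a b} → a ℕ.≤ b → fraction a b ≤ 1ℚ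
  fraction≤1 {a} {zero}  a≤b = fraction-mono 0 0 1 0 ℕ.z≤n
  fraction≤1 {a} {suc b} a≤b = fraction-mono a b 1 0
    (subst₂ ℕ._≤_ (sym (ℕ.*-identityʳ a)) (sym (ℕ.*-identityˡ (suc b))) a≤b)

  <⇒≱ : ∀ {p q} → p < q → p ≱ q
  <⇒≱ p<q q≤p = <-irrefl refl (<-≤-trans p<q q≤p)

  0<1/suc : ∀ n → 0ℚ < fraction 1 (suc n)
  0<1/suc n = positive⁻¹ (fraction 1 (suc n)) ⦃ normalize-pos 1 (suc n) ⦄

  fromℕ-suc : ∀ n → fraction (suc n) 1 ≡ 1ℚ + fraction n 1
  fromℕ-suc n = toℚᵘ-injective (ℚᵘ.≃-trans (toℚᵘ-fromℚᵘ (ℚᵘ.mkℚᵘ (+ suc n) 0))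
    (ℚᵘ.≃-sym (ℚᵘ.≃-trans (toℚᵘ-homo-+ 1ℚ (fraction n 1))
      (ℚᵘ.≃-trans (ℚᵘ.+-congʳ ℚᵘ.1ℚᵘ (toℚᵘ-fromℚᵘ (ℚᵘ.mkℚᵘ (+ n) 0)))
        (ℚᵘ.*≡* (cong (λ z → (+ 1 ℤ.+ z) ℤ.* + 1) (ℤ.*-identityʳ (+ n))))))))

  infixl 7 _*≥0_
  _*≥0_ : ∀ {p q} → 0ℚ ≤ p → 0ℚ ≤ q → 0ℚ ≤ p * q
  _*≥0_ {p} {q} 0≤p 0≤q = nonNegative⁻¹ (p * q)
    ⦃ nonNeg*nonNeg⇒nonNeg p ⦃ nonNegative 0≤p ⦄ q ⦃ nonNegative 0≤q ⦄ ⦄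

  infixl 6 _+≥0_
  _+≥0_ : ∀ {p q} → 0ℚ ≤ p → 0ℚ ≤ q → 0ℚ ≤ p + q
  _+≥0_ {p} {q} 0≤p 0≤q = nonNegative⁻¹ (p + q)
    ⦃ nonNeg+nonNeg⇒nonNeg p ⦃ nonNegative 0≤p ⦄ q ⦃ nonNegative 0≤q ⦄ ⦄

  infixl 7 _*>0_
  _*>0_ : ∀ {p q} → 0ℚ < p → 0ℚ < q → 0ℚ < p * q
  _*>0_ {p} {q} 0<p 0<q = positive⁻¹ (p * q)
    ⦃ pos*pos⇒pos p ⦃ positive 0<p ⦄ q ⦃ positive 0<q ⦄ ⦄

  0<½ : 0ℚ < ½
  0<½ = 0<1/suc 1

  *-mono : ∀ {p q r s} → 0ℚ ≤ p → 0ℚ ≤ s → p ≤ q → r ≤ s → p * r ≤ q * s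
  *-mono {p} {q} {r} {s} 0≤p 0≤s p≤q r≤s = ≤-trans
    (*-monoˡ-≤-nonNeg p ⦃ nonNegative 0≤p ⦄ r≤s)
    (*-monoʳ-≤-nonNeg s ⦃ nonNegative 0≤s ⦄ p≤q)

  half+half : ∀ ε → ½ * ε + ½ * ε ≡ ε
  half+half ε = trans (sym (*-distribʳ-+ ε ½ ½)) (*-identityˡ ε)

  ∣-∣-sym : ∀ p q → ∣ p - q ∣ ≡ ∣ q - p ∣
  ∣-∣-sym p q = trans (sym (∣-p∣≡∣p∣ (p - q))) (cong ∣_∣
    (solve 2 (λ a b → :- (a :- b) := b :- a) refl p q))
    where open +-*-Solver

  p≤∣p∣ : ∀ p → p ≤ ∣ p ∣
  p≤∣p∣ p with ≤-total 0ℚ p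
  ... | inj₁ 0≤p = ≤-reflexive (sym (0≤p⇒∣p∣≡p 0≤p))
  ... | inj₂ p≤0 = ≤-trans p≤0 (0≤∣p∣ p)

  ∣∣≤ : ∀ {p r} → p ≤ r → - p ≤ r → ∣ p ∣ ≤ r
  ∣∣≤ {p} {r} p≤r -p≤r with ∣p∣≡p∨∣p∣≡-p p
  ... | inj₁ e = subst (_≤ r) (sym e) p≤r
  ... | inj₂ e = subst (_≤ r) (sym e) -p≤r

  p≤q+r⇒p-q≤r : ∀ {p q r} → p ≤ q + r → p - q ≤ r
  p≤q+r⇒p-q≤r {p} {q} {r} h = ≤-trans (+-monoˡ-≤ (- q) h)
    (≤-reflexive (solve 2 (λ a b → a :+ b :- a := b) refl q r))
    where open +-*-Solver

  p-q≤r⇒p≤q+r : ∀ {p q r} → p - q ≤ r → p ≤ q + r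
  p-q≤r⇒p≤q+r {p} {q} {r} h = ≤-trans
    (≤-reflexive (solve 2 (λ a b → a := b :+ (a :- b)) refl p q)) (+-monoʳ-≤ q h)
    where open +-*-Solver

  ∣-∣≤⇒ : ∀ {p q r} → ∣ p - q ∣ ≤ r → p ≤ q + r
  ∣-∣≤⇒ {p} {q} h = p-q≤r⇒p≤q+r (≤-trans (p≤∣p∣ (p - q)) h)

  ∣-∣≤⁺ : ∀ {p q r} → p ≤ q + r → q ≤ p + r → ∣ p - q ∣ ≤ r
  ∣-∣≤⁺ {p} {q} {r} h₁ h₂ = ∣∣≤ (p≤q+r⇒p-q≤r h₁)
    (subst (_≤ r) (solve 2 (λ a b → b :- a := :- (a :- b)) refl p q) (p≤q+r⇒p-q≤r h₂))
    where open +-*-Solver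

  ∣+-+∣≤ : ∀ p q p′ q′ → ∣ (p + q) - (p′ + q′) ∣ ≤ ∣ p - p′ ∣ + ∣ q - q′ ∣
  ∣+-+∣≤ p q p′ q′ = subst (_≤ ∣ p - p′ ∣ + ∣ q - q′ ∣)
    (cong ∣_∣ (solve 4 (λ a b c d → (a :- c) :+ (b :- d) := (a :+ b) :- (c :+ d)) refl p q p′ q′))
    (∣p+q∣≤∣p∣+∣q∣ (p - p′) (q - q′))
    where open +-*-Solver

  ∣*-*∣≤ : ∀ p q p′ q′ → ∣ p * q - p′ * q′ ∣ ≤ ∣ p ∣ * ∣ q - q′ ∣ + ∣ q′ ∣ * ∣ p - p′ ∣
  ∣*-*∣≤ p q p′ q′ = subst₂ _≤_
    (cong ∣_∣ (solve 4 (λ a b c d → a :* (b :- d) :+ d :* (a :- c) := a :* b :- c :* d) refl p q p′ q′))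
    (cong₂ _+_ (∣p*q∣≡∣p∣*∣q∣ p (q - q′)) (∣p*q∣≡∣p∣*∣q∣ q′ (p - p′)))
    (∣p+q∣≤∣p∣+∣q∣ (p * (q - q′)) (q′ * (p - p′)))
    where open +-*-Solver

  ∣∣-lipschitz : ∀ p q → ∣ ∣ p ∣ - ∣ q ∣ ∣ ≤ ∣ p - q ∣
  ∣∣-lipschitz p q = ∣-∣≤⁺ (half p q) (subst (λ z → ∣ q ∣ ≤ ∣ p ∣ + z) (∣-∣-sym q p) (half q p))
    where
    open +-*-Solver
    half : ∀ a b → ∣ a ∣ ≤ ∣ b ∣ + ∣ a - b ∣
    half a b = subst (_≤ ∣ b ∣ + ∣ a - b ∣)
      (cong ∣_∣ (solve 2 (λ x y → y :+ (x :- y) := x) refl a b)) (∣p+q∣≤∣p∣+∣q∣ b (a - b))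

  ⊔-lipschitz : ∀ c p q → ∣ (p ⊔ c) - (q ⊔ c) ∣ ≤ ∣ p - q ∣
  ⊔-lipschitz c p q = ∣-∣≤⁺ (half p q) (subst (λ z → q ⊔ c ≤ p ⊔ c + z) (∣-∣-sym q p) (half q p))
    where
    half : ∀ a b → a ⊔ c ≤ b ⊔ c + ∣ a - b ∣
    half a b = ⊔-lub
      (≤-trans (∣-∣≤⇒ {a} {b} ≤-refl) (+-monoˡ-≤ ∣ a - b ∣ (p≤p⊔q b c)))
      (≤-trans (p≤q⊔p b c) (≤-trans (≤-reflexive (sym (+-identityʳ (b ⊔ c))))
        (+-monoʳ-≤ (b ⊔ c) (0≤∣p∣ (a - b)))))

  recip : ∀ p → 0ℚ < p → ℚ
  recip p 0<p = (1/ p) ⦃ >-nonZero 0<p ⦄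

  *-recip : ∀ p 0<p → p * recip p 0<p ≡ 1ℚ
  *-recip p 0<p = *-inverseʳ p ⦃ >-nonZero 0<p ⦄

  0<recip : ∀ p 0<p → 0ℚ < recip p 0<p
  0<recip p 0<p = positive⁻¹ (recip p 0<p) ⦃ 1/pos⇒pos p ⦃ positive 0<p ⦄ ⦄

  recip-antimono : ∀ {p q} 0<p 0<q → p ≤ q → recip q 0<q ≤ recip p 0<p
  recip-antimono {p} {q} 0<p 0<q p≤q = subst₂ _≤_
    (trans (cong (_* recip q 0<q) (trans (*-comm (recip p 0<p) p) (*-recip p 0<p)))
      (*-identityˡ (recip q 0<q)))
    (trans (*-assoc (recip p 0<p) q (recip q 0<q))
      (trans (cong (recip p 0<p *_) (*-recip q 0<q)) (*-identityʳ (recip p 0<p))))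
    (*-monoʳ-≤-nonNeg (recip q 0<q) ⦃ nonNegative (<⇒≤ (0<recip q 0<q)) ⦄
      (*-monoˡ-≤-nonNeg (recip p 0<p) ⦃ nonNegative (<⇒≤ (0<recip p 0<p)) ⦄ p≤q))

  recip-lipschitz : ∀ {c p q} 0<c 0<p 0<q → c ≤ p → c ≤ q →
                    ∣ recip p 0<p - recip q 0<q ∣ ≤ recip c 0<c * recip c 0<c * ∣ p - q ∣
  recip-lipschitz {c} {p} {q} 0<c 0<p 0<q c≤p c≤q = subst (_≤ w * w * ∣ p - q ∣) e
    (*-monoʳ-≤-nonNeg ∣ p - q ∣ ⦃ nonNegative (0≤∣p∣ (p - q)) ⦄
      (*-mono (<⇒≤ (0<recip p 0<p)) (<⇒≤ (0<recip c 0<c))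
        (recip-antimono 0<c 0<p c≤p) (recip-antimono 0<c 0<q c≤q)))
    where
    open +-*-Solver
    u = recip p 0<p
    v = recip q 0<q
    w = recip c 0<c
    e′ : u * v * (q - p) ≡ u - v
    e′ = trans (solve 4 (λ a b x y → a :* b :* (y :- x) := a :* (y :* b) :- b :* (x :* a)) refl u v p q)
      (trans (cong₂ (λ y z → u * y - v * z) (*-recip q 0<q) (*-recip p 0<p))
        (cong₂ _-_ (*-identityʳ u) (*-identityʳ v)))
    e : u * v * ∣ p - q ∣ ≡ ∣ u - v ∣
    e = trans (cong₂ _*_ (sym (0≤p⇒∣p∣≡p (<⇒≤ (0<recip p 0<p *>0 0<recip q 0<q)))) (∣-∣-sym p q))
      (trans (sym (∣p*q∣≡∣p∣*∣q∣ (u * v) (q - p))) (cong ∣_∣ e′))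

  shrink : ∀ A ε → 0ℚ < A → 0ℚ < ε → ∃[ δ ] 0ℚ < δ × A * δ ≡ ε
  shrink A ε 0<A 0<ε = recip A 0<A * ε , 0<recip A 0<A *>0 0<ε ,
    trans (sym (*-assoc A (recip A 0<A) ε)) (trans (cong (_* ε) (*-recip A 0<A)) (*-identityˡ ε))

  archimedean : ∀ p → ∃[ n ] p ≤ fraction n 1
  archimedean p@(mkℚ (+ n) d _) = n , subst (_≤ fraction n 1) (↥p/↧p≡p p)
    (fraction-mono n d n 0 (ℕ.*-monoʳ-≤ n (ℕ.s≤s ℕ.z≤n)))
  archimedean p@(mkℚ -[1+ n ] d _) = 0 , <⇒≤ (negative⁻¹ p)

  archimedean-step : ∀ p δ → 0ℚ < δ → ∃[ n ] p ≤ fraction n 1 * δ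
  archimedean-step p δ 0<δ with archimedean (p * recip δ 0<δ)
  ... | n , h = n , subst (_≤ fraction n 1 * δ) e (*-monoʳ-≤-nonNeg δ ⦃ nonNegative (<⇒≤ 0<δ) ⦄ h)
    where
    e : p * recip δ 0<δ * δ ≡ p
    e = trans (*-assoc p (recip δ 0<δ) δ)
      (trans (cong (p *_) (trans (*-comm (recip δ 0<δ) δ) (*-recip δ 0<δ))) (*-identityʳ p))

  1/suc≤ : ∀ ε → 0ℚ < ε → ∃[ N ] ∀ n → N ℕ.≤ n → fraction 1 (suc n) ≤ ε
  1/suc≤ p@(mkℚ (+ suc a) d _) _ = d , λ n d≤n → subst (fraction 1 (suc n) ≤_) (↥p/↧p≡p p)
    (fraction-mono 1 n (suc a) d (ℕ.≤-trans (ℕ.≤-reflexive (ℕ.*-identityˡ (suc d)))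
      (ℕ.≤-trans (ℕ.s≤s d≤n) (ℕ.m≤m+n (suc n) (a ℕ.* suc n)))))
  1/suc≤ p@(mkℚ (+ zero) _ _)   0<p = contradiction (nonPositive⁻¹ p) (<⇒≱ 0<p)
  1/suc≤ p@(mkℚ -[1+ _ ] _ _)   0<p = contradiction (<⇒≤ (negative⁻¹ p)) (<⇒≱ 0<p)

  if-elim : ∀ {A : Set} {x y} (P : ℚ → Set) (A? : Dec A) → (A → P x) → (¬ A → P y) →
            P (if does A? then x else y)
  if-elim P (yes a) f g = f a
  if-elim P (no ¬a) f g = g ¬a

  -- The largest multiple r = k δ with k ≤ B and r² ≤ p.
  root : ℚ → ℚ → ℕ → ℚ
  root p δ zero    = 0ℚ
  root p δ (suc B) =
    let r = root p δ B in if does ((r + δ) * (r + δ) ≤? p) then r + δ else r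

  module _ {p δ} (0≤p : 0ℚ ≤ p) (0<δ : 0ℚ < δ) where

    0≤root : ∀ B → 0ℚ ≤ root p δ B
    0≤root zero = ≤-refl
    0≤root (suc B) = if-elim (0ℚ ≤_) ((root p δ B + δ) * (root p δ B + δ) ≤? p)
      (λ _ → _+≥0_ {root p δ B} {δ} (0≤root B) (<⇒≤ 0<δ)) (λ _ → 0≤root B)

    root²≤ : ∀ B → root p δ B * root p δ B ≤ p
    root²≤ zero = 0≤p
    root²≤ (suc B) = if-elim (λ r → r * r ≤ p) ((root p δ B + δ) * (root p δ B + δ) ≤? p)
      (λ h → h) (λ _ → root²≤ B)

    root-max : ∀ B → p < (root p δ B + δ) * (root p δ B + δ) ⊎ root p δ B ≡ fraction B 1 * δ
    root-max zero = inj₂ (sym (*-zeroˡ δ))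
    root-max (suc B) = if-elim (λ r → p < (r + δ) * (r + δ) ⊎ r ≡ fraction (suc B) 1 * δ)
      ((root p δ B + δ) * (root p δ B + δ) ≤? p) (λ h → inj₂ (next h (root-max B)))
      (λ h → inj₁ (≰⇒> h))
      where
      open +-*-Solver
      next : (root p δ B + δ) * (root p δ B + δ) ≤ p →
             p < (root p δ B + δ) * (root p δ B + δ) ⊎ root p δ B ≡ fraction B 1 * δ →
             root p δ B + δ ≡ fraction (suc B) 1 * δ
      next h (inj₁ g) = contradiction h (<⇒≱ g)
      next h (inj₂ e) = trans (cong (_+ δ) e)
        (trans (solve 2 (λ b d → b :* d :+ d := (con 1ℚ :+ b) :* d) refl (fraction B 1) δ)
          (cong (_* δ) (sym (fromℕ-suc B))))

    root< : ∀ B → 1ℚ + p ≤ fraction B 1 * δ → p < (root p δ B + δ) * (root p δ B + δ)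
    root< B h with root-max B
    ... | inj₁ g = g
    ... | inj₂ e = contradiction (root²≤ B) (<⇒≱ (<-≤-trans p<1+p² (subst (λ z → (1ℚ + p) * (1ℚ + p) ≤ z * z) (sym e)
           (*-mono 0≤1+p (≤-trans 0≤1+p h) h h))))
      where
      open +-*-Solver
      0≤1+p : 0ℚ ≤ 1ℚ + p
      0≤1+p = <⇒≤ (0<1/suc 0) +≥0 0≤p
      p<1+p² : p < (1ℚ + p) * (1ℚ + p)
      p<1+p² = subst₂ _<_ (+-identityʳ p)
        (solve 1 (λ x → x :+ (con 1ℚ :+ (x :+ x :* x)) := (con 1ℚ :+ x) :* (con 1ℚ :+ x)) refl p)
        (+-monoʳ-< p (+-mono-<-≤ (0<1/suc 0) (0≤p +≥0 0≤p *≥0 0≤p)))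

  rootBound : ∀ p δ → 0ℚ < δ → ℕ
  rootBound p δ 0<δ = proj₁ (archimedean-step (1ℚ + p) δ 0<δ)

  opaque
    -- √p rounded down to a multiple of 1 / (n + 1).
    approxRoot : ℚ → ℕ → ℚ
    approxRoot p n = root p (fraction 1 (suc n)) (rootBound p (fraction 1 (suc n)) (0<1/suc n))

    0≤approxRoot : ∀ {p} → 0ℚ ≤ p → ∀ n → 0ℚ ≤ approxRoot p n
    0≤approxRoot {p} 0≤p n = 0≤root 0≤p (0<1/suc n) (rootBound p (fraction 1 (suc n)) (0<1/suc n))

    approxRoot²≤ : ∀ {p} → 0ℚ ≤ p → ∀ n → approxRoot p n * approxRoot p n ≤ p
    approxRoot²≤ {p} 0≤p n = root²≤ 0≤p (0<1/suc n) (rootBound p (fraction 1 (suc n)) (0<1/suc n))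

    approxRoot< : ∀ {p} → 0ℚ ≤ p → ∀ n →
      p < (approxRoot p n + fraction 1 (suc n)) * (approxRoot p n + fraction 1 (suc n))
    approxRoot< {p} 0≤p n = root< 0≤p (0<1/suc n) (rootBound p (fraction 1 (suc n)) (0<1/suc n))
      (proj₂ (archimedean-step (1ℚ + p) (fraction 1 (suc n)) (0<1/suc n)))

  root-close : ∀ {p q r s δ ε} → 0ℚ < ε → 0ℚ ≤ δ → 0ℚ ≤ s → r * r ≤ p → q < (s + δ) * (s + δ) →
               δ ≤ ½ * ε → p ≤ q + ½ * ε * (½ * ε) → r ≤ s + ε
  root-close {p} {q} {r} {s} {δ} {ε} 0<ε 0≤δ 0≤s r²≤p q<s+δ² δ≤ p≤q+ = ≮⇒≥ λ s+ε<r →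
    contradiction (≤-trans (*-mono 0≤s+ε (≤-trans 0≤s+ε (<⇒≤ s+ε<r)) (<⇒≤ s+ε<r) (<⇒≤ s+ε<r)) r²≤p)
      (<⇒≱ p<)
    where
    open +-*-Solver
    η = ½ * ε
    0≤η : 0ℚ ≤ η
    0≤η = <⇒≤ (0<½ *>0 0<ε)
    0≤s+ε : 0ℚ ≤ s + ε
    0≤s+ε = 0≤s +≥0 <⇒≤ 0<ε
    s+δ≤ : s + δ ≤ s + η
    s+δ≤ = +-monoʳ-≤ s δ≤
    expand : (s + η) * (s + η) + η * η + (s * (η + η) + (η * η + η * η)) ≡ (s + (η + η)) * (s + (η + η))
    expand = solve 2 (λ a e → (a :+ e) :* (a :+ e) :+ e :* e :+ (a :* (e :+ e) :+ (e :* e :+ e :* e))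
      := (a :+ (e :+ e)) :* (a :+ (e :+ e))) refl s η
    p< : p < (s + ε) * (s + ε)
    p< = ≤-<-trans p≤q+ (<-≤-trans (+-monoˡ-< (η * η) (<-≤-trans q<s+δ²
      (*-mono (0≤s +≥0 0≤δ) (0≤s +≥0 0≤η) s+δ≤ s+δ≤)))
      (subst₂ _≤_ (+-identityʳ _) (trans expand (cong (λ z → (s + z) * (s + z)) (half+half ε)))
        (+-monoʳ-≤ ((s + η) * (s + η) + η * η)
          (0≤s *≥0 (0≤η +≥0 0≤η) +≥0 (0≤η *≥0 0≤η +≥0 0≤η *≥0 0≤η)))))

  product-close : ∀ {p q p′ q′ A B α β ε} → A * α ≡ ½ * ε → B * β ≡ ½ * ε → 0ℚ < α → 0ℚ < β →
                  ∣ p ∣ ≤ A → ∣ q′ ∣ ≤ B → ∣ q - q′ ∣ ≤ α → ∣ p - p′ ∣ ≤ β → ∣ p * q - p′ * q′ ∣ ≤ ε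
  product-close {p} {q} {p′} {q′} {A} {B} {α} {β} {ε} Aα Bβ 0<α 0<β p≤ q≤ q-q≤ p-p≤ = ≤-trans
    (∣*-*∣≤ p q p′ q′)
    (≤-trans (+-mono-≤
      (*-mono {∣ p ∣} {A} {∣ q - q′ ∣} {α} (0≤∣p∣ p) (<⇒≤ 0<α) p≤ q-q≤)
      (*-mono {∣ q′ ∣} {B} {∣ p - p′ ∣} {β} (0≤∣p∣ q′) (<⇒≤ 0<β) q≤ p-p≤))
    (≤-reflexive (trans (cong₂ _+_ Aα Bβ) (half+half ε))))

  square-close : ∀ {p r d A δ ε} → 0ℚ ≤ r → r ≤ A → 0ℚ ≤ d → d ≤ 1ℚ → d ≤ δ →
                 p < (r + d) * (r + d) → (A + A + 1ℚ) * δ ≡ ε → p ≤ r * r + ε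
  square-close {p} {r} {d} {A} {δ} {ε} 0≤r r≤A 0≤d d≤1 d≤δ p< Aδ = <⇒≤ (<-≤-trans p<
    (≤-trans (≤-reflexive (solve 2 (λ a b → (a :+ b) :* (a :+ b) := a :* a :+ (a :+ a :+ b) :* b) refl r d))
      (+-monoʳ-≤ (r * r) (≤-trans
        (*-mono (_+≥0_ {r + r} {d} (_+≥0_ {r} {r} 0≤r 0≤r) 0≤d)
          (≤-trans 0≤d d≤δ) (+-mono-≤ (+-mono-≤ r≤A r≤A) d≤1) d≤δ)
        (≤-reflexive Aδ)))))
    where open +-*-Solver

open RationalLemmas public

module CauchySequences where
  open Rat
  open Ratₚ

  Cauchy : (ℕ → ℚ) → Set
  Cauchy x = ∀ ε → 0ℚ < ε → ∃[ N ] ∀ m n → N ℕ.≤ m → N ℕ.≤ n → ∣ x m - x n ∣ ≤ ε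

  const-cauchy : ∀ q → Cauchy (λ _ → q)
  const-cauchy q ε 0<ε = 0 , λ _ _ _ _ →
    subst (λ z → ∣ z ∣ ≤ ε) (sym (+-inverseʳ q)) (<⇒≤ 0<ε)

  lipschitz-cauchy : ∀ {x y : ℕ → ℚ} K → 0ℚ < K → Cauchy x →
    ∃[ N ] (∀ m n → N ℕ.≤ m → N ℕ.≤ n → ∣ y m - y n ∣ ≤ K * ∣ x m - x n ∣) → Cauchy y
  lipschitz-cauchy {x} K 0<K cx (N , lip) ε 0<ε =
    let δ , 0<δ , Kδ≡ε = shrink K ε 0<K 0<ε
        M , close = cx δ 0<δ
    in N ℕ.⊔ M , λ m n m≥ n≥ → ≤-trans
    (lip m n (ℕ.m⊔n≤o⇒m≤o N M m≥) (ℕ.m⊔n≤o⇒m≤o N M n≥))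
    (≤-trans (*-monoˡ-≤-nonNeg K ⦃ nonNegative (<⇒≤ 0<K) ⦄
        (close m n (ℕ.m⊔n≤o⇒n≤o N M m≥) (ℕ.m⊔n≤o⇒n≤o N M n≥)))
      (≤-reflexive Kδ≡ε))

  +-cauchy : ∀ {x y} → Cauchy x → Cauchy y → Cauchy (λ n → x n + y n)
  +-cauchy {x} {y} cx cy ε 0<ε =
    let N , hx = cx (½ * ε) (0<½ *>0 0<ε)
        M , hy = cy (½ * ε) (0<½ *>0 0<ε)
    in N ℕ.⊔ M , λ m n m≥ n≥ → ≤-trans
    (∣+-+∣≤ (x m) (y m) (x n) (y n))
    (≤-trans (+-mono-≤ (hx m n (ℕ.m⊔n≤o⇒m≤o N M m≥) (ℕ.m⊔n≤o⇒m≤o N M n≥))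
                       (hy m n (ℕ.m⊔n≤o⇒n≤o N M m≥) (ℕ.m⊔n≤o⇒n≤o N M n≥)))
      (≤-reflexive (half+half ε)))

  neg-cauchy : ∀ {x} → Cauchy x → Cauchy (λ n → - x n)
  neg-cauchy {x} cx ε 0<ε with cx ε 0<ε
  ... | N , h = N , λ m n m≥ n≥ → subst (_≤ ε)
    (trans (sym (∣-p∣≡∣p∣ (x m - x n)))
      (cong ∣_∣ (solve 2 (λ a b → :- (a :- b) := :- a :- :- b) refl (x m) (x n))))
    (h m n m≥ n≥)
    where open +-*-Solver

  ∣∣-cauchy : ∀ {x} → Cauchy x → Cauchy (λ n → ∣ x n ∣)
  ∣∣-cauchy {x} cx ε 0<ε with cx ε 0<ε
  ... | N , h = N , λ m n m≥ n≥ → ≤-trans (∣∣-lipschitz (x m) (x n)) (h m n m≥ n≥)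

  bounded : ∀ {x} → Cauchy x → ∃[ A ] 0ℚ < A × ∃[ N ] ∀ n → N ℕ.≤ n → ∣ x n ∣ ≤ A
  bounded {x} cx with cx 1ℚ (0<1/suc 0)
  ... | N , h = 1ℚ + ∣ x N ∣ ,
    <-≤-trans (0<1/suc 0) (≤-trans (≤-reflexive (sym (+-identityʳ 1ℚ))) (+-monoʳ-≤ 1ℚ (0≤∣p∣ (x N)))) ,
    N , λ n n≥ → ≤-trans
      (≤-reflexive (cong ∣_∣ (solve 2 (λ a b → a := (a :- b) :+ b) refl (x n) (x N))))
      (≤-trans (∣p+q∣≤∣p∣+∣q∣ (x n - x N) (x N)) (+-monoˡ-≤ ∣ x N ∣ (h n N n≥ ℕ.≤-refl)))
    where open +-*-Solver

  *-cauchy : ∀ {x y} → Cauchy x → Cauchy y → Cauchy (λ n → x n * y n)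
  *-cauchy {x} {y} cx cy ε 0<ε =
    let A , 0<A , N₁ , hA = bounded cx
        B , 0<B , N₂ , hB = bounded cy
        α , 0<α , Aα = shrink A (½ * ε) 0<A (0<½ *>0 0<ε)
        β , 0<β , Bβ = shrink B (½ * ε) 0<B (0<½ *>0 0<ε)
        N₃ , hy = cy α 0<α
        N₄ , hx = cx β 0<β
        N₁₂ = N₁ ℕ.⊔ N₂
        N₃₄ = N₃ ℕ.⊔ N₄
    in N₁₂ ℕ.⊔ N₃₄ , λ m n m≥ n≥ →
      let m₁₂ = ℕ.m⊔n≤o⇒m≤o N₁₂ N₃₄ m≥ ; m₃₄ = ℕ.m⊔n≤o⇒n≤o N₁₂ N₃₄ m≥
          n₁₂ = ℕ.m⊔n≤o⇒m≤o N₁₂ N₃₄ n≥ ; n₃₄ = ℕ.m⊔n≤o⇒n≤o N₁₂ N₃₄ n≥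
      in product-close {x m} {y m} {x n} {y n} {A} {B} {α} {β} {ε} Aα Bβ 0<α 0<β
        (hA m (ℕ.m⊔n≤o⇒m≤o N₁ N₂ m₁₂)) (hB n (ℕ.m⊔n≤o⇒n≤o N₁ N₂ n₁₂))
        (hy m n (ℕ.m⊔n≤o⇒m≤o N₃ N₄ m₃₄) (ℕ.m⊔n≤o⇒m≤o N₃ N₄ n₃₄))
        (hx m n (ℕ.m⊔n≤o⇒n≤o N₃ N₄ m₃₄) (ℕ.m⊔n≤o⇒n≤o N₃ N₄ n₃₄))

  max0 : ℚ → ℚ
  max0 p = p ⊔ 0ℚ

  0≤max0 : ∀ p → 0ℚ ≤ max0 p
  0≤max0 p = p≤q⊔p p 0ℚ

  √-seq : (ℕ → ℚ) → ℕ → ℚ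
  √-seq x n = approxRoot (max0 (x n)) n

  0≤√-seq : ∀ x n → 0ℚ ≤ √-seq x n
  0≤√-seq x n = 0≤approxRoot (0≤max0 (x n)) n

  √-seq²≤ : ∀ x n → √-seq x n * √-seq x n ≤ max0 (x n)
  √-seq²≤ x n = approxRoot²≤ (0≤max0 (x n)) n

  √-cauchy : ∀ {x} → Cauchy x → Cauchy (√-seq x)
  √-cauchy {x} cx ε 0<ε =
    let N , small = 1/suc≤ (½ * ε) (0<½ *>0 0<ε)
        M , close = cx (½ * ε * (½ * ε)) (0<½ *>0 0<ε *>0 (0<½ *>0 0<ε))
    in N ℕ.⊔ M , λ m n m≥ n≥ → ∣-∣≤⁺
      (half m n (small n (ℕ.m⊔n≤o⇒m≤o N M n≥)) (close m n (ℕ.m⊔n≤o⇒n≤o N M m≥) (ℕ.m⊔n≤o⇒n≤o N M n≥)))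
      (half n m (small m (ℕ.m⊔n≤o⇒m≤o N M m≥)) (close n m (ℕ.m⊔n≤o⇒n≤o N M n≥) (ℕ.m⊔n≤o⇒n≤o N M m≥)))
    where
    half : ∀ m n → fraction 1 (suc n) ≤ ½ * ε → ∣ x m - x n ∣ ≤ ½ * ε * (½ * ε) →
           √-seq x m ≤ √-seq x n + ε
    half m n small c = root-close {max0 (x m)} {max0 (x n)} 0<ε (<⇒≤ (0<1/suc n)) (0≤√-seq x n) (√-seq²≤ x m)
      (approxRoot< (0≤max0 (x n)) n) small
      (∣-∣≤⇒ {max0 (x m)} {max0 (x n)} (≤-trans (⊔-lipschitz 0ℚ (x m) (x n)) c))

  √-seq-square : ∀ {x} → Cauchy x → ∀ ε → 0ℚ < ε →
    ∃[ N ] ∀ n → N ℕ.≤ n → max0 (x n) ≤ √-seq x n * √-seq x n + ε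
  √-seq-square {x} cx ε 0<ε =
    let A , 0<A , N , hA = bounded (√-cauchy {x} cx)
        δ , 0<δ , Aδ = shrink (A + A + 1ℚ) ε (0<A+A+1 A 0<A) 0<ε
        M , small = 1/suc≤ δ 0<δ
    in N ℕ.⊔ M , λ n n≥ → square-close {max0 (x n)} {√-seq x n} {fraction 1 (suc n)} {A} {δ} {ε}
      (0≤√-seq x n) (≤-trans (p≤∣p∣ (√-seq x n)) (hA n (ℕ.m⊔n≤o⇒m≤o N M n≥)))
      (<⇒≤ (0<1/suc n)) (fraction-mono 1 n 1 0 (ℕ.s≤s ℕ.z≤n))
      (small n (ℕ.m⊔n≤o⇒n≤o N M n≥)) (approxRoot< (0≤max0 (x n)) n) Aδ
    where
    0<A+A+1 : ∀ A → 0ℚ < A → 0ℚ < A + A + 1ℚ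
    0<A+A+1 A 0<A = positive⁻¹ (A + A + 1ℚ)
      ⦃ pos+pos⇒pos (A + A) ⦃ pos+pos⇒pos A ⦃ positive 0<A ⦄ A ⦃ positive 0<A ⦄ ⦄ 1ℚ ⦄

  √-seq-positive : ∀ {x} ε → 0ℚ < ε → ∃[ N ] (∀ n → N ℕ.≤ n → ε ≤ x n) →
    ∃[ δ ] 0ℚ < δ × ∃[ M ] ∀ n → M ℕ.≤ n → δ ≤ √-seq x n
  √-seq-positive {x} ε 0<ε (N , h) = c , 0<c , N ℕ.⊔ proj₁ small , λ n n≥ → ≮⇒≥ λ r<c →
    contradiction (p≤p⊔q (x n) 0ℚ) (<⇒≱
      (<-≤-trans (approxRoot< (0≤max0 (x n)) n)
        (≤-trans (*-mono (_+≥0_ {√-seq x n} {fraction 1 (suc n)} (0≤√-seq x n) (<⇒≤ (0<1/suc n)))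
                   0≤e (r+d≤e n n≥ r<c) (r+d≤e n n≥ r<c))
          (≤-trans e²≤ε (h n (ℕ.m⊔n≤o⇒m≤o N (proj₁ small) n≥))))))
    where
    e = ε ⊓ 1ℚ
    0<e : 0ℚ < e
    0<e with ⊓-sel ε 1ℚ
    ... | inj₁ q = subst (0ℚ <_) (sym q) 0<ε
    ... | inj₂ q = subst (0ℚ <_) (sym q) (0<1/suc 0)
    0≤e = <⇒≤ 0<e
    c = ½ * e
    0<c = 0<½ *>0 0<e
    small = 1/suc≤ c 0<c
    e²≤ε : e * e ≤ ε
    e²≤ε = ≤-trans (*-mono 0≤e (<⇒≤ (0<1/suc 0)) (p⊓q≤p ε 1ℚ) (p⊓q≤q ε 1ℚ)) (≤-reflexive (*-identityʳ ε))
    r+d≤e : ∀ n → N ℕ.⊔ proj₁ small ℕ.≤ n → √-seq x n < c → √-seq x n + fraction 1 (suc n) ≤ e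
    r+d≤e n n≥ r<c = ≤-trans
      (+-mono-≤ (<⇒≤ r<c) (proj₂ small n (ℕ.m⊔n≤o⇒n≤o N (proj₁ small) n≥)))
      (≤-reflexive (half+half e))

  ⊔-positive : ∀ {c} → 0ℚ < c → ∀ p → 0ℚ < p ⊔ c
  ⊔-positive {c} 0<c p = <-≤-trans 0<c (p≤q⊔p p c)

  recip-seq : (ℕ → ℚ) → ∀ c → 0ℚ < c → ℕ → ℚ
  recip-seq x c 0<c n = recip (x n ⊔ c) (⊔-positive 0<c (x n))

  recip-cauchy : ∀ {x c} 0<c → Cauchy x → Cauchy (recip-seq x c 0<c)
  recip-cauchy {x} {c} 0<c cx = lipschitz-cauchy {x} {recip-seq x c 0<c} (w * w) (0<w *>0 0<w) cx (0 , λ m n _ _ → ≤-trans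
    (recip-lipschitz 0<c (⊔-positive 0<c (x m)) (⊔-positive 0<c (x n)) (p≤q⊔p (x m) c) (p≤q⊔p (x n) c))
    (*-monoˡ-≤-nonNeg (w * w) ⦃ nonNegative (<⇒≤ (0<w *>0 0<w)) ⦄ (⊔-lipschitz c (x m) (x n))))
    where
    w = recip c 0<c
    0<w = 0<recip c 0<c

open CauchySequences public

record ℝ : Set where
  constructor mkℝ
  field
    seq    : ℕ → ℚ
    cauchy : Cauchy seq

open ℝ public

infix 4 _≈_ _≤_ _<_

_≈_ : ℝ → ℝ → Set
x ≈ y = ∀ ε → 0ℚ Rat.< ε → ∃[ N ] ∀ n → N ℕ.≤ n → Rat.∣ seq x n Rat.- seq y n ∣ Rat.≤ ε

_≤_ : ℝ → ℝ → Set
x ≤ y = ∀ ε → 0ℚ Rat.< ε → ∃[ N ] ∀ n → N ℕ.≤ n → seq x n Rat.≤ seq y n Rat.+ ε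

_<_ : ℝ → ℝ → Set
x < y = ∃[ ε ] 0ℚ Rat.< ε × ∃[ N ] ∀ n → N ℕ.≤ n → seq x n Rat.+ ε Rat.≤ seq y n

ι : ℚ → ℝ
ι q = mkℝ (λ _ → q) (const-cauchy q)

fromℕ : ℕ → ℝ
fromℕ n = ι (fraction n 1)

0ℝ 1ℝ : ℝ
0ℝ = fromℕ 0
1ℝ = fromℕ 1

infix  8 -_
infixl 7 _*_
infixl 6 _+_ _-_

_+_ : ℝ → ℝ → ℝ
x + y = mkℝ (λ n → seq x n Rat.+ seq y n) (+-cauchy {seq x} {seq y} (cauchy x) (cauchy y))

-_ : ℝ → ℝ
- x = mkℝ (λ n → Rat.- seq x n) (neg-cauchy {seq x} (cauchy x))

_-_ : ℝ → ℝ → ℝ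
x - y = x + - y

_*_ : ℝ → ℝ → ℝ
x * y = mkℝ (λ n → seq x n Rat.* seq y n) (*-cauchy {seq x} {seq y} (cauchy x) (cauchy y))

∣_∣ : ℝ → ℝ
∣ x ∣ = mkℝ (λ n → Rat.∣ seq x n ∣) (∣∣-cauchy {seq x} (cauchy x))

-- √ x is 0 for negative x.
infix 9 √_
√_ : ℝ → ℝ
√ x = mkℝ (√-seq (seq x)) (√-cauchy {seq x} (cauchy x))

inverse : ∀ x → 0ℝ < x → ℝ
inverse x (c , 0<c , _) = mkℝ (recip-seq (seq x) c 0<c) (recip-cauchy {seq x} 0<c (cauchy x))

ι-mono-≤ : ∀ {p q} → p Rat.≤ q → ι p ≤ ι q
ι-mono-≤ {p} {q} p≤q ε 0<ε = 0 , λ _ _ → Ratₚ.≤-trans p≤q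
  (Ratₚ.≤-trans (Ratₚ.≤-reflexive (sym (Ratₚ.+-identityʳ q))) (Ratₚ.+-monoʳ-≤ q (Ratₚ.<⇒≤ 0<ε)))

0<⇒ : ∀ {x ε} → 0ℚ Rat.< ε → ∃[ N ] (∀ n → N ℕ.≤ n → ε Rat.≤ seq x n) → 0ℝ < x
0<⇒ {x} {ε} 0<ε (N , h) = ε , 0<ε , N , λ n n≥ →
  Ratₚ.≤-trans (Ratₚ.≤-reflexive (Ratₚ.+-identityˡ ε)) (h n n≥)

⇒0< : ∀ {x} ((ε , _) : 0ℝ < x) → ∃[ N ] ∀ n → N ℕ.≤ n → ε Rat.≤ seq x n
⇒0< {x} (ε , 0<ε , N , h) = N , λ n n≥ →
  Ratₚ.≤-trans (Ratₚ.≤-reflexive (sym (Ratₚ.+-identityˡ ε))) (h n n≥)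

√-positive : ∀ x → 0ℝ < x → 0ℝ < √ x
√-positive x 0<x =
  let δ , 0<δ , h = √-seq-positive {seq x} (proj₁ 0<x) (proj₁ (proj₂ 0<x)) (⇒0< {x} 0<x)
  in 0<⇒ {√ x} 0<δ h

√-square : ∀ x → 0ℝ ≤ x → √ x * √ x ≈ x
√-square x 0≤x ε 0<ε =
  let N , h = 0≤x ε 0<ε
      M , g = √-seq-square {seq x} (cauchy x) ε 0<ε
  in N ℕ.⊔ M , λ n n≥ →
    let r = √-seq (seq x) n in ∣-∣≤⁺
      (Ratₚ.≤-trans (√-seq²≤ (seq x) n) (Ratₚ.⊔-lub
        (Ratₚ.≤-trans (Ratₚ.≤-reflexive (sym (Ratₚ.+-identityʳ (seq x n))))
          (Ratₚ.+-monoʳ-≤ (seq x n) (Ratₚ.<⇒≤ 0<ε)))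
        (h n (ℕ.m⊔n≤o⇒m≤o N M n≥))))
      (Ratₚ.≤-trans (Ratₚ.p≤p⊔q (seq x n) 0ℚ) (g n (ℕ.m⊔n≤o⇒n≤o N M n≥)))

*-inverse : ∀ x (0<x : 0ℝ < x) → x * inverse x 0<x ≈ 1ℝ
*-inverse x 0<x@(c , 0<c , _) ε 0<ε =
  let N , h = ⇒0< {x} 0<x
  in N , λ n n≥ →
    let u = recip-seq (seq x) c 0<c n
        e : seq x n Rat.* u ≡ 1ℚ
        e = trans (cong (Rat._* u) (sym (Ratₚ.p≥q⇒p⊔q≡p (h n n≥))))
              (*-recip (seq x n Rat.⊔ c) (⊔-positive 0<c (seq x n)))
    in subst (Rat._≤ ε) (cong (λ z → Rat.∣ z Rat.- 1ℚ ∣) (sym e)) (Ratₚ.<⇒≤ 0<ε)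

1/√ : ∀ x → 0ℝ < x → ℝ
1/√ x 0<x = inverse (√ x) (√-positive x 0<x)

∑ : ∀ {n} → (Fin n → ℝ) → ℝ
∑ = foldr _+_ 0ℝ

infix 4 _⟶_

_⟶_ : (ℕ → ℝ) → ℝ → Set
x ⟶ L = ∀ ε → 0ℚ Rat.< ε → ∃[ N ] ∀ n → N ℕ.≤ n → ∣ x n - L ∣ ≤ ι ε

-- k = ⌊ x ⌋ and k = ⌈ x ⌉, for x ≥ 0; floor and ceiling are not total functions on
-- the constructive reals.
IsFloor IsCeiling : ℕ → ℝ → Set
IsFloor   k x = fromℕ k ≤ x × x < fromℕ (suc k)
IsCeiling k x = x ≤ fromℕ k × fromℕ k < x + 1ℝ

record 𝕀 : Set where
  constructor mk𝕀
  field
    val   : ℝ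
    0≤val : 0ℝ ≤ val
    val≤1 : val ≤ 1ℝ

open 𝕀 public

0𝕀 1𝕀 : 𝕀
0𝕀 = mk𝕀 0ℝ (ι-mono-≤ Ratₚ.≤-refl) (ι-mono-≤ (Ratₚ.<⇒≤ (0<1/suc 0)))
1𝕀 = mk𝕀 1ℝ (ι-mono-≤ (Ratₚ.<⇒≤ (0<1/suc 0))) (ι-mono-≤ Ratₚ.≤-refl)

-- On [0,1] continuity is uniform continuity, as usual in constructive analysis.
Continuous : (𝕀 → ℝ) → Set
Continuous f = ∀ ε → 0ℚ Rat.< ε → ∃[ δ ] 0ℚ Rat.< δ ×
  (∀ s t → ∣ val s - val t ∣ ≤ ι δ → ∣ f s - f t ∣ ≤ ι ε)

-- ∫ₐᵇ f = I, for a ≤ b: Riemann sums over equal subdivisions of [a,b], with arbitrary tags,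
-- tend to I.
Integral : (𝕀 → ℝ) → ℝ → ℝ → ℝ → Set
Integral f a b I = ∀ ε → 0ℚ Rat.< ε → ∃[ N ] ∀ n → N ℕ.≤ n →
  let node = λ i → a + fromFraction i n * (b - a) in
  (ξ : Fin n → 𝕀) → (∀ i → node (toℕ i) ≤ val (ξ i) × val (ξ i) ≤ node (suc (toℕ i))) →
  ∣ ∑ (λ i → f (ξ i)) * (fromFraction 1 n * (b - a)) - I ∣ ≤ ι ε
  where
  fromFraction : ℕ → ℕ → ℝ
  fromFraction i n = ι (fraction i n)

0<1+2x : ∀ x → 0ℝ ≤ x → 0ℝ < 1ℝ + fromℕ 2 * x
0<1+2x x 0≤x =
  let N , h = 0≤x ¼ (0<1/suc 3)
  in 0<⇒ {1ℝ + fromℕ 2 * x} 0<½ (N , λ n n≥ → lemma (seq x n) (h n n≥))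
  where
  ¼ = fraction 1 4
  lemma : ∀ q → 0ℚ Rat.≤ q Rat.+ ¼ → ½ Rat.≤ 1ℚ Rat.+ fraction 2 1 Rat.* q
  lemma q h = subst₂ Rat._≤_ refl
    (solve 1 (λ z → con ½ :+ con (fraction 2 1) :* (z :+ con ¼) := con 1ℚ :+ con (fraction 2 1) :* z) refl q)
    (Ratₚ.+-monoʳ-≤ ½ (Ratₚ.*-monoˡ-≤-nonNeg (fraction 2 1) h))
    where open +-*-Solver

1/√[1+2_] : 𝕀 → ℝ
1/√[1+2 t ] = 1/√ (1ℝ + fromℕ 2 * val t) (0<1+2x (val t) (0≤val t))

1/√3 : ℝ
1/√3 = 1/√ (fromℕ 3) (0<⇒ {fromℕ 3} (0<1/suc 0) (0 , λ _ _ → fraction-mono 1 0 3 0 (ℕ.s≤s ℕ.z≤n)))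

-- Gödel implication on the chain v₀ < ⋯ < vₘ₋₁, with vₖ represented by k : Fin m.
infixr 5 _⇒ᴳ_
_⇒ᴳ_ : ∀ {m} → Fin m → Fin m → Fin m
_⇒ᴳ_ {suc m} p q = if does (p Fin.≤? q) then Fin.fromℕ m else q

data Bracketing : ℕ → Set where
  var     : Bracketing 1
  bracket : ∀ {i j n} → i ℕ.+ j ≡ n → Bracketing i → Bracketing j → Bracketing n

evaluate : ∀ {m n} → Bracketing n → Vec (Fin m) n → Fin m
evaluate var (v ∷ [])             = v
evaluate (bracket {i} refl l r) v = evaluate l (Vec.take i v) ⇒ᴳ evaluate r (Vec.drop i v)

splits : ∀ n → List (Σ[ i ∈ ℕ ] Σ[ j ∈ ℕ ] i ℕ.+ j ≡ n)
splits zero    = (0 , 0 , refl) ∷ []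
splits (suc n) = (0 , suc n , refl) ∷ map (λ (i , j , e) → suc i , j , cong suc e) (splits n)

leaves : ∀ n → List (Bracketing n)
leaves 1 = var ∷ []
leaves _ = []

-- The bracketings with n leaves and height at most d.
bracketings≤ : ℕ → ∀ n → List (Bracketing n)
bracketings≤ zero    n = []
bracketings≤ (suc d) n = leaves n ++
  concatMap (λ (i , j , e) → cartesianProductWith (bracket e) (bracketings≤ d i) (bracketings≤ d j)) (splits n)

-- A bracketing with n leaves has height at most n.
bracketings : ∀ n → List (Bracketing n)
bracketings n = bracketings≤ n n

_ : map (λ n → length (bracketings n)) (upTo 6) ≡ 0 ∷ 1 ∷ 1 ∷ 2 ∷ 5 ∷ 14 ∷ []
_ = refl

valuations : ∀ m n → List (Vec (Fin m) n)
valuations m zero    = [] ∷ []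
valuations m (suc n) = cartesianProductWith _∷_ (allFin m) (valuations m n)

-- g m n k is gₙ⁽ᵏ⁾ for the m-element chain, and gTotal m n is gₙ.
g : ℕ → ℕ → ℕ → ℕ
g m n k = length (filter (λ (b , v) → toℕ (evaluate b v) ℕ.≟ k)
                         (cartesianProduct (bracketings n) (valuations m n)))

gTotal : ℕ → ℕ → ℕ
gTotal m n = sum (map (g m n) (upTo m))

-- p m k = lim gₙ⁽ᵏ⁾ / gₙ for all 0 ≤ k ≤ m - 1; values of p outside this range are irrelevant.
LimitingFrequencies : (ℕ → ℕ → ℝ) → Set
LimitingFrequencies p = ∀ m → 2 ℕ.≤ m → ∀ k → k ℕ.< m →
  (λ n → ι (fraction (g m n k) (gTotal m n))) ⟶ p m k

-- The value k / (m - 1) of Tₘ at Kₘ = k.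
grid : ∀ m → Fin m → 𝕀
grid m k = mk𝕀 (ι (fraction (toℕ k) (m ℕ.∸ 1)))
  (ι-mono-≤ (0≤fraction (toℕ k) (m ℕ.∸ 1))) (ι-mono-≤ (fraction≤1 {toℕ k} {m ℕ.∸ 1} (bound k)))
  where
  bound : ∀ {m} (k : Fin m) → toℕ k ℕ.≤ m ℕ.∸ 1
  bound {suc m} k = Fin.toℕ≤pred[n] k

module _ (p : ℕ → ℕ → ℝ) where

  -- q m k = Σ_{j=k}^{m-1} p m j
  q : ℕ → ℕ → ℝ
  q m k = ∑ {m ℕ.∸ k} (λ i → p m (k ℕ.+ toℕ i))

  -- Pr (Tₘ ∈ A) = v.  The order on ℝ is undecidable in general, so the decidability of
  -- the event is part of the claim.
  PrT : ℕ → Pred ℝ 0ℓ → ℝ → Set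
  PrT m A v = Σ[ A? ∈ Decidable (λ k → A (val (grid m k))) ]
    ∑ (λ k → if does (A? k) then p m (toℕ k) else 0ℝ) ≈ v

  -- ∫ f dμₘ
  𝔼T : ℕ → (𝕀 → ℝ) → ℝ
  𝔼T m f = ∑ (λ k → p m (toℕ k) * f (grid m k))

-- h dx+ w δ₁ is the measure h(x) 1_[0,1)(x) dx + w δ₁(dx); the value h(1) does not matter.
record Law : Set where
  constructor _dx+_δ₁
  field
    density : 𝕀 → ℝ
    atom    : ℝ

module _ (μ : Law) where
  open Law μ

  -- ∫ f dμ = v
  Expectation : (𝕀 → ℝ) → ℝ → Set
  Expectation f v = ∃[ I ] Integral (λ t → f t * density t) 0ℝ 1ℝ I × v ≈ I + f 1𝕀 * atom

  -- μ [t,1] = v; on [0,1] the case t = 1 is μ {1} = v.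
  Pr≥ : 𝕀 → ℝ → Set
  Pr≥ t v = ∃[ I ] Integral density (val t) 1ℝ I × v ≈ I + atom

-- Convergence in distribution of Tₘ, i.e. weak convergence of μₘ.
_⇝_ : (ℕ → ℕ → ℝ) → Law → Set
p ⇝ μ = ∀ f → Continuous f → ∃[ v ] Expectation μ f v × (λ m → 𝔼T p m f) ⟶ v

μ : Law
μ = (λ t → 1/√[1+2 t ] * 1/√[1+2 t ] * 1/√[1+2 t ]) dx+ 1/√3 δ₁

{-# OPTIONS --safe #-}

-- Put F x = 1/√(1 + 2x), so that F′ = - F³.  For a ≤ b, multiplying by F a + F b shows
-- F³ b (b - a) ≤ F a - F b ≤ F³ a (b - a); hence a Riemann sum of f F³ differs from the Stieltjes
-- sum Σ f(ξᵢ) (F xᵢ - F xᵢ₊₁) by an error that telescopes.  For f = 1 the Stieltjes sum itself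
-- telescopes, which gives the tail probabilities of the limit law.  In general it is the limit, as
-- m → ∞, of Σ f(ξᵢ) Pr (Tₘ in the i-th block), and that is close to 𝔼 f(Tₘ) without the atom at 1
-- by uniform continuity.  One Riemann sum is thus close to all late expectations: they form a
-- Cauchy sequence, and its limit is the integral.
-- For a real t the floors of t (m - 1) cannot be computed from the ceilings; instead the ceiling at
-- one large m encloses t between two grid points, whose floors are natural number divisions, and
-- monotonicity of the tails in k does the rest.

module Submission where

open import Defs
open import Algebra.Structures using (IsCommutativeRing)
open import Algebra.Solver.Ring.AlmostCommutativeRing
  using (AlmostCommutativeRing; fromCommutativeRing; _-Raw-AlmostCommutative⟶_)
import Algebra.Solver.Ring
open import Data.Bool.Base using (if_then_else_)
open import Data.Empty using (⊥)
open import Data.Fin.Base using (Fin; zero; suc; toℕ)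
import Data.Fin.Properties as Fin
open import Data.Integer.Base as ℤ using (+_)
import Data.Integer.Properties as ℤ
import Data.Integer.Solver as ℤ
open import Data.Maybe.Base using (Maybe; just; nothing)
open import Data.Nat.Base as ℕ using (ℕ; zero; suc; _∸_)
open import Data.Nat.DivMod using (_/_; m/n*n≤m; m*n/n≡m; /-monoˡ-≤; m≡m%n+[m/n]*n; m%n<n)
import Data.Nat.Properties as ℕ
open import Data.Product.Base using (∃-syntax; _×_; _,_; proj₁; proj₂)
open import Data.Rational.Base as Rat using (ℚ; 0ℚ; 1ℚ; ½)
import Data.Rational.Properties as Rat
open import Data.Rational.Solver using (module +-*-Solver)
import Data.Rational.Unnormalised.Base as ℚᵘ
import Data.Rational.Unnormalised.Properties as ℚᵘ
open import Data.Sum.Base using (_⊎_; inj₁; inj₂)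
open import Function.Base using (_∘_)
open import Level using (0ℓ)
open import Relation.Binary.PropositionalEquality
  using (_≡_; refl; sym; trans; cong; cong₂; subst; subst₂)
open import Relation.Nullary.Decidable using (Dec; yes; no; does; map′)
open import Relation.Nullary.Negation using (¬_; contradiction)
open import Relation.Unary using (Pred)

-- No derivative enters: since F² x (1 + 2x) = 1, one has F² a - F² b = 2 F² a F² b (b - a), and
-- after multiplication by F a + F b both bounds become factorisations that contain F a - F b ≥ 0.
-- The telescoped error is at most sup |f| / n, because F³ decreases inside [0,1]; the bound on f
-- has to be extracted from uniform continuity. The quantifiers are ordered, n before m: the assumed
-- limits are used at the finitely many points i / n, so how large m must be depends on n and the
-- tags, while the remaining error is controlled by n alone. This is why the integral of f F³ can be
-- obtained as a limit in m. The atom is kept apart throughout: the blocks cover the indices below m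
-- - 1, and the index m - 1 contributes f(1) times its probability. The value F 1 = 1/√3 is what the
-- integral of the density over [t,1] lacks to reach F t, and the atom supplies exactly that.

fraction-≡ : ∀ a b c d → a ℕ.* suc d ≡ c ℕ.* suc b → fraction a (suc b) ≡ fraction c (suc d)
fraction-≡ a b c d e = Rat.≤-antisym (fraction-mono a b c d (ℕ.≤-reflexive e))
  (fraction-mono c d a b (ℕ.≤-reflexive (sym e)))

fraction-+ : ∀ a b n → fraction (a ℕ.+ b) (suc n) ≡ fraction a (suc n) Rat.+ fraction b (suc n)
fraction-+ a b n = Rat.toℚᵘ-injective (ℚᵘ.≃-trans (Rat.toℚᵘ-fromℚᵘ (ℚᵘ.mkℚᵘ (+ (a ℕ.+ b)) n))
  (ℚᵘ.≃-sym (ℚᵘ.≃-trans (Rat.toℚᵘ-homo-+ (fraction a (suc n)) (fraction b (suc n)))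
    (ℚᵘ.≃-trans (ℚᵘ.+-cong (Rat.toℚᵘ-fromℚᵘ (ℚᵘ.mkℚᵘ (+ a) n)) (Rat.toℚᵘ-fromℚᵘ (ℚᵘ.mkℚᵘ (+ b) n)))
      (ℚᵘ.*≡* (trans (solve 3 (λ a b n → (a :* n :+ b :* n) :* n := (a :+ b) :* (n :* n)) refl (+ a) (+ b) (+ suc n))
        (cong ((+ a ℤ.+ + b) ℤ.*_) (sym (ℤ.pos-* (suc n) (suc n))))))))))
  where open ℤ.+-*-Solver

fraction-* : ∀ a n b → fraction a (suc n) Rat.* fraction b 1 ≡ fraction (a ℕ.* b) (suc n)
fraction-* a n b = Rat.toℚᵘ-injective (ℚᵘ.≃-trans (Rat.toℚᵘ-homo-* (fraction a (suc n)) (fraction b 1))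
  (ℚᵘ.≃-trans (ℚᵘ.*-cong (Rat.toℚᵘ-fromℚᵘ (ℚᵘ.mkℚᵘ (+ a) n)) (Rat.toℚᵘ-fromℚᵘ (ℚᵘ.mkℚᵘ (+ b) 0)))
    (ℚᵘ.≃-trans (ℚᵘ.*≡* (cong₂ ℤ._*_ (sym (ℤ.pos-* a b)) (cong (λ z → + suc z) (sym (ℕ.*-identityʳ n))))) (ℚᵘ.≃-sym (Rat.toℚᵘ-fromℚᵘ (ℚᵘ.mkℚᵘ (+ (a ℕ.* b)) n))))))

Eventually : (ℕ → Set) → Set
Eventually P = ∃[ N ] ∀ n → N ℕ.≤ n → P n

always : ∀ {P : ℕ → Set} → (∀ n → P n) → Eventually P
always h = 0 , λ n _ → h n

eventually-map : ∀ {P Q : ℕ → Set} → (∀ {n} → P n → Q n) → Eventually P → Eventually Q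
eventually-map f (N , h) = N , λ n n≥ → f (h n n≥)

eventually-zip : ∀ {P Q R : ℕ → Set} → (∀ {n} → P n → Q n → R n) →
                 Eventually P → Eventually Q → Eventually R
eventually-zip f (N , h) (M , g) = N ℕ.⊔ M , λ n n≥ →
  f (h n (ℕ.m⊔n≤o⇒m≤o N M n≥)) (g n (ℕ.m⊔n≤o⇒n≤o N M n≥))

p≤p+ε : ∀ {p q ε} → 0ℚ Rat.< ε → p Rat.≤ q → p Rat.≤ q Rat.+ ε
p≤p+ε {p} {q} 0<ε p≤q = Rat.≤-trans (Rat.≤-reflexive (sym (Rat.+-identityʳ p)))
  (Rat.+-mono-≤ p≤q (Rat.<⇒≤ 0<ε))

0<half : ∀ {ε} → 0ℚ Rat.< ε → 0ℚ Rat.< ½ Rat.* ε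
0<half 0<ε = 0<½ *>0 0<ε

p≤q+ε⇒p≤q : ∀ {p q} → (∀ ε → 0ℚ Rat.< ε → p Rat.≤ q Rat.+ ε) → p Rat.≤ q
p≤q+ε⇒p≤q {p} {q} h = Rat.≮⇒≥ λ q<p →
  let r , q<r , r<p = Rat.<-dense q<p
      ε>0 = subst (Rat._< r Rat.- q) (Rat.+-inverseʳ q) (Rat.+-monoˡ-< (Rat.- q) q<r)
  in <⇒≱ r<p (subst (p Rat.≤_) (solve 2 (λ a b → a :+ (b :- a) := b) refl q r) (h (r Rat.- q) ε>0))
  where open +-*-Solver

-- The operations of Defs reduce to Cauchy sequences, which blocks unification;
-- the opaque copies are injective for the type checker.
infix  4 _≃_ _≼_
infix  8 ⊝_
infixl 7 _⊗_
infixl 6 _⊕_ _⊖_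

opaque
  _≃_ _≼_ : ℝ → ℝ → Set
  _≃_ = _≈_
  _≼_ = _≤_

  _⊕_ _⊗_ : ℝ → ℝ → ℝ
  _⊕_ = _+_
  _⊗_ = _*_

  ⊝_ ∥_∥ : ℝ → ℝ
  ⊝_  = -_
  ∥_∥ = ∣_∣

  ⟨_⟩ : ℚ → ℝ
  ⟨_⟩ = ι

  sum : ∀ {n} → (Fin n → ℝ) → ℝ
  sum = ∑

_⊖_ : ℝ → ℝ → ℝ
x ⊖ y = x ⊕ ⊝ y

0ᴿ 1ᴿ : ℝ
0ᴿ = ⟨ 0ℚ ⟩
1ᴿ = ⟨ 1ℚ ⟩

-- Order and operations on Cauchy sequences of rationals

opaque
  unfolding _≃_

  ≃-pointwise : ∀ {x y} → (∀ n → seq x n ≡ seq y n) → x ≃ y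
  ≃-pointwise {x} {y} h ε 0<ε = always λ n →
    subst (λ z → Rat.∣ seq x n Rat.- z ∣ Rat.≤ ε) (h n)
      (subst (λ z → Rat.∣ z ∣ Rat.≤ ε) (sym (Rat.+-inverseʳ (seq x n))) (Rat.<⇒≤ 0<ε))

  ≼-pointwise : ∀ {x y} → (∀ n → seq x n Rat.≤ seq y n) → x ≼ y
  ≼-pointwise h ε 0<ε = always λ n → p≤p+ε 0<ε (h n)

  ≃⇒≼ : ∀ {x y} → x ≃ y → x ≼ y
  ≃⇒≼ h ε 0<ε = eventually-map ∣-∣≤⇒ (h ε 0<ε)

  ≼-antisym : ∀ {x y} → x ≼ y → y ≼ x → x ≃ y
  ≼-antisym h g ε 0<ε = eventually-zip ∣-∣≤⁺ (h ε 0<ε) (g ε 0<ε)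

  ≼-trans : ∀ {x y z} → x ≼ y → y ≼ z → x ≼ z
  ≼-trans {x} {y} {z} h g ε 0<ε = eventually-zip
    (λ {n} a b → Rat.≤-trans a (Rat.≤-trans (Rat.+-monoˡ-≤ (½ Rat.* ε) b) (Rat.≤-reflexive
      (trans (Rat.+-assoc (seq z n) (½ Rat.* ε) (½ Rat.* ε)) (cong (seq z n Rat.+_) (half+half ε))))))
    (h (½ Rat.* ε) (0<half 0<ε)) (g (½ Rat.* ε) (0<half 0<ε))

  ⊕-mono : ∀ {x y z w} → x ≼ y → z ≼ w → x ⊕ z ≼ y ⊕ w
  ⊕-mono {x} {y} {z} {w} h g ε 0<ε = eventually-zip
    (λ {n} a b → Rat.≤-trans (Rat.+-mono-≤ a b) (Rat.≤-reflexive
      (trans (solve 3 (λ a b e → (a :+ e) :+ (b :+ e) := a :+ b :+ (e :+ e)) refl (seq y n) (seq w n) (½ Rat.* ε))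
        (cong (seq y n Rat.+ seq w n Rat.+_) (half+half ε)))))
    (h (½ Rat.* ε) (0<half 0<ε)) (g (½ Rat.* ε) (0<half 0<ε))
    where open +-*-Solver

  ⊝-anti : ∀ {x y} → x ≼ y → ⊝ y ≼ ⊝ x
  ⊝-anti {x} {y} h ε 0<ε = eventually-map
    (λ {n} a → subst₂ Rat._≤_
      (solve 2 (λ a b → a :- (a :+ b) := :- b) refl (seq x n) (seq y n))
      (solve 3 (λ a b e → b :+ e :- (a :+ b) := :- a :+ e) refl (seq x n) (seq y n) ε)
      (Rat.+-monoˡ-≤ (Rat.- (seq x n Rat.+ seq y n)) a))
    (h ε 0<ε)
    where open +-*-Solver

  -- Order holds only up to an eventual ε, so both factors may be slightly negative. With `p + d`
  -- and `q + d` non-negative, the expansion `(p + d) (q + d) = p q + (p + q + d) d` leaves an error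
  -- of at most `(A + B + 1) d`.
  0≼⊗ : ∀ {x y} → 0ᴿ ≼ x → 0ᴿ ≼ y → 0ᴿ ≼ x ⊗ y
  0≼⊗ {x} {y} h g ε 0<ε =
    let A , 0<A , hA = bounded {seq x} (cauchy x)
        B , 0<B , hB = bounded {seq y} (cauchy y)
        0<K = Rat.+-mono-< (Rat.+-mono-< 0<A 0<B) (0<1/suc 0)
        δ , 0<δ , Kδ = shrink (A Rat.+ B Rat.+ 1ℚ) ε 0<K 0<ε
        -- The cap at 1 bounds the last summand of `p + q + d`.
        0<δ′ = ⊓>0 0<δ
    in eventually-zip
      (λ (a , a′) (b , b′) → lemma {A = A} {B} (Rat.<⇒≤ 0<K) (Rat.p⊓q≤q δ 1ℚ) (Rat.p⊓q≤p δ 1ℚ) Kδ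
        (Rat.≤-trans (p≤∣p∣ _) a′) (Rat.≤-trans (p≤∣p∣ _) b′) (Rat.<⇒≤ 0<δ′) a b)
      (eventually-zip _,_ (h (δ Rat.⊓ 1ℚ) 0<δ′) hA) (eventually-zip _,_ (g (δ Rat.⊓ 1ℚ) 0<δ′) hB)
    where
    open +-*-Solver
    ⊓>0 : ∀ {δ} → 0ℚ Rat.< δ → 0ℚ Rat.< δ Rat.⊓ 1ℚ
    ⊓>0 {δ} 0<δ with Rat.⊓-sel δ 1ℚ
    ... | inj₁ e = subst (0ℚ Rat.<_) (sym e) 0<δ
    ... | inj₂ e = subst (0ℚ Rat.<_) (sym e) (0<1/suc 0)
    lemma : ∀ {p q A B d δ} → 0ℚ Rat.≤ A Rat.+ B Rat.+ 1ℚ → d Rat.≤ 1ℚ → d Rat.≤ δ →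
            (A Rat.+ B Rat.+ 1ℚ) Rat.* δ ≡ ε → p Rat.≤ A → q Rat.≤ B → 0ℚ Rat.≤ d →
            0ℚ Rat.≤ p Rat.+ d → 0ℚ Rat.≤ q Rat.+ d → 0ℚ Rat.≤ p Rat.* q Rat.+ ε
    lemma {p} {q} {A} {B} {d} {δ} 0≤K d≤1 d≤δ Kδ p≤A q≤B 0≤d a b = Rat.≤-trans (a *≥0 b)
      (Rat.≤-trans (Rat.≤-reflexive
        (solve 3 (λ p q d → (p :+ d) :* (q :+ d) := p :* q :+ (p :+ q :+ d) :* d) refl p q d))
        (Rat.+-monoʳ-≤ (p Rat.* q) (Rat.≤-trans
          (Rat.≤-trans (Rat.*-monoʳ-≤-nonNeg d ⦃ Rat.nonNegative 0≤d ⦄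
            (Rat.+-mono-≤ (Rat.+-mono-≤ p≤A q≤B) d≤1))
            (Rat.*-monoˡ-≤-nonNeg (A Rat.+ B Rat.+ 1ℚ) ⦃ Rat.nonNegative 0≤K ⦄ d≤δ))
          (Rat.≤-reflexive Kδ))))

  x≼∥x∥ : ∀ x → x ≼ ∥ x ∥
  x≼∥x∥ x = ≼-pointwise {x} {∥ x ∥} λ n → p≤∣p∣ (seq x n)

  0≼∥x∥ : ∀ x → 0ᴿ ≼ ∥ x ∥
  0≼∥x∥ x = ≼-pointwise {0ᴿ} {∥ x ∥} λ n → Rat.0≤∣p∣ (seq x n)

  ∥⊝x∥≃∥x∥ : ∀ x → ∥ ⊝ x ∥ ≃ ∥ x ∥
  ∥⊝x∥≃∥x∥ x = ≃-pointwise {∥ ⊝ x ∥} {∥ x ∥} λ n → Rat.∣-p∣≡∣p∣ (seq x n)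

  ∥⊗∥ : ∀ x y → ∥ x ⊗ y ∥ ≃ ∥ x ∥ ⊗ ∥ y ∥
  ∥⊗∥ x y = ≃-pointwise {∥ x ⊗ y ∥} {∥ x ∥ ⊗ ∥ y ∥} λ n → Rat.∣p*q∣≡∣p∣*∣q∣ (seq x n) (seq y n)

  ∥x∥≼ : ∀ {x r} → x ≼ r → ⊝ x ≼ r → ∥ x ∥ ≼ r
  ∥x∥≼ h g ε 0<ε = eventually-zip ∣∣≤ (h ε 0<ε) (g ε 0<ε)

  ≼-closed : ∀ {x y} → (∀ ε → 0ℚ Rat.< ε → x ≼ y ⊕ ⟨ ε ⟩) → x ≼ y
  ≼-closed {x} {y} h ε 0<ε = eventually-map
    (λ {n} a → Rat.≤-trans a (Rat.≤-reflexive
      (trans (Rat.+-assoc (seq y n) (½ Rat.* ε) (½ Rat.* ε)) (cong (seq y n Rat.+_) (half+half ε)))))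
    (h (½ Rat.* ε) (0<half 0<ε) (½ Rat.* ε) (0<half 0<ε))

  ⟨⟩-mono : ∀ {p q} → p Rat.≤ q → ⟨ p ⟩ ≼ ⟨ q ⟩
  ⟨⟩-mono = ι-mono-≤

  ⟨⟩-cancel : ∀ {p q} → ⟨ p ⟩ ≼ ⟨ q ⟩ → p Rat.≤ q
  ⟨⟩-cancel h = p≤q+ε⇒p≤q λ ε 0<ε → let N , g = h ε 0<ε in g N ℕ.≤-refl

  archimedeanᴿ : ∀ x → ∃[ n ] x ≼ ⟨ fraction n 1 ⟩
  archimedeanᴿ x =
    let A , _ , N , hA = bounded {seq x} (cauchy x)
        n , A≤n = archimedean A
    in n , λ ε 0<ε → N , λ k k≥ → p≤p+ε 0<ε
      (Rat.≤-trans (p≤∣p∣ (seq x k)) (Rat.≤-trans (hA k k≥) A≤n))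

  positive-inverse : ∀ {x c} → 0ℚ Rat.< c → ⟨ c ⟩ ≼ x → ∃[ y ] 0ᴿ ≼ y × x ⊗ y ≃ 1ᴿ
  positive-inverse {x} {c} 0<c h = inverse x 0<x ,
    ≼-pointwise {0ᴿ} {inverse x 0<x} (λ n → Rat.<⇒≤
      (0<recip (seq x n Rat.⊔ (½ Rat.* c)) (⊔-positive (0<half 0<c) (seq x n)))) ,
    *-inverse x 0<x
    where
    open +-*-Solver
    0<x : 0ℝ < x
    -- The hypothesis makes `c - η` an eventual lower bound for every positive η; the choice
    -- `η = c / 2` leaves `c / 2`.
    0<x = 0<⇒ {x} (0<half 0<c) (eventually-map (λ {n} a → subst₂ Rat._≤_
      (trans (cong (Rat._- ½ Rat.* c) (sym (half+half c))) (solve 1 (λ a → a :+ a :- a := a) refl (½ Rat.* c)))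
      (solve 2 (λ a b → a :+ b :- b := a) refl (seq x n) (½ Rat.* c))
      (Rat.+-monoˡ-≤ (Rat.- (½ Rat.* c)) a)) (h (½ Rat.* c) (0<half 0<c)))

  ≃-refl : ∀ {x} → x ≃ x
  ≃-refl {x} = ≃-pointwise {x} {x} λ _ → refl

  ≃-sym : ∀ {x y} → x ≃ y → y ≃ x
  ≃-sym {x} {y} h ε 0<ε = eventually-map
    (λ {n} → subst (Rat._≤ ε) (∣-∣-sym (seq x n) (seq y n))) (h ε 0<ε)

≃-trans : ∀ {x y z} → x ≃ y → y ≃ z → x ≃ z
≃-trans h g = ≼-antisym (≼-trans (≃⇒≼ h) (≃⇒≼ g)) (≼-trans (≃⇒≼ (≃-sym g)) (≃⇒≼ (≃-sym h)))

≼-refl : ∀ {x} → x ≼ x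
≼-refl = ≃⇒≼ ≃-refl

⊕-cong : ∀ {x y z w} → x ≃ y → z ≃ w → x ⊕ z ≃ y ⊕ w
⊕-cong h g = ≼-antisym (⊕-mono (≃⇒≼ h) (≃⇒≼ g)) (⊕-mono (≃⇒≼ (≃-sym h)) (≃⇒≼ (≃-sym g)))

⊝-cong : ∀ {x y} → x ≃ y → ⊝ x ≃ ⊝ y
⊝-cong h = ≼-antisym (⊝-anti (≃⇒≼ (≃-sym h))) (⊝-anti (≃⇒≼ h))

opaque
  unfolding _≃_

  ⊗-comm : ∀ x y → x ⊗ y ≃ y ⊗ x
  ⊗-comm x y = ≃-pointwise {x ⊗ y} {y ⊗ x} λ n → Rat.*-comm (seq x n) (seq y n)

  ⊗-congˡ : ∀ x {y z} → y ≃ z → x ⊗ y ≃ x ⊗ z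
  ⊗-congˡ x {y} {z} h ε 0<ε =
    let A , 0<A , hA = bounded {seq x} (cauchy x)
        δ , 0<δ , Aδ = shrink A ε 0<A 0<ε
    in eventually-zip
      (λ {n} a b → Rat.≤-trans (Rat.≤-reflexive (trans
        (cong Rat.∣_∣ (solve 3 (λ x y z → x :* y :- x :* z := x :* (y :- z)) refl (seq x n) (seq y n) (seq z n)))
        (Rat.∣p*q∣≡∣p∣*∣q∣ (seq x n) (seq y n Rat.- seq z n))))
        (Rat.≤-trans (RationalLemmas.*-mono (Rat.0≤∣p∣ (seq x n)) (Rat.<⇒≤ 0<δ) a b) (Rat.≤-reflexive Aδ)))
      hA (h δ 0<δ)
    where open +-*-Solver

⊗-cong : ∀ {x y z w} → x ≃ y → z ≃ w → x ⊗ z ≃ y ⊗ w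
⊗-cong {x} {y} {z} {w} h g = ≃-trans (⊗-congˡ x g)
  (≃-trans (⊗-comm x w) (≃-trans (⊗-congˡ w h) (⊗-comm w y)))

-- The commutative ring of reals, with a solver over rational coefficients

opaque
  unfolding _≃_

  isCommutativeRing : IsCommutativeRing _≃_ _⊕_ _⊗_ ⊝_ 0ᴿ 1ᴿ
  isCommutativeRing = record
      { isRing = record
        { +-isAbelianGroup = record
          { isGroup = record
            { isMonoid = record
              { isSemigroup = record
                { isMagma = record
                  { isEquivalence = record
                    { refl = λ {x} → ≃-refl {x} ; sym = λ {x} {y} → ≃-sym {x} {y}
                    ; trans = λ {x} {y} {z} → ≃-trans {x} {y} {z} }
                  ; ∙-cong = λ {x} {y} {z} {w} → ⊕-cong {x} {y} {z} {w} }
                ; assoc = λ x y z → ≃-pointwise {x ⊕ y ⊕ z} {x ⊕ (y ⊕ z)} λ n → Rat.+-assoc (seq x n) (seq y n) (seq z n) }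
              ; identity = (λ x → ≃-pointwise {0ᴿ ⊕ x} {x} λ n → Rat.+-identityˡ (seq x n))
                         , (λ x → ≃-pointwise {x ⊕ 0ᴿ} {x} λ n → Rat.+-identityʳ (seq x n)) }
            ; inverse = (λ x → ≃-pointwise {⊝ x ⊕ x} {0ᴿ} λ n → Rat.+-inverseˡ (seq x n))
                      , (λ x → ≃-pointwise {x ⊕ ⊝ x} {0ᴿ} λ n → Rat.+-inverseʳ (seq x n))
            ; ⁻¹-cong = λ {x} {y} → ⊝-cong {x} {y} }
          ; comm = λ x y → ≃-pointwise {x ⊕ y} {y ⊕ x} λ n → Rat.+-comm (seq x n) (seq y n) }
        ; *-cong = λ {x} {y} {z} {w} → ⊗-cong {x} {y} {z} {w}
        ; *-assoc = λ x y z → ≃-pointwise {x ⊗ y ⊗ z} {x ⊗ (y ⊗ z)} λ n → Rat.*-assoc (seq x n) (seq y n) (seq z n)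
        ; *-identity = (λ x → ≃-pointwise {1ᴿ ⊗ x} {x} λ n → Rat.*-identityˡ (seq x n))
                     , (λ x → ≃-pointwise {x ⊗ 1ᴿ} {x} λ n → Rat.*-identityʳ (seq x n))
        ; distrib = (λ x y z → ≃-pointwise {x ⊗ (y ⊕ z)} {x ⊗ y ⊕ x ⊗ z} λ n → Rat.*-distribˡ-+ (seq x n) (seq y n) (seq z n))
                  , (λ x y z → ≃-pointwise {(y ⊕ z) ⊗ x} {y ⊗ x ⊕ z ⊗ x} λ n → Rat.*-distribʳ-+ (seq x n) (seq y n) (seq z n)) }
      ; *-comm = ⊗-comm }

  ⟨⟩-+ : ∀ p q → ⟨ p Rat.+ q ⟩ ≃ ⟨ p ⟩ ⊕ ⟨ q ⟩
  ⟨⟩-+ p q = ≃-pointwise {⟨ p Rat.+ q ⟩} {⟨ p ⟩ ⊕ ⟨ q ⟩} λ _ → refl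

  ⟨⟩-* : ∀ p q → ⟨ p Rat.* q ⟩ ≃ ⟨ p ⟩ ⊗ ⟨ q ⟩
  ⟨⟩-* p q = ≃-pointwise {⟨ p Rat.* q ⟩} {⟨ p ⟩ ⊗ ⟨ q ⟩} λ _ → refl

  ⟨⟩-neg : ∀ p → ⟨ Rat.- p ⟩ ≃ ⊝ ⟨ p ⟩
  ⟨⟩-neg p = ≃-pointwise {⟨ Rat.- p ⟩} {⊝ ⟨ p ⟩} λ _ → refl

realRing : AlmostCommutativeRing 0ℓ 0ℓ
realRing = fromCommutativeRing record { isCommutativeRing = isCommutativeRing }

⟨⟩-homomorphism : Rat.+-*-rawRing -Raw-AlmostCommutative⟶ realRing
⟨⟩-homomorphism = record
  { ⟦_⟧ = ⟨_⟩ ; +-homo = ⟨⟩-+ ; *-homo = ⟨⟩-* ; -‿homo = ⟨⟩-neg ; 0-homo = ≃-refl ; 1-homo = ≃-refl }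

⟨⟩-≟ : ∀ p q → Maybe (⟨ p ⟩ ≃ ⟨ q ⟩)
⟨⟩-≟ p q with p Rat.≟ q
... | yes refl = just ≃-refl
... | no _     = nothing

open Algebra.Solver.Ring Rat.+-*-rawRing realRing ⟨⟩-homomorphism ⟨⟩-≟
  using (solve; _:+_; _:*_; _:-_; :-_; _:=_; con)

-- Order, limits and sums of real numbers

≼-resp : ∀ {x x′ y y′} → x ≃ x′ → y ≃ y′ → x ≼ y → x′ ≼ y′
≼-resp h g x≼y = ≼-trans (≃⇒≼ (≃-sym h)) (≼-trans x≼y (≃⇒≼ g))

≼⇒0≼ : ∀ {x y} → x ≼ y → 0ᴿ ≼ y ⊖ x
≼⇒0≼ {x} {y} h = ≼-resp (solve 1 (λ x → x :- x := con 0ℚ) ≃-refl x) ≃-refl (⊕-mono h (≼-refl {⊝ x}))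

0≼⇒≼ : ∀ {x y} → 0ᴿ ≼ y ⊖ x → x ≼ y
0≼⇒≼ {x} {y} h = ≼-resp (solve 1 (λ x → con 0ℚ :+ x := x) ≃-refl x)
  (solve 2 (λ x y → y :- x :+ x := y) ≃-refl x y) (⊕-mono h (≼-refl {x}))

-- Moves terms across an inequality: only the differences of the two sides have to agree, and that
-- is an identity for the ring solver.
≼-shift : ∀ {a b x y} → a ≼ b → b ⊖ a ≃ y ⊖ x → x ≼ y
≼-shift h e = 0≼⇒≼ (≼-resp ≃-refl e (≼⇒0≼ h))

0≼⊕ : ∀ {x y} → 0ᴿ ≼ x → 0ᴿ ≼ y → 0ᴿ ≼ x ⊕ y
0≼⊕ h g = ≼-resp (solve 0 (con 0ℚ :+ con 0ℚ := con 0ℚ) ≃-refl) ≃-refl (⊕-mono h g)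

0≼⟨⟩ : ∀ {p} → 0ℚ Rat.< p → 0ᴿ ≼ ⟨ p ⟩
0≼⟨⟩ 0<p = ⟨⟩-mono (Rat.<⇒≤ 0<p)

0≼1 : 0ᴿ ≼ 1ᴿ
0≼1 = 0≼⟨⟩ (0<1/suc 0)

⊗-monoˡ : ∀ {x y z} → 0ᴿ ≼ z → x ≼ y → z ⊗ x ≼ z ⊗ y
⊗-monoˡ {x} {y} {z} h g = 0≼⇒≼ (≼-resp ≃-refl
  (solve 3 (λ x y z → z :* (y :- x) := z :* y :- z :* x) ≃-refl x y z) (0≼⊗ h (≼⇒0≼ g)))

⊗-monoʳ : ∀ {x y z} → 0ᴿ ≼ z → x ≼ y → x ⊗ z ≼ y ⊗ z
⊗-monoʳ {x} {y} {z} h g = ≼-resp (⊗-comm z x) (⊗-comm z y) (⊗-monoˡ h g)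

⊗-mono : ∀ {x y z w} → 0ᴿ ≼ x → 0ᴿ ≼ w → x ≼ y → z ≼ w → x ⊗ z ≼ y ⊗ w
⊗-mono {x} {y} {z} {w} hx hw g h = ≼-trans (⊗-monoˡ hx h)
  (⊗-monoʳ hw g)

-- Multiply by the inverse of `y`. The rational `c` witnesses that `y` is bounded away from 0,
-- without which it cannot be inverted constructively.
⊗-cancel-0≼ : ∀ {x y c} → 0ℚ Rat.< c → ⟨ c ⟩ ≼ y → 0ᴿ ≼ x ⊗ y → 0ᴿ ≼ x
⊗-cancel-0≼ {x} {y} 0<c c≼y h =
  let z , 0≼z , yz≃1 = positive-inverse 0<c c≼y
  in ≼-resp ≃-refl
    (≃-trans (solve 3 (λ x y z → x :* y :* z := x :* (y :* z)) ≃-refl x y z)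
      (≃-trans (⊗-congˡ x yz≃1) (solve 1 (λ x → x :* con 1ℚ := x) ≃-refl x)))
    (0≼⊗ h 0≼z)

∥-∥≼ : ∀ {x y r} → x ≼ y ⊕ r → y ≼ x ⊕ r → ∥ x ⊖ y ∥ ≼ r
∥-∥≼ {x} {y} {r} h g = ∥x∥≼
  (≼-shift h (solve 3 (λ x y r → y :+ r :- x := r :- (x :- y)) ≃-refl x y r))
  (≼-shift g (solve 3 (λ x y r → x :+ r :- y := r :- :- (x :- y)) ≃-refl x y r))

∥-∥≼⇒≼ : ∀ {x y r} → ∥ x ⊖ y ∥ ≼ r → x ≼ y ⊕ r
∥-∥≼⇒≼ {x} {y} {r} h = ≼-shift (≼-trans (x≼∥x∥ (x ⊖ y)) h)
  (solve 3 (λ x y r → r :- (x :- y) := y :+ r :- x) ≃-refl x y r)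

∥-∥≼-sym : ∀ {x y r} → ∥ x ⊖ y ∥ ≼ r → ∥ y ⊖ x ∥ ≼ r
∥-∥≼-sym {x} {y} {r} h = ∥x∥≼
  (≼-trans (≃⇒≼ (solve 2 (λ x y → y :- x := :- (x :- y)) ≃-refl x y))
    (≼-trans (x≼∥x∥ (⊝ (x ⊖ y))) (≼-trans (≃⇒≼ (∥⊝x∥≃∥x∥ (x ⊖ y))) h)))
  (≼-trans (≃⇒≼ (solve 2 (λ x y → :- (y :- x) := x :- y) ≃-refl x y)) (≼-trans (x≼∥x∥ (x ⊖ y)) h))

∥-∥≼-trans : ∀ {x y z r s} → ∥ x ⊖ y ∥ ≼ r → ∥ y ⊖ z ∥ ≼ s → ∥ x ⊖ z ∥ ≼ r ⊕ s
∥-∥≼-trans {x} {y} {z} {r} {s} h g = ∥-∥≼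
  (≼-trans (∥-∥≼⇒≼ h) (≼-trans (⊕-mono (∥-∥≼⇒≼ g) (≼-refl {r}))
    (≃⇒≼ (solve 3 (λ z r s → z :+ s :+ r := z :+ (r :+ s)) ≃-refl z r s))))
  (≼-trans (∥-∥≼⇒≼ (∥-∥≼-sym g)) (≼-trans (⊕-mono (∥-∥≼⇒≼ (∥-∥≼-sym h)) (≼-refl {s}))
    (≃⇒≼ (solve 3 (λ x r s → x :+ r :+ s := x :+ (r :+ s)) ≃-refl x r s))))

∥∥-cong : ∀ {x y} → x ≃ y → ∥ x ∥ ≃ ∥ y ∥
∥∥-cong h = ≼-antisym (half h) (half (≃-sym h))
  where
  half : ∀ {x y} → x ≃ y → ∥ x ∥ ≼ ∥ y ∥
  half {x} {y} e = ∥x∥≼ (≼-trans (≃⇒≼ e) (x≼∥x∥ y))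
    (≼-trans (≃⇒≼ (⊝-cong e)) (≼-trans (x≼∥x∥ (⊝ y)) (≃⇒≼ (∥⊝x∥≃∥x∥ y))))

∥-∥≼-resp : ∀ {x x′ y y′ r} → x ≃ x′ → y ≃ y′ → ∥ x ⊖ y ∥ ≼ r → ∥ x′ ⊖ y′ ∥ ≼ r
∥-∥≼-resp h g = ≼-resp (∥∥-cong (⊕-cong h (⊝-cong g))) ≃-refl

≃⇒∥-∥≼ : ∀ {x y r} → 0ᴿ ≼ r → x ≃ y → ∥ x ⊖ y ∥ ≼ r
≃⇒∥-∥≼ {x} {y} {r} 0≼r e = ∥-∥≼ (lemma e) (lemma (≃-sym e))
  where
  lemma : ∀ {x y} → x ≃ y → x ≼ y ⊕ r
  lemma {x} {y} e = ≼-resp (solve 1 (λ x → x :+ con 0ℚ := x) ≃-refl x) ≃-refl (⊕-mono (≃⇒≼ e) 0≼r)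

∥⊗-⊗∥≼ : ∀ {c x y A r} → ∥ c ∥ ≼ A → 0ᴿ ≼ r → ∥ x ⊖ y ∥ ≼ r → ∥ c ⊗ x ⊖ c ⊗ y ∥ ≼ A ⊗ r
∥⊗-⊗∥≼ {c} {x} {y} h 0≼r g = ≼-resp
  (≃-trans (≃-sym (∥⊗∥ c (x ⊖ y)))
    (∥∥-cong (solve 3 (λ c x y → c :* (x :- y) := c :* x :- c :* y) ≃-refl c x y)))
  ≃-refl (⊗-mono (0≼∥x∥ c) 0≼r h g)

∥-∥≼-closed⇒≃ : ∀ {x y} → (∀ ε → 0ℚ Rat.< ε → ∥ x ⊖ y ∥ ≼ ⟨ ε ⟩) → x ≃ y
∥-∥≼-closed⇒≃ h = ≼-antisym (≼-closed λ ε 0<ε → ∥-∥≼⇒≼ (h ε 0<ε))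
  (≼-closed λ ε 0<ε → ∥-∥≼⇒≼ (∥-∥≼-sym (h ε 0<ε)))

⟨half⟩ : ∀ ε → ⟨ ½ Rat.* ε ⟩ ⊕ ⟨ ½ Rat.* ε ⟩ ≃ ⟨ ε ⟩
⟨half⟩ ε = ≃-trans (≃-sym (⟨⟩-+ (½ Rat.* ε) (½ Rat.* ε)))
  (subst (λ z → ⟨ z ⟩ ≃ ⟨ ε ⟩) (sym (half+half ε)) ≃-refl)

∥-∥≼-halves : ∀ {x y z} ε → ∥ x ⊖ y ∥ ≼ ⟨ ½ Rat.* ε ⟩ → ∥ y ⊖ z ∥ ≼ ⟨ ½ Rat.* ε ⟩ → ∥ x ⊖ z ∥ ≼ ⟨ ε ⟩
∥-∥≼-halves ε h g = ≼-resp ≃-refl (⟨half⟩ ε) (∥-∥≼-trans h g)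

Lim : (ℕ → ℝ) → ℝ → Set
Lim x L = ∀ ε → 0ℚ Rat.< ε → Eventually λ n → ∥ x n ⊖ L ∥ ≼ ⟨ ε ⟩

Lim-⊕ : ∀ {x y L M} → Lim x L → Lim y M → Lim (λ n → x n ⊕ y n) (L ⊕ M)
Lim-⊕ {x} {y} {L} {M} h g ε 0<ε = eventually-zip
  (λ {n} a b → ∥-∥≼-halves ε
    (∥-∥≼-resp (⊕-cong ≃-refl ≃-refl) ≃-refl
      (shift (x n) L (y n) a))
    (∥-∥≼-resp (solve 2 (λ a b → a :+ b := b :+ a) ≃-refl (y n) L)
      (solve 2 (λ a b → a :+ b := b :+ a) ≃-refl M L) (shift (y n) M L b)))
  (h (½ Rat.* ε) (0<half 0<ε)) (g (½ Rat.* ε) (0<half 0<ε))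
  where
  shift : ∀ x x′ y {r} → ∥ x ⊖ x′ ∥ ≼ r → ∥ (x ⊕ y) ⊖ (x′ ⊕ y) ∥ ≼ r
  shift x x′ y = ≼-resp (∥∥-cong (solve 3 (λ x x′ y → x :- x′ := (x :+ y) :- (x′ :+ y)) ≃-refl x x′ y)) ≃-refl

Lim-⊗ˡ : ∀ c {x L} → Lim x L → Lim (λ n → c ⊗ x n) (c ⊗ L)
Lim-⊗ˡ c h ε 0<ε =
  let n , ∥c∥≼n = archimedeanᴿ ∥ c ∥
      0<A = 0<fraction n
      δ , 0<δ , Aδ = shrink (fraction (suc n) 1) ε 0<A 0<ε
  in eventually-map (λ a → ≼-resp ≃-refl
      (≃-trans (≃-sym (⟨⟩-* (fraction (suc n) 1) δ)) (subst (λ z → ⟨ z ⟩ ≃ ⟨ ε ⟩) (sym Aδ) ≃-refl))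
      (∥⊗-⊗∥≼ {c} (≼-trans ∥c∥≼n (⟨⟩-mono (fraction-mono n 0 (suc n) 0
        (ℕ.*-monoˡ-≤ 1 (ℕ.n≤1+n n))))) (0≼⟨⟩ 0<δ) a))
    (h δ 0<δ)
  where
  0<fraction : ∀ n → 0ℚ Rat.< fraction (suc n) 1
  0<fraction n = Rat.<-≤-trans (0<1/suc 0) (fraction-mono 1 0 (suc n) 0 (ℕ.s≤s ℕ.z≤n))

Lim-⊖ : ∀ {x y L M} → Lim x L → Lim y M → Lim (λ n → x n ⊖ y n) (L ⊖ M)
Lim-⊖ {x} {y} {L} {M} h g = Lim-⊕ {x} {λ n → ⊝ y n} h λ ε 0<ε → eventually-map
  (λ {n} a → ≼-resp (∥∥-cong (solve 2 (λ y M → M :- y := :- y :- :- M) ≃-refl (y n) M)) ≃-refl (∥-∥≼-sym a))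
  (g ε 0<ε)

opaque
  unfolding _≃_

  approximate : ∀ x ε → 0ℚ Rat.< ε → ∃[ q ] ∥ x ⊖ ⟨ q ⟩ ∥ ≼ ⟨ ε ⟩
  approximate x ε 0<ε =
    let N , h = cauchy x ε 0<ε
    in seq x N , λ η 0<η → N , λ n n≥ → p≤p+ε 0<η (h n N n≥ ℕ.≤-refl)

module _ {x : ℕ → ℝ}
  (h : ∀ ε → 0ℚ Rat.< ε → ∃[ N ] ∀ m n → N ℕ.≤ m → N ℕ.≤ n → ∥ x m ⊖ x n ∥ ≼ ⟨ ε ⟩) where

  private
    approx : ℕ → ℚ
    approx n = proj₁ (approximate (x n) (fraction 1 (suc n)) (0<1/suc n))

    approx-close : ∀ n → ∥ x n ⊖ ⟨ approx n ⟩ ∥ ≼ ⟨ fraction 1 (suc n) ⟩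
    approx-close n = proj₂ (approximate (x n) (fraction 1 (suc n)) (0<1/suc n))

    approx-close′ : ∀ ε → 0ℚ Rat.< ε → Eventually λ n → ∥ x n ⊖ ⟨ approx n ⟩ ∥ ≼ ⟨ ε ⟩
    approx-close′ ε 0<ε = let N , small = 1/suc≤ ε 0<ε in
      N , λ n n≥ → ≼-trans (approx-close n) (⟨⟩-mono (small n n≥))

    ∣-∣≤ : ∀ {p q ε} → ∥ ⟨ p ⟩ ⊖ ⟨ q ⟩ ∥ ≼ ⟨ ε ⟩ → Rat.∣ p Rat.- q ∣ Rat.≤ ε
    ∣-∣≤ {p} {q} {ε} g = ∣-∣≤⁺
      (⟨⟩-cancel (≼-resp ≃-refl (≃-sym (⟨⟩-+ q ε)) (∥-∥≼⇒≼ g)))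
      (⟨⟩-cancel (≼-resp ≃-refl (≃-sym (⟨⟩-+ p ε)) (∥-∥≼⇒≼ (∥-∥≼-sym g))))

    approx-cauchy : Cauchy approx
    approx-cauchy ε 0<ε =
      -- Two rounding errors of ε/4 and one distance of ε/2.
      let ¼ε = ½ Rat.* (½ Rat.* ε)
          N , g = h (½ Rat.* ε) (0<half 0<ε)
          M , c = approx-close′ ¼ε (0<half (0<half 0<ε))
      in N ℕ.⊔ M , λ m n m≥ n≥ → ∣-∣≤ (≼-resp ≃-refl
        (≃-trans (solve 2 (λ a b → a :+ (b :+ a) := a :+ a :+ b) ≃-refl ⟨ ¼ε ⟩ ⟨ ½ Rat.* ε ⟩)
          (≃-trans (⊕-cong (⟨half⟩ (½ Rat.* ε)) ≃-refl) (⟨half⟩ ε)))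
        (∥-∥≼-trans (∥-∥≼-sym (c m (ℕ.m⊔n≤o⇒n≤o N M m≥)))
          (∥-∥≼-trans (g m n (ℕ.m⊔n≤o⇒m≤o N M m≥) (ℕ.m⊔n≤o⇒m≤o N M n≥)) (c n (ℕ.m⊔n≤o⇒n≤o N M n≥)))))

    limit : ℝ
    limit = mkℝ approx approx-cauchy

    opaque
      unfolding _≃_

      approx⟶limit : Lim (λ n → ⟨ approx n ⟩) limit
      approx⟶limit ε 0<ε = let N , g = approx-cauchy ε 0<ε in
        N , λ m m≥ η 0<η → N , λ n n≥ → p≤p+ε 0<η (g m n m≥ n≥)

  -- Each `x n` is rounded to a rational within 1/(n + 1), and these rationals are the Cauchy
  -- sequence that represents the limit. As `Cauchy` prescribes no rate, there is no need to pass to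
  -- a subsequence.
  complete : ∃[ L ] Lim x L
  complete = limit , λ ε 0<ε → eventually-zip (∥-∥≼-halves ε)
    (approx-close′ (½ Rat.* ε) (0<half 0<ε)) (approx⟶limit (½ Rat.* ε) (0<half 0<ε))

opaque
  unfolding _≃_

  sum-zero : ∀ (a : Fin 0 → ℝ) → sum a ≃ 0ᴿ
  sum-zero a = ≃-pointwise {sum a} {0ᴿ} λ _ → refl

  sum-suc : ∀ {n} (a : Fin (suc n) → ℝ) → sum a ≃ a zero ⊕ sum (a ∘ suc)
  sum-suc a = ≃-refl {sum a}

sum-mono : ∀ {n} {a b : Fin n → ℝ} → (∀ i → a i ≼ b i) → sum a ≼ sum b
sum-mono {zero}  {a} {b} h = ≃⇒≼ (≃-trans (sum-zero a) (≃-sym (sum-zero b)))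
sum-mono {suc n} {a} {b} h = ≼-resp (≃-sym (sum-suc a)) (≃-sym (sum-suc b))
  (⊕-mono (h zero) (sum-mono (h ∘ suc)))

sum-cong : ∀ {n} {a b : Fin n → ℝ} → (∀ i → a i ≃ b i) → sum a ≃ sum b
sum-cong h = ≼-antisym (sum-mono (≃⇒≼ ∘ h)) (sum-mono (≃⇒≼ ∘ ≃-sym ∘ h))

sum-⊗ˡ : ∀ {n} c (a : Fin n → ℝ) → sum (λ i → c ⊗ a i) ≃ c ⊗ sum a
sum-⊗ˡ {zero}  c a = ≃-trans (sum-zero _)
  (≃-trans (solve 1 (λ c → con 0ℚ := c :* con 0ℚ) ≃-refl c) (⊗-congˡ c (≃-sym (sum-zero a))))
sum-⊗ˡ {suc n} c a = ≃-trans (sum-suc _) (≃-trans (⊕-cong ≃-refl (sum-⊗ˡ c (a ∘ suc)))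
  (≃-trans (solve 3 (λ c x y → c :* x :+ c :* y := c :* (x :+ y)) ≃-refl c (a zero) (sum (a ∘ suc)))
    (⊗-congˡ c (≃-sym (sum-suc a)))))

sum-telescope : ∀ n (G : ℕ → ℝ) → sum {n} (λ i → G (toℕ i) ⊖ G (suc (toℕ i))) ≃ G 0 ⊖ G n
sum-telescope zero    G = ≃-trans (sum-zero _) (solve 1 (λ x → con 0ℚ := x :- x) ≃-refl (G 0))
sum-telescope (suc n) G = ≃-trans (sum-suc _) (≃-trans (⊕-cong ≃-refl (sum-telescope n (G ∘ suc)))
  (solve 3 (λ x y z → x :- y :+ (y :- z) := x :- z) ≃-refl (G 0) (G 1) (G (suc n))))

∥sum-sum∥≼ : ∀ {n} {a b c : Fin n → ℝ} → (∀ i → ∥ a i ⊖ b i ∥ ≼ c i) → ∥ sum a ⊖ sum b ∥ ≼ sum c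
∥sum-sum∥≼ {zero}  {a} {b} {c} h = ≃⇒∥-∥≼ (≃⇒≼ (≃-sym (sum-zero c))) (≃-trans (sum-zero a) (≃-sym (sum-zero b)))
∥sum-sum∥≼ {suc n} {a} {b} {c} h = ≼-resp ≃-refl (≃-sym (sum-suc c))
  (∥-∥≼-resp (≃-sym (sum-suc a)) (≃-sym (sum-suc b)) (∥-∥≼
    (≼-trans (⊕-mono (∥-∥≼⇒≼ (h zero)) (∥-∥≼⇒≼ tail)) (≃⇒≼ (swap (b zero) (c zero) (sum (b ∘ suc)) (sum (c ∘ suc)))))
    (≼-trans (⊕-mono (∥-∥≼⇒≼ (∥-∥≼-sym (h zero))) (∥-∥≼⇒≼ (∥-∥≼-sym tail)))
      (≃⇒≼ (swap (a zero) (c zero) (sum (a ∘ suc)) (sum (c ∘ suc)))))))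
  where
  tail = ∥sum-sum∥≼ (h ∘ suc)
  swap : ∀ x y z w → (x ⊕ y) ⊕ (z ⊕ w) ≃ (x ⊕ z) ⊕ (y ⊕ w)
  swap = solve 4 (λ x y z w → (x :+ y) :+ (z :+ w) := (x :+ z) :+ (y :+ w)) ≃-refl

Lim-resp : ∀ {x y L M} → (∀ n → x n ≃ y n) → L ≃ M → Lim x L → Lim y M
Lim-resp e e′ h ε 0<ε = eventually-map (λ {n} → ∥-∥≼-resp (e n) e′) (h ε 0<ε)

Lim-sum : ∀ {k} {x : Fin k → ℕ → ℝ} {L} → (∀ i → Lim (x i) (L i)) → Lim (λ n → sum λ i → x i n) (sum L)
Lim-sum {zero}  {x} {L} h ε 0<ε = always λ n → ≃⇒∥-∥≼ (0≼⟨⟩ 0<ε) (≃-trans (sum-zero _) (≃-sym (sum-zero L)))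
Lim-sum {suc k} {x} {L} h = Lim-resp (λ n → ≃-sym (sum-suc λ i → x i n)) (≃-sym (sum-suc L))
  (Lim-⊕ {x zero} {λ n → sum λ i → x (suc i) n} (h zero) (Lim-sum (h ∘ suc)))

-- Terms indexed by ℕ instead of `Fin n` allow sums of different lengths to be split and compared.
prefix : (ℕ → ℝ) → ℕ → ℝ
prefix a n = sum {n} (a ∘ toℕ)

prefix-suc : ∀ a n → prefix a (suc n) ≃ prefix a n ⊕ a n
prefix-suc a zero    = ≃-trans (sum-suc _) (≃-trans
  (solve 2 (λ x y → x :+ y := y :+ x) ≃-refl (a 0) (sum {0} λ i → a (suc (toℕ i))))
  (⊕-cong (≃-trans (sum-zero _) (≃-sym (sum-zero _))) ≃-refl))
prefix-suc a (suc n) = ≃-trans (sum-suc _) (≃-trans (⊕-cong ≃-refl (prefix-suc (a ∘ suc) n))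
  (≃-trans (solve 3 (λ x y z → x :+ (y :+ z) := x :+ y :+ z) ≃-refl (a 0) (prefix (a ∘ suc) n) (a (suc n)))
    (⊕-cong (≃-sym (sum-suc _)) ≃-refl)))

prefix-+ : ∀ a k l → prefix a (k ℕ.+ l) ≃ prefix a k ⊕ prefix (λ i → a (k ℕ.+ i)) l
prefix-+ a zero    l = ≃-trans (solve 1 (λ x → x := con 0ℚ :+ x) ≃-refl (prefix a l))
  (⊕-cong (≃-sym (sum-zero _)) ≃-refl)
prefix-+ a (suc k) l = ≃-trans (sum-suc _) (≃-trans (⊕-cong ≃-refl (prefix-+ (a ∘ suc) k l))
  (≃-trans (solve 3 (λ x y z → x :+ (y :+ z) := x :+ y :+ z) ≃-refl (a 0) (prefix (a ∘ suc) k)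
      (prefix (λ i → a (suc (k ℕ.+ i))) l))
    (⊕-cong (≃-sym (sum-suc _)) ≃-refl)))

prefix-mono : ∀ a {k l} → k ℕ.≤ l → (∀ i → i ℕ.< l → 0ᴿ ≼ a i) → prefix a k ≼ prefix a l
prefix-mono a {k} {l} k≤l h = subst (λ z → prefix a k ≼ prefix a z) (ℕ.m+[n∸m]≡n k≤l)
  (≼-resp (solve 1 (λ x → x :+ con 0ℚ := x) ≃-refl (prefix a k)) (≃-sym (prefix-+ a k (l ∸ k)))
    (⊕-mono ≼-refl (≼-trans (≃⇒≼ 0≃sum) (sum-mono λ i → h (k ℕ.+ toℕ i) (bound i)))))
  where
  bound : ∀ (i : Fin (l ∸ k)) → k ℕ.+ toℕ i ℕ.< l
  bound i = subst (k ℕ.+ toℕ i ℕ.<_) (ℕ.m+[n∸m]≡n k≤l) (ℕ.+-monoʳ-< k (Fin.toℕ<n i))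
  0≃sum : 0ᴿ ≃ sum {l ∸ k} λ _ → 0ᴿ
  0≃sum = ≃-trans (solve 1 (λ x → con 0ℚ := con 0ℚ :* x) ≃-refl (sum {l ∸ k} λ _ → 0ᴿ))
    (≃-trans (≃-sym (sum-⊗ˡ {l ∸ k} 0ᴿ λ _ → 0ᴿ))
      (sum-cong {l ∸ k} λ _ → solve 0 (con 0ℚ :* con 0ℚ := con 0ℚ) ≃-refl))

-- The inverse square root

2ᴿ : ℝ
2ᴿ = ⟨ fraction 2 1 ⟩

0≼2 : 0ᴿ ≼ 2ᴿ
0≼2 = ⟨⟩-mono (0≤fraction 2 1)

x≼x⊕y : ∀ {x y} → 0ᴿ ≼ y → x ≼ x ⊕ y
x≼x⊕y {x} h = ≼-resp (solve 1 (λ x → x :+ con 0ℚ := x) ≃-refl x) ≃-refl (⊕-mono ≼-refl h)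

-- Retains of u = 1/√A what algebra needs, so that later arguments never look at approximating
-- sequences. The bound `1 ≼ A` is what keeps u at most 1.
record IsInverseRoot (A u : ℝ) : Set where
  field
    1≼A    : 1ᴿ ≼ A
    0≼u    : 0ᴿ ≼ u
    uuA≃1  : u ⊗ u ⊗ A ≃ 1ᴿ

  0≼A : 0ᴿ ≼ A
  0≼A = ≼-trans 0≼1 1≼A

  0≼uu : 0ᴿ ≼ u ⊗ u
  0≼uu = 0≼⊗ 0≼u 0≼u

  -- From u² (A - 1) = 1 - u² = (1 - u) (1 + u), where the factor 1 + u ≥ 1 can be cancelled.
  u≼1 : u ≼ 1ᴿ
  u≼1 = 0≼⇒≼ (⊗-cancel-0≼ (0<1/suc 0) (x≼x⊕y {1ᴿ} 0≼u) (≼-resp ≃-refl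
    (≃-trans (solve 2 (λ A u → u :* u :* (A :- con 1ℚ) := u :* u :* A :- u :* u) ≃-refl A u)
      (≃-trans (⊕-cong uuA≃1 ≃-refl)
        (solve 1 (λ u → con 1ℚ :- u :* u := (con 1ℚ :- u) :* (con 1ℚ :+ u)) ≃-refl u)))
    (0≼⊗ 0≼uu (≼⇒0≼ 1≼A))))

  -- Multiply 1/k ≼ u by k: with A ≼ k and u ≼ 1, 1 = u (u A) ≼ u k.
  bounded-below : ∃[ c ] 0ℚ Rat.< c × ⟨ c ⟩ ≼ u
  bounded-below =
    let n , A≼n = archimedeanᴿ A
        k = fraction (suc n) 1
        0<k = Rat.<-≤-trans (0<1/suc 0) (fraction-mono 1 0 (suc n) 0 (ℕ.s≤s ℕ.z≤n))
        c = recip k 0<k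
        A≼k = ≼-trans A≼n (⟨⟩-mono (fraction-mono n 0 (suc n) 0 (ℕ.*-monoˡ-≤ 1 (ℕ.n≤1+n n))))
        uA≼k = ≼-trans (≼-resp ≃-refl (solve 1 (λ A → con 1ℚ :* A := A) ≃-refl A)
                 (⊗-mono 0≼u 0≼A u≼1 (≼-refl {A}))) A≼k
        0<c = 0<recip k 0<k
        kc≃1 = subst (λ z → ⟨ k ⟩ ⊗ ⟨ c ⟩ ≃ ⟨ z ⟩) (*-recip k 0<k) (≃-sym (⟨⟩-* k c))
    in c , 0<c , ≼-resp
      (≃-trans (⊗-congˡ ⟨ c ⟩ uuA≃1) (solve 1 (λ c → c :* con 1ℚ := c) ≃-refl ⟨ c ⟩))
      (≃-trans (solve 3 (λ c u k → c :* (u :* k) := u :* (k :* c)) ≃-refl ⟨ c ⟩ u ⟨ k ⟩)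
        (≃-trans (⊗-congˡ u kc≃1) (solve 1 (λ u → u :* con 1ℚ := u) ≃-refl u)))
      (⊗-monoˡ (0≼⟨⟩ 0<c) (≼-resp (solve 2 (λ A u → u :* (u :* A) := u :* u :* A) ≃-refl A u) ≃-refl
        (⊗-monoˡ 0≼u uA≼k)))

module _ {A B u v : ℝ} (U : IsInverseRoot A u) (V : IsInverseRoot B v) where
  private
    module U = IsInverseRoot U
    module V = IsInverseRoot V

  -- Pad each square with the other equation, u² = u² (v² B) and v² = v² (u² A). This trades the
  -- difference of roots for that of their arguments without dividing.
  uu-vv : u ⊗ u ⊖ v ⊗ v ≃ u ⊗ u ⊗ (v ⊗ v) ⊗ (B ⊖ A)
  uu-vv = ≃-trans (solve 2 (λ u v → u :* u :- v :* v := u :* u :* con 1ℚ :- v :* v :* con 1ℚ) ≃-refl u v)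
    (≃-trans (⊕-cong (⊗-congˡ (u ⊗ u) (≃-sym V.uuA≃1)) (⊝-cong (⊗-congˡ (v ⊗ v) (≃-sym U.uuA≃1))))
      (solve 4 (λ A B u v → u :* u :* (v :* v :* B) :- v :* v :* (u :* u :* A) := u :* u :* (v :* v) :* (B :- A))
        ≃-refl A B u v))

  cancel-u⊕v : ∀ {x} → 0ᴿ ≼ x ⊗ (u ⊕ v) → 0ᴿ ≼ x
  cancel-u⊕v = let c , 0<c , c≼u = U.bounded-below in ⊗-cancel-0≼ 0<c (≼-trans c≼u (x≼x⊕y V.0≼u))

  inverseRoot-anti : A ≼ B → v ≼ u
  inverseRoot-anti A≼B = 0≼⇒≼ (cancel-u⊕v (≼-resp ≃-refl
    (≃-trans (≃-sym uu-vv) (solve 2 (λ u v → u :* u :- v :* v := (u :- v) :* (u :+ v)) ≃-refl u v))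
    (0≼⊗ (0≼⊗ U.0≼uu V.0≼uu) (≼⇒0≼ A≼B))))

  module _ {d : ℝ} (0≼d : 0ᴿ ≼ d) (B-A : B ⊖ A ≃ 2ᴿ ⊗ d) where

    u-v : (u ⊖ v) ⊗ (u ⊕ v) ≃ u ⊗ u ⊗ (v ⊗ v) ⊗ (2ᴿ ⊗ d)
    u-v = ≃-trans (solve 2 (λ u v → (u :- v) :* (u :+ v) := u :* u :- v :* v) ≃-refl u v)
      (≃-trans uu-vv (⊗-congˡ (u ⊗ u ⊗ (v ⊗ v)) B-A))

    v≼u : v ≼ u
    v≼u = inverseRoot-anti (0≼⇒≼ (≼-resp ≃-refl (≃-sym B-A) (0≼⊗ 0≼2 0≼d)))

    -- Times u + v, the right side minus the left is 2 u² v² d - v³ d (u + v) = d v² (2u + v) (u -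
    -- v), a product of non-negative factors.
    v³d≼u-v : v ⊗ v ⊗ v ⊗ d ≼ u ⊖ v
    v³d≼u-v = 0≼⇒≼ (cancel-u⊕v (≼-resp ≃-refl
      (≃-trans (solve 3 (λ u v d → d :* (v :* v) :* (con (fraction 2 1) :* u :+ v) :* (u :- v)
          := u :* u :* (v :* v) :* (con (fraction 2 1) :* d) :- v :* v :* v :* d :* (u :+ v)) ≃-refl u v d)
        (≃-trans (⊕-cong (≃-sym u-v) ≃-refl)
          (solve 3 (λ u v d → (u :- v) :* (u :+ v) :- v :* v :* v :* d :* (u :+ v)
            := (u :- v :- v :* v :* v :* d) :* (u :+ v)) ≃-refl u v d)))
      (0≼⊗ (0≼⊗ (0≼⊗ 0≼d V.0≼uu) (0≼⊕ (0≼⊗ 0≼2 U.0≼u) V.0≼u)) (≼⇒0≼ v≼u))))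

    -- Likewise u³ d (u + v) - 2 u² v² d = d u² (u + 2v) (u - v).
    u-v≼u³d : u ⊖ v ≼ u ⊗ u ⊗ u ⊗ d
    u-v≼u³d = 0≼⇒≼ (cancel-u⊕v (≼-resp ≃-refl
      (≃-trans (solve 3 (λ u v d → d :* (u :* u) :* (u :+ con (fraction 2 1) :* v) :* (u :- v)
          := u :* u :* u :* d :* (u :+ v) :- u :* u :* (v :* v) :* (con (fraction 2 1) :* d)) ≃-refl u v d)
        (≃-trans (⊕-cong ≃-refl (⊝-cong (≃-sym u-v)))
          (solve 3 (λ u v d → u :* u :* u :* d :* (u :+ v) :- (u :- v) :* (u :+ v)
            := (u :* u :* u :* d :- (u :- v)) :* (u :+ v)) ≃-refl u v d)))
      (0≼⊗ (0≼⊗ (0≼⊗ 0≼d U.0≼uu) (0≼⊕ U.0≼u (0≼⊗ 0≼2 V.0≼u))) (≼⇒0≼ v≼u))))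

-- `F`, `R`, `1/√3` and the constant 1 come from different constructions or carry different proofs
-- of positivity; they are identified through the equation that they satisfy.
inverseRoot-unique : ∀ {A B u v} → IsInverseRoot A u → IsInverseRoot B v → A ≃ B → u ≃ v
inverseRoot-unique U V A≃B = ≼-antisym (inverseRoot-anti V U (≃⇒≼ (≃-sym A≃B))) (inverseRoot-anti U V (≃⇒≼ A≃B))

square-of-inverse : ∀ {x r u} → r ⊗ r ≃ x → r ⊗ u ≃ 1ᴿ → u ⊗ u ⊗ x ≃ 1ᴿ
square-of-inverse {x} {r} {u} rr≃x ru≃1 = ≃-trans (⊗-congˡ (u ⊗ u) (≃-sym rr≃x))
  (≃-trans (solve 2 (λ u r → u :* u :* (r :* r) := r :* u :* (r :* u)) ≃-refl u r)
    (≃-trans (⊗-cong ru≃1 ru≃1) (solve 0 (con 1ℚ :* con 1ℚ := con 1ℚ) ≃-refl)))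

opaque
  unfolding _≃_

  0≼1/√ : ∀ x (0<x : 0ℝ < x) → 0ᴿ ≼ 1/√ x 0<x
  0≼1/√ x 0<x = ≼-pointwise {0ᴿ} {1/√ x 0<x} λ n → Rat.<⇒≤
    (0<recip _ (⊔-positive (proj₁ (proj₂ (√-positive x 0<x))) (seq (√ x) n)))

  1/√-square : ∀ x (0<x : 0ℝ < x) → 0ᴿ ≼ x → 1/√ x 0<x ⊗ 1/√ x 0<x ⊗ x ≃ 1ᴿ
  1/√-square x 0<x 0≤x = square-of-inverse {x} {√ x} {1/√ x 0<x} (√-square x 0≤x)
    (*-inverse (√ x) (√-positive x 0<x))

-- The functions F and F³ on the non-negative reals

opaque
  unfolding _≃_

  -- Nodes of a subdivision are real expressions, not elements of `𝕀`, so the bound `0 ≼ x` is a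
  -- separate argument; `F-cong` shows that the choice of its proof does not matter up to `≃`.
  F : ∀ x → 0ᴿ ≼ x → ℝ
  F x 0≼x = 1/√ (1ℝ + fromℕ 2 * x) (0<1+2x x 0≼x)

  inverseRoot√3 : ℝ
  inverseRoot√3 = 1/√3

  R : 𝕀 → ℝ
  R t = 1/√[1+2 t ]

  density : 𝕀 → ℝ
  density = Law.density μ

1≼1+2x : ∀ {x} → 0ᴿ ≼ x → 1ᴿ ≼ 1ᴿ ⊕ 2ᴿ ⊗ x
1≼1+2x h = x≼x⊕y (0≼⊗ 0≼2 h)

opaque
  unfolding _≃_

  0≼val : ∀ t → 0ᴿ ≼ val t
  0≼val = 0≤val

  val≼1 : ∀ t → val t ≼ 1ᴿ
  val≼1 = val≤1

opaque
  unfolding F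

  F-isInverseRoot : ∀ {x} (0≼x : 0ᴿ ≼ x) → IsInverseRoot (1ᴿ ⊕ 2ᴿ ⊗ x) (F x 0≼x)
  F-isInverseRoot {x} 0≼x = record
    { 1≼A = 1≼1+2x {x} 0≼x ; 0≼u = 0≼1/√ (1ℝ + fromℕ 2 * x) (0<1+2x x 0≼x)
    ; uuA≃1 = 1/√-square (1ℝ + fromℕ 2 * x) (0<1+2x x 0≼x)
        (≼-trans {0ᴿ} {1ᴿ} {1ᴿ ⊕ 2ᴿ ⊗ x} 0≼1 (1≼1+2x {x} 0≼x)) }

  R-isInverseRoot : ∀ t → IsInverseRoot (1ᴿ ⊕ 2ᴿ ⊗ val t) (R t)
  R-isInverseRoot t = record
    { 1≼A = 1≼1+2x {val t} (0≼val t) ; 0≼u = 0≼1/√ (1ℝ + fromℕ 2 * val t) (0<1+2x (val t) (0≤val t))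
    ; uuA≃1 = 1/√-square (1ℝ + fromℕ 2 * val t) (0<1+2x (val t) (0≤val t))
        (≼-trans {0ᴿ} {1ᴿ} {1ᴿ ⊕ 2ᴿ ⊗ val t} 0≼1 (1≼1+2x {val t} (0≼val t))) }

  density≃R³ : ∀ t → density t ≃ R t ⊗ R t ⊗ R t
  density≃R³ t = ≃-refl {density t}

  √3-isInverseRoot : IsInverseRoot ⟨ fraction 3 1 ⟩ inverseRoot√3
  √3-isInverseRoot = record
    { 1≼A = ⟨⟩-mono (fraction-mono 1 0 3 0 (ℕ.s≤s ℕ.z≤n))
    ; 0≼u = 0≼1/√ (fromℕ 3) (0<⇒ {fromℕ 3} (0<1/suc 0) (0 , λ _ _ → fraction-mono 1 0 3 0 (ℕ.s≤s ℕ.z≤n)))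
    ; uuA≃1 = 1/√-square (fromℕ 3) (0<⇒ {fromℕ 3} (0<1/suc 0) (0 , λ _ _ → fraction-mono 1 0 3 0 (ℕ.s≤s ℕ.z≤n))) (⟨⟩-mono (0≤fraction 3 1)) }

F-anti : ∀ {x y} (0≼x : 0ᴿ ≼ x) (0≼y : 0ᴿ ≼ y) → x ≼ y → F y 0≼y ≼ F x 0≼x
F-anti 0≼x 0≼y x≼y = inverseRoot-anti (F-isInverseRoot 0≼x) (F-isInverseRoot 0≼y)
  (⊕-mono ≼-refl (⊗-monoˡ 0≼2 x≼y))

F-cong : ∀ {x y} (0≼x : 0ᴿ ≼ x) (0≼y : 0ᴿ ≼ y) → x ≃ y → F x 0≼x ≃ F y 0≼y
F-cong 0≼x 0≼y e = ≼-antisym (F-anti 0≼y 0≼x (≃⇒≼ (≃-sym e))) (F-anti 0≼x 0≼y (≃⇒≼ e))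

F≼1 : ∀ {x} (0≼x : 0ᴿ ≼ x) → F x 0≼x ≼ 1ᴿ
F≼1 0≼x = IsInverseRoot.u≼1 (F-isInverseRoot 0≼x)

0≼F : ∀ {x} (0≼x : 0ᴿ ≼ x) → 0ᴿ ≼ F x 0≼x
0≼F 0≼x = IsInverseRoot.0≼u (F-isInverseRoot 0≼x)

F0≃1 : ∀ {x} (0≼x : 0ᴿ ≼ x) → x ≃ 0ᴿ → F x 0≼x ≃ 1ᴿ
F0≃1 {x} 0≼x e = inverseRoot-unique {1ᴿ ⊕ 2ᴿ ⊗ x} (F-isInverseRoot 0≼x)
  record { 1≼A = ≼-refl ; 0≼u = 0≼1 ; uuA≃1 = solve 0 (con 1ℚ :* con 1ℚ :* con 1ℚ := con 1ℚ) ≃-refl }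
  (≃-trans (⊕-cong ≃-refl (⊗-congˡ 2ᴿ e))
    (solve 0 (con 1ℚ :+ con (fraction 2 1) :* con 0ℚ := con 1ℚ) ≃-refl))

F1≃1/√3 : ∀ {x} (0≼x : 0ᴿ ≼ x) → x ≃ 1ᴿ → F x 0≼x ≃ inverseRoot√3
F1≃1/√3 {x} 0≼x e = inverseRoot-unique {1ᴿ ⊕ 2ᴿ ⊗ x} (F-isInverseRoot 0≼x) √3-isInverseRoot
  (≃-trans (⊕-cong ≃-refl (⊗-congˡ 2ᴿ e))
    (solve 0 (con 1ℚ :+ con (fraction 2 1) :* con 1ℚ := con (fraction 3 1)) ≃-refl))

F³ : ∀ x → 0ᴿ ≼ x → ℝ
F³ x 0≼x = F x 0≼x ⊗ F x 0≼x ⊗ F x 0≼x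

0≼F³ : ∀ {x} (0≼x : 0ᴿ ≼ x) → 0ᴿ ≼ F³ x 0≼x
0≼F³ 0≼x = 0≼⊗ (0≼⊗ (0≼F 0≼x) (0≼F 0≼x)) (0≼F 0≼x)

F³-anti : ∀ {x y} (0≼x : 0ᴿ ≼ x) (0≼y : 0ᴿ ≼ y) → x ≼ y → F³ y 0≼y ≼ F³ x 0≼x
F³-anti 0≼x 0≼y x≼y = ⊗-mono (0≼⊗ (0≼F 0≼y) (0≼F 0≼y)) (0≼F 0≼x)
  (⊗-mono (0≼F 0≼y) (0≼F 0≼x) (F-anti 0≼x 0≼y x≼y) (F-anti 0≼x 0≼y x≼y)) (F-anti 0≼x 0≼y x≼y)

F³≼1 : ∀ {x} (0≼x : 0ᴿ ≼ x) → F³ x 0≼x ≼ 1ᴿ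
F³≼1 0≼x = ≼-resp ≃-refl (solve 0 (con 1ℚ :* con 1ℚ :* con 1ℚ := con 1ℚ) ≃-refl)
  (⊗-mono (0≼⊗ (0≼F 0≼x) (0≼F 0≼x)) 0≼1 (⊗-mono (0≼F 0≼x) 0≼1 (F≼1 0≼x) (F≼1 0≼x)) (F≼1 0≼x))

module _ {x y} (0≼x : 0ᴿ ≼ x) (0≼y : 0ᴿ ≼ y) (x≼y : x ≼ y) where
  private
    2d : (1ᴿ ⊕ 2ᴿ ⊗ y) ⊖ (1ᴿ ⊕ 2ᴿ ⊗ x) ≃ 2ᴿ ⊗ (y ⊖ x)
    2d = solve 2 (λ x y → (con 1ℚ :+ con (fraction 2 1) :* y) :- (con 1ℚ :+ con (fraction 2 1) :* x)
      := con (fraction 2 1) :* (y :- x)) ≃-refl x y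

  F³-lower : F³ y 0≼y ⊗ (y ⊖ x) ≼ F x 0≼x ⊖ F y 0≼y
  F³-lower = v³d≼u-v (F-isInverseRoot 0≼x) (F-isInverseRoot 0≼y) (≼⇒0≼ x≼y) 2d

  F³-upper : F x 0≼x ⊖ F y 0≼y ≼ F³ x 0≼x ⊗ (y ⊖ x)
  F³-upper = u-v≼u³d (F-isInverseRoot 0≼x) (F-isInverseRoot 0≼y) (≼⇒0≼ x≼y) 2d

  F-lipschitz : F x 0≼x ≼ F y 0≼y ⊕ (y ⊖ x)
  F-lipschitz = ≼-shift (≼-trans F³-upper (≼-resp (⊗-comm (y ⊖ x) (F³ x 0≼x))
      (solve 1 (λ z → z :* con 1ℚ := z) ≃-refl (y ⊖ x)) (⊗-monoˡ (≼⇒0≼ x≼y) (F³≼1 0≼x))))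
    (solve 3 (λ a b d → d :- (a :- b) := b :+ d :- a) ≃-refl (F x 0≼x) (F y 0≼y) (y ⊖ x))

  -- Both quantities lie between `F³ y (y - x)` and `F³ x (y - x)`: the first since F³ is antitone,
  -- the second by `F³-lower` and `F³-upper`.
  tag-error : ∀ {ξ} (0≼ξ : 0ᴿ ≼ ξ) → x ≼ ξ → ξ ≼ y →
    ∥ F³ ξ 0≼ξ ⊗ (y ⊖ x) ⊖ (F x 0≼x ⊖ F y 0≼y) ∥ ≼ (F³ x 0≼x ⊖ F³ y 0≼y) ⊗ (y ⊖ x)
  tag-error {ξ} 0≼ξ x≼ξ ξ≼y = ∥-∥≼
    (≼-shift (⊕-mono (⊗-monoʳ (≼⇒0≼ x≼y) (F³-anti 0≼x 0≼ξ x≼ξ)) F³-lower)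
      (solve 5 (λ a b c d f → a :* d :+ f :- (c :* d :+ b :* d) := f :+ (a :- b) :* d :- c :* d) ≃-refl
        (F³ x 0≼x) (F³ y 0≼y) (F³ ξ 0≼ξ) (y ⊖ x) (F x 0≼x ⊖ F y 0≼y)))
    (≼-shift (⊕-mono (⊗-monoʳ (≼⇒0≼ x≼y) (F³-anti 0≼ξ 0≼y ξ≼y)) F³-upper)
      (solve 5 (λ a b c d f → c :* d :+ a :* d :- (b :* d :+ f) := c :* d :+ (a :- b) :* d :- f) ≃-refl
        (F³ x 0≼x) (F³ y 0≼y) (F³ ξ 0≼ξ) (y ⊖ x) (F x 0≼x ⊖ F y 0≼y)))

-- Riemann sums

≡⇒≃ : ∀ {p q} → p ≡ q → ⟨ p ⟩ ≃ ⟨ q ⟩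
≡⇒≃ refl = ≃-refl

-- Opaque, since comparing two fractions up to conversion normalises greatest common divisors.
opaque
  ratio : ℕ → ℕ → ℝ
  ratio i n = ⟨ fraction i n ⟩

⌜_⌝ : ℕ → ℝ
⌜ n ⌝ = ratio n 1

opaque
  unfolding ratio

  ratio≼⟨⟩ : ∀ {i n p} → fraction i n Rat.≤ p → ratio i n ≼ ⟨ p ⟩
  ratio≼⟨⟩ = ⟨⟩-mono

  ratio-mono : ∀ a b c d → a ℕ.* suc d ℕ.≤ c ℕ.* suc b → ratio a (suc b) ≼ ratio c (suc d)
  ratio-mono a b c d h = ⟨⟩-mono (fraction-mono a b c d h)

  ratio-+ : ∀ a b n → ratio (a ℕ.+ b) (suc n) ≃ ratio a (suc n) ⊕ ratio b (suc n)
  ratio-+ a b n = ≃-trans (≡⇒≃ (fraction-+ a b n)) (⟨⟩-+ (fraction a (suc n)) (fraction b (suc n)))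

  ratio-self : ∀ n → ratio (suc n) (suc n) ≃ 1ᴿ
  ratio-self n = ≡⇒≃ (fraction-≡ (suc n) n 1 0 (ℕ.*-comm (suc n) 1))

  ratio-zero : ∀ n → ratio 0 (suc n) ≃ 0ᴿ
  ratio-zero n = ≡⇒≃ (fraction-≡ 0 n 0 0 refl)

  ratio-⊗ : ∀ i n → ratio i (suc n) ⊗ ⌜ suc n ⌝ ≃ ⌜ i ⌝
  ratio-⊗ i n = ≃-trans (≃-sym (⟨⟩-* (fraction i (suc n)) (fraction (suc n) 1)))
    (≡⇒≃ (trans (fraction-* i n (suc n)) (fraction-≡ (i ℕ.* suc n) n i 0 (ℕ.*-identityʳ (i ℕ.* suc n)))))

  0≼ratio : ∀ i n → 0ᴿ ≼ ratio i n
  0≼ratio i n = ⟨⟩-mono (0≤fraction i n)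

  ⌜⌝-* : ∀ m n → ⌜ m ℕ.* n ⌝ ≃ ⌜ m ⌝ ⊗ ⌜ n ⌝
  ⌜⌝-* m n = ≃-trans (≡⇒≃ (sym (fraction-* m 0 n))) (⟨⟩-* (fraction m 1) (fraction n 1))

  ⌜suc⌝ : ∀ n → ⌜ suc n ⌝ ≃ ⌜ n ⌝ ⊕ 1ᴿ
  ⌜suc⌝ n = ≃-trans (≡⇒≃ (trans (fromℕ-suc n) (Rat.+-comm 1ℚ (fraction n 1)))) (⟨⟩-+ (fraction n 1) 1ℚ)

  ⌜⌝-cancel : ∀ {m n} → ⌜ m ⌝ ≼ ⌜ n ⌝ → m ℕ.≤ n
  ⌜⌝-cancel {m} {n} h = ℕ.≮⇒≥ λ n<m → <⇒≱
    (subst₂ Rat._<_ (Rat.+-identityˡ (fraction n 1)) (sym (fromℕ-suc n)) (Rat.+-monoˡ-< (fraction n 1) (0<1/suc 0)))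
    (Rat.≤-trans (fraction-mono (suc n) 0 m 0 (ℕ.*-monoˡ-≤ 1 n<m)) (⟨⟩-cancel h))

  ⊗1/suc-small : ∀ A ε → 0ℚ Rat.< ε → Eventually λ n → A ⊗ ratio 1 (suc n) ≼ ⟨ ε ⟩
  ⊗1/suc-small A ε 0<ε =
    let k , A≼k = archimedeanᴿ A
        0<K = Rat.<-≤-trans (0<1/suc 0) (fraction-mono 1 0 (suc k) 0 (ℕ.s≤s ℕ.z≤n))
        δ , 0<δ , Kδ = shrink (fraction (suc k) 1) ε 0<K 0<ε
        N , small = 1/suc≤ δ 0<δ
    in N , λ n n≥ → ≼-trans
      (⊗-monoʳ (0≼ratio 1 (suc n)) (≼-trans A≼k (⟨⟩-mono (fraction-mono k 0 (suc k) 0 (ℕ.*-monoˡ-≤ 1 (ℕ.n≤1+n k))))))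
      (≼-trans (⊗-monoˡ (0≼⟨⟩ 0<K) (⟨⟩-mono (small n n≥)))
        (≃⇒≼ (≃-trans (≃-sym (⟨⟩-* (fraction (suc k) 1) δ)) (≡⇒≃ Kδ))))

ratio-monoˡ : ∀ {i j} n → i ℕ.≤ j → ratio i (suc n) ≼ ratio j (suc n)
ratio-monoˡ {i} {j} n i≤j = ratio-mono i n j n (ℕ.*-monoˡ-≤ (suc n) i≤j)

⌜⌝-mono : ∀ {m n} → m ℕ.≤ n → ⌜ m ⌝ ≼ ⌜ n ⌝
⌜⌝-mono = ratio-monoˡ 0

0≼⌜⌝ : ∀ n → 0ᴿ ≼ ⌜ n ⌝
0≼⌜⌝ n = 0≼ratio n 1

-- The parameter `n` stands for n + 1 subintervals of [a,1], so that no denominator vanishes.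
module Subdivision {a} (0≼a : 0ᴿ ≼ a) (a≼1 : a ≼ 1ᴿ) (n : ℕ) where
  Δ : ℝ
  Δ = ratio 1 (suc n) ⊗ (1ᴿ ⊖ a)

  node : ℕ → ℝ
  node i = a ⊕ ratio i (suc n) ⊗ (1ᴿ ⊖ a)

  0≼Δ : 0ᴿ ≼ Δ
  0≼Δ = 0≼⊗ (0≼ratio 1 (suc n)) (≼⇒0≼ a≼1)

  0≼node : ∀ i → 0ᴿ ≼ node i
  0≼node i = 0≼⊕ 0≼a (0≼⊗ (0≼ratio i (suc n)) (≼⇒0≼ a≼1))

  node-step : ∀ i → node (suc i) ⊖ node i ≃ Δ
  node-step i = ≃-trans
    (⊕-cong (⊕-cong ≃-refl (⊗-cong (ratio-+ 1 i n) ≃-refl)) ≃-refl)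
    (solve 4 (λ a d x y → a :+ (x :+ y) :* d :- (a :+ y :* d) := x :* d) ≃-refl
      a (1ᴿ ⊖ a) (ratio 1 (suc n)) (ratio i (suc n)))

  node≼ : ∀ i → node i ≼ node (suc i)
  node≼ i = 0≼⇒≼ (≼-resp ≃-refl (≃-sym (node-step i)) 0≼Δ)

  node-zero : node 0 ≃ a
  node-zero = ≃-trans (⊕-cong ≃-refl (⊗-cong (ratio-zero n) ≃-refl))
    (solve 2 (λ a d → a :+ con 0ℚ :* d := a) ≃-refl a (1ᴿ ⊖ a))

  node-last : node (suc n) ≃ 1ᴿ
  node-last = ≃-trans (⊕-cong ≃-refl (⊗-cong (ratio-self n) ≃-refl))
    (solve 1 (λ a → a :+ con 1ℚ :* (con 1ℚ :- a) := con 1ℚ) ≃-refl a)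

  Fₙ F³ₙ : ℕ → ℝ
  Fₙ i = F (node i) (0≼node i)
  F³ₙ i = F³ (node i) (0≼node i)

  -- The telescoped error is A Δ (F³ a - F³ 1), where the decrease of F³ is at most 1 and Δ is at
  -- most 1/(n + 1). The weights `c` are left arbitrary: `c = 1` serves the tails of the limit law
  -- and `c = f ∘ ξ` the expectations.
  riemann-error : ∀ {c ξ : Fin (suc n) → ℝ} {A} (0≼ξ : ∀ i → 0ᴿ ≼ ξ i) →
    (∀ i → node (toℕ i) ≼ ξ i) → (∀ i → ξ i ≼ node (suc (toℕ i))) → 0ᴿ ≼ A → (∀ i → ∥ c i ∥ ≼ A) →
    ∥ sum (λ i → c i ⊗ F³ (ξ i) (0≼ξ i)) ⊗ Δ ⊖ sum (λ i → c i ⊗ (Fₙ (toℕ i) ⊖ Fₙ (suc (toℕ i)))) ∥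
      ≼ A ⊗ ratio 1 (suc n)
  riemann-error {c} {ξ} {A} 0≼ξ ξ≥ ξ≤ 0≼A ∥c∥≼A = ≼-trans
    (∥-∥≼-resp (≃-sym (≃-trans (⊗-comm _ Δ) (≃-sym (sum-⊗ˡ Δ (λ i → c i ⊗ F³ (ξ i) (0≼ξ i)))))) ≃-refl
      (∥sum-sum∥≼ term))
    (≼-trans (≃⇒≼ (≃-trans (sum-⊗ˡ (A ⊗ Δ) _) (⊗-congˡ (A ⊗ Δ) (sum-telescope (suc n) F³ₙ))))
      (≼-trans (⊗-monoˡ (0≼⊗ 0≼A 0≼Δ) decrease≼1)
        (≼-trans (≃⇒≼ (solve 2 (λ A d → A :* d :* con 1ℚ := A :* d) ≃-refl A Δ)) (⊗-monoˡ 0≼A Δ≼))))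
    where
    decrease≼1 : F³ₙ 0 ⊖ F³ₙ (suc n) ≼ 1ᴿ
    decrease≼1 = ≼-shift (⊕-mono (F³≼1 (0≼node 0)) (0≼F³ (0≼node (suc n))))
      (solve 2 (λ x y → con 1ℚ :+ y :- (x :+ con 0ℚ) := con 1ℚ :- (x :- y)) ≃-refl (F³ₙ 0) (F³ₙ (suc n)))
    Δ≼ : Δ ≼ ratio 1 (suc n)
    Δ≼ = ≼-resp ≃-refl (solve 1 (λ x → x :* con 1ℚ := x) ≃-refl (ratio 1 (suc n)))
      (⊗-monoˡ (0≼ratio 1 (suc n)) (≼-shift 0≼a
        (solve 1 (λ a → a :- con 0ℚ := con 1ℚ :- (con 1ℚ :- a)) ≃-refl a)))
    term : ∀ i → ∥ Δ ⊗ (c i ⊗ F³ (ξ i) (0≼ξ i)) ⊖ c i ⊗ (Fₙ (toℕ i) ⊖ Fₙ (suc (toℕ i))) ∥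
                 ≼ A ⊗ Δ ⊗ (F³ₙ (toℕ i) ⊖ F³ₙ (suc (toℕ i)))
    term i = ∥-∥≼-resp
      (≃-trans (⊗-congˡ (c i) (⊗-congˡ (F³ (ξ i) (0≼ξ i)) (node-step (toℕ i))))
        (solve 3 (λ c x d → c :* (x :* d) := d :* (c :* x)) ≃-refl (c i) (F³ (ξ i) (0≼ξ i)) Δ)) ≃-refl
      (≼-resp ≃-refl
        (≃-trans (⊗-congˡ A (⊗-congˡ (F³ₙ (toℕ i) ⊖ F³ₙ (suc (toℕ i))) (node-step (toℕ i))))
          (solve 3 (λ A x d → A :* (x :* d) := A :* d :* x) ≃-refl A (F³ₙ (toℕ i) ⊖ F³ₙ (suc (toℕ i))) Δ))
        (∥⊗-⊗∥≼ (∥c∥≼A i)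
          (0≼⊗ (≼⇒0≼ (F³-anti (0≼node (toℕ i)) (0≼node (suc (toℕ i))) (node≼ (toℕ i)))) (≼⇒0≼ (node≼ (toℕ i))))
          (tag-error (0≼node (toℕ i)) (0≼node (suc (toℕ i))) (node≼ (toℕ i)) (0≼ξ i) (ξ≥ i) (ξ≤ i))))

F³ᴵ Fᴵ : 𝕀 → ℝ
F³ᴵ s = F³ (val s) (0≼val s)
Fᴵ s = F (val s) (0≼val s)

R≃Fᴵ : ∀ t → R t ≃ Fᴵ t
R≃Fᴵ t = inverseRoot-unique (R-isInverseRoot t) (F-isInverseRoot (0≼val t)) ≃-refl

density≃F³ᴵ : ∀ t → density t ≃ F³ᴵ t
density≃F³ᴵ t = ≃-trans (density≃R³ t) (⊗-cong (⊗-cong (R≃Fᴵ t) (R≃Fᴵ t)) (R≃Fᴵ t))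

∥1∥≼1 : ∥ 1ᴿ ∥ ≼ 1ᴿ
∥1∥≼1 = ∥x∥≼ ≼-refl (≼-trans (≼-resp ≃-refl (solve 0 (:- con 0ℚ := con 0ℚ) ≃-refl) (⊝-anti 0≼1)) 0≼1)

module _ (t : 𝕀) where
  open Subdivision (0≼val t) (val≼1 t)

  Tags : ∀ n → (Fin (suc n) → 𝕀) → Set
  Tags n ξ = ∀ i → node n (toℕ i) ≼ val (ξ i) × val (ξ i) ≼ node n (suc (toℕ i))

  IsIntegral : (𝕀 → ℝ) → ℝ → Set
  IsIntegral f I = ∀ ε → 0ℚ Rat.< ε → Eventually λ n → ∀ ξ → Tags n ξ →
    ∥ sum (λ i → f (ξ i)) ⊗ Δ n ⊖ I ∥ ≼ ⟨ ε ⟩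

  opaque
    unfolding _≃_ ratio

    isIntegral : ∀ {f I} → IsIntegral f I → Integral f (val t) 1ℝ I
    isIntegral int ε 0<ε = let N , g = int ε 0<ε in
      -- `Integral` counts n subintervals and `IsIntegral` counts n + 1, so the threshold moves up
      -- by one and n = 0 is excluded.
      suc N , λ { (suc n) n≥ ξ tags → g n (ℕ.s≤s⁻¹ n≥) ξ tags }

  density-integral : IsIntegral density (Fᴵ t ⊖ inverseRoot√3)
  density-integral ε 0<ε = let N , small = ⊗1/suc-small 1ᴿ ε 0<ε in
    N , λ n n≥ ξ tags → ∥-∥≼-resp
      (⊗-cong (sum-cong (λ i → ≃-trans (solve 1 (λ x → con 1ℚ :* x := x) ≃-refl (F³ᴵ (ξ i)))
        (≃-sym (density≃F³ᴵ (ξ i))))) ≃-refl)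
      (≃-trans (sum-cong λ i → solve 1 (λ x → con 1ℚ :* x := x) ≃-refl (Fₙ n (toℕ i) ⊖ Fₙ n (suc (toℕ i))))
        (≃-trans (sum-telescope (suc n) (Fₙ n))
          (⊕-cong (F-cong (0≼node n 0) (0≼val t) (node-zero n))
            (⊝-cong (F1≃1/√3 (0≼node n (suc n)) (node-last n))))))
      (≼-trans (riemann-error n {λ _ → 1ᴿ} (0≼val ∘ ξ) (proj₁ ∘ tags) (proj₂ ∘ tags) 0≼1 (λ _ → ∥1∥≼1))
        (small n n≥))

  x≃x-y+y : ∀ x y → x ≃ x ⊖ y ⊕ y
  x≃x-y+y = solve 2 (λ x y → x := x :- y :+ y) ≃-refl

  opaque
    unfolding R

    -- The density contributes F t - 1/√3 on [t,1], and the atom restores the missing 1/√3.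
    Pr≥-μ : ∀ {v} → v ≃ Fᴵ t → Pr≥ μ t v
    Pr≥-μ {v} e = Fᴵ t ⊖ inverseRoot√3 , isIntegral {density} {Fᴵ t ⊖ inverseRoot√3} density-integral ,
      ≃-trans {v} {Fᴵ t} {Fᴵ t ⊖ inverseRoot√3 ⊕ inverseRoot√3} e (x≃x-y+y (Fᴵ t) inverseRoot√3)

-- Grid points, floors and ceilings

opaque
  unfolding _≃_

  Lim⇒⟶ : ∀ {x L} → Lim x L → x ⟶ L
  Lim⇒⟶ h = h

  <⇒≼ : ∀ {x y} → x < y → x ≼ y
  <⇒≼ {x} {y} (c , 0<c , N , h) ε 0<ε = N , λ n n≥ → p≤p+ε 0<ε (Rat.≤-trans (p≤p+ε 0<c Rat.≤-refl) (h n n≥))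

  <⇒⋠ : ∀ {x y} → x < y → y ≼ x → ⊥
  <⇒⋠ {x} {y} (c , 0<c , N , h) y≼x =
    let M , g = y≼x (½ Rat.* c) (0<half 0<c)
        k = N ℕ.⊔ M
    in contradiction (Rat.≤-trans (h k (ℕ.m≤m⊔n N M)) (g k (ℕ.m≤n⊔m N M)))
      (<⇒≱ (Rat.+-monoʳ-< (seq x k) (subst₂ Rat._<_ (Rat.+-identityʳ (½ Rat.* c)) (half+half c)
        (Rat.+-monoʳ-< (½ Rat.* c) (0<half 0<c)))))

Lim-nonneg : ∀ {x L} → (∀ n → 0ᴿ ≼ x n) → Lim x L → 0ᴿ ≼ L
Lim-nonneg h g = ≼-closed λ ε 0<ε → let N , g′ = g ε 0<ε in ≼-trans (h N) (∥-∥≼⇒≼ (g′ N ℕ.≤-refl))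

sum-zeros : ∀ {n} {a : Fin n → ℝ} → (∀ i → a i ≃ 0ᴿ) → sum a ≃ 0ᴿ
sum-zeros {a = a} h = ≃-trans (sum-cong λ i → ≃-trans (h i) (solve 0 (con 0ℚ := con 0ℚ :* con 0ℚ) ≃-refl))
  (≃-trans (sum-⊗ˡ 0ᴿ λ _ → 0ᴿ) (solve 1 (λ x → con 0ℚ :* x := con 0ℚ) ≃-refl (sum {_} λ _ → 0ᴿ)))

1/suc-scale : ∀ {x y} n → x ⊗ ⌜ suc n ⌝ ≼ y ⊗ ⌜ suc n ⌝ → x ≼ y
1/suc-scale {x} {y} n h = ≼-resp (e x) (e y) (⊗-monoˡ (0≼ratio 1 (suc n)) h)
  where
  e : ∀ z → ratio 1 (suc n) ⊗ (z ⊗ ⌜ suc n ⌝) ≃ z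
  e z = ≃-trans (solve 3 (λ r z n → r :* (z :* n) := z :* (r :* n)) ≃-refl (ratio 1 (suc n)) z ⌜ suc n ⌝)
    (≃-trans (⊗-congˡ z (≃-trans (ratio-⊗ 1 n) (ratio-self 0))) (solve 1 (λ z → z :* con 1ℚ := z) ≃-refl z))

if-≃ : ∀ {A : Set} (A? : Dec A) {x y z : ℝ} → (A → x ≃ z) → (¬ A → y ≃ z) → (if does A? then x else y) ≃ z
if-≃ (yes a) f g = f a
if-≃ (no ¬a) f g = g ¬a

opaque
  -- Truncating `i` at `n` makes the point total in `i`; `val-point` removes the truncation for
  -- `i ≤ n`.
  point : ℕ → ℕ → 𝕀
  point n i = mk𝕀 (ι (fraction (i ℕ.⊓ n) n))
    (ι-mono-≤ (0≤fraction (i ℕ.⊓ n) n)) (ι-mono-≤ (fraction≤1 {i ℕ.⊓ n} {n} (ℕ.m⊓n≤n i n)))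

opaque
  unfolding _≃_ ratio point

  val-point : ∀ {i n} → i ℕ.≤ n → val (point n i) ≃ ratio i n
  val-point {i} {n} i≤n rewrite ℕ.m≤n⇒m⊓n≡m i≤n = ≃-refl {ι (fraction i n)}

  val-grid : ∀ m (j : Fin m) → val (grid m j) ≃ ratio (toℕ j) (m ∸ 1)
  val-grid m j = ≃-refl {ι (fraction (toℕ j) (m ∸ 1))}

  ≃1⇒≈1ℝ : ∀ {x} → x ≃ 1ᴿ → x ≈ 1ℝ
  ≃1⇒≈1ℝ e = e

  ≈1ℝ⇒≃1 : ∀ {x} → x ≈ 1ℝ → x ≃ 1ᴿ
  ≈1ℝ⇒≃1 e = e

  ≼⇒≤ : ∀ {x y} → x ≼ y → x ≤ y
  ≼⇒≤ h = h

  ≤⇒≼ : ∀ {x y} → x ≤ y → x ≼ y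
  ≤⇒≼ h = h

  isFloor : ∀ {i n} → i ℕ.≤ suc n → ∀ d → IsFloor (i ℕ.* d / suc n) (val (point (suc n) i) * fromℕ d)
  isFloor {i} {n} i≤n d rewrite ℕ.m≤n⇒m⊓n≡m i≤n =
    ι-mono-≤ (Rat.≤-trans (fraction-mono k 0 (i ℕ.* d) n
      (subst (k ℕ.* suc n ℕ.≤_) (sym (ℕ.*-identityʳ (i ℕ.* d))) (m/n*n≤m (i ℕ.* d) (suc n))))
      (Rat.≤-reflexive (sym (fraction-* i n d)))) ,
    -- The remainder of i d modulo n + 1 is at most n, so i d / (n + 1) stays at least 1/(n + 1)
    -- below the next integer. That gap witnesses the strict inequality.
    fraction 1 (suc n) , 0<1/suc n , 0 , λ _ _ → Rat.≤-trans
      (Rat.≤-reflexive (trans (cong (Rat._+ fraction 1 (suc n)) (fraction-* i n d))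
        (sym (fraction-+ (i ℕ.* d) 1 n))))
      (fraction-mono (i ℕ.* d ℕ.+ 1) n (suc k) 0 (subst₂ ℕ._≤_
        (trans (sym (ℕ.+-comm (i ℕ.* d) 1)) (sym (ℕ.*-identityʳ (i ℕ.* d ℕ.+ 1)))) refl bound))
    where
    k : ℕ
    k = i ℕ.* d / suc n
    bound : suc (i ℕ.* d) ℕ.≤ suc k ℕ.* suc n
    bound = ℕ.≤-trans (ℕ.≤-reflexive (cong suc (m≡m%n+[m/n]*n (i ℕ.* d) (suc n))))
      (ℕ.+-monoˡ-≤ (k ℕ.* suc n) (m%n<n (i ℕ.* d) (suc n)))

module Ceiling (t : 𝕀) (k d : ℕ) (c : IsCeiling k (val t * fromℕ d)) where
  opaque
    unfolding _≃_ ratio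

    lower : val t ⊗ ⌜ d ⌝ ≼ ⌜ k ⌝
    lower = proj₁ c

    upper : ⌜ k ⌝ ≼ val t ⊗ ⌜ d ⌝ ⊕ 1ᴿ
    upper = <⇒≼ {⌜ k ⌝} {val t ⊗ ⌜ d ⌝ ⊕ 1ᴿ} (proj₂ c)

    strict : val t ⊗ ⌜ d ⌝ ⊕ 1ᴿ ≼ ⌜ k ⌝ → ⊥
    strict = <⇒⋠ {⌜ k ⌝} {val t ⊗ ⌜ d ⌝ ⊕ 1ᴿ} (proj₂ c)

  k≤d : k ℕ.≤ d
  k≤d with k ℕ.≤? d
  ... | yes k≤d = k≤d
  -- If k > d, then t d + 1 ≤ d + 1 ≤ k, against the strict bound.
  ... | no k≰d = contradiction (≼-trans
    (⊕-mono (≼-resp (⊗-comm ⌜ d ⌝ (val t)) (solve 1 (λ d → d :* con 1ℚ := d) ≃-refl ⌜ d ⌝)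
      (⊗-monoˡ (0≼⌜⌝ d) (val≼1 t))) ≼-refl)
    (≼-trans (≃⇒≼ (≃-sym (⌜suc⌝ d))) (⌜⌝-mono (ℕ.≰⇒> k≰d)))) strict

-- Tail probabilities as probabilities of events

module _ (p : ℕ → ℕ → ℝ) where

  tail : ℕ → ℕ → ℝ
  tail m k = prefix (λ i → p m (k ℕ.+ i)) (m ∸ k)

  opaque
    unfolding _≃_

    tail≃q : ∀ m k → tail m k ≃ q p m k
    tail≃q m k = ≃-refl {q p m k}

  PrT-sum : ∀ {m k} → k ℕ.≤ m →
    sum {m} (λ j → if does (k ℕ.≤? toℕ j) then p m (toℕ j) else 0ᴿ) ≃ tail m k
  PrT-sum {m} {k} k≤m = subst (λ z → prefix a z ≃ tail m k) (ℕ.m+[n∸m]≡n k≤m)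
    (≃-trans (prefix-+ a k (m ∸ k)) (≃-trans
      (⊕-cong (sum-zeros λ i → below (toℕ i) (Fin.toℕ<n i)) (sum-cong λ i → above (toℕ i)))
      (solve 1 (λ x → con 0ℚ :+ x := x) ≃-refl (tail m k))))
    where
    a : ℕ → ℝ
    a i = if does (k ℕ.≤? i) then p m i else 0ᴿ
    below : ∀ i → i ℕ.< k → a i ≃ 0ᴿ
    below i i<k = if-≃ (k ℕ.≤? i) (λ k≤i → contradiction k≤i (ℕ.<⇒≱ i<k)) (λ _ → ≃-refl)
    above : ∀ i → a (k ℕ.+ i) ≃ p m (k ℕ.+ i)
    above i = if-≃ (k ℕ.≤? k ℕ.+ i) (λ _ → ≃-refl) (λ k≰ → contradiction (ℕ.m≤m+n k i) k≰)

  opaque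
    unfolding _≃_

    -- The event is a final segment of grid indices, so deciding it reduces to comparing natural
    -- numbers. As `map′` keeps the boolean, the sum over the event is the one of `PrT-sum`.
    PrT-tail : ∀ {m k v} (A : Pred ℝ 0ℓ) → k ℕ.≤ m →
      (∀ j → k ℕ.≤ toℕ j → A (val (grid m j))) → (∀ j → A (val (grid m j)) → k ℕ.≤ toℕ j) →
      tail m k ≃ v → PrT p m A v
    PrT-tail {m} {k} {v} A k≤m to from e = (λ j → map′ (to j) (from j) (k ℕ.≤? toℕ j)) ,
      ≃-trans {sum {m} (λ j → if does (k ℕ.≤? toℕ j) then p m (toℕ j) else 0ᴿ)} {tail m k} {v} (PrT-sum k≤m) e

  tail-last : ∀ d → tail (suc d) d ≃ p (suc d) d
  tail-last d = subst (λ z → prefix (λ i → p (suc d) (d ℕ.+ i)) z ≃ p (suc d) d) (sym (ℕ.m+n∸n≡m 1 d))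
    (≃-trans (sum-suc _) (≃-trans (⊕-cong (subst (λ z → p (suc d) z ≃ p (suc d) d) (sym (ℕ.+-identityʳ d)) ≃-refl) (sum-zero _))
      (solve 1 (λ x → x :+ con 0ℚ := x) ≃-refl (p (suc d) d))))

  grid⇒≥ : ∀ (t : 𝕀) d k → IsCeiling k (val t * fromℕ (suc d)) →
    ∀ (j : Fin (suc (suc d))) → val t ≤ val (grid (suc (suc d)) j) → k ℕ.≤ toℕ j
  grid⇒≥ t d k c j h with k ℕ.≤? toℕ j
  ... | yes k≤j = k≤j
  -- If j < k, then t (m - 1) + 1 ≤ j + 1 ≤ k, which the ceiling excludes.
  ... | no k≰j = contradiction (≼-trans
    (⊕-mono (≼-trans (⊗-monoʳ (0≼⌜⌝ (suc d)) (≤⇒≼ h)) (≃⇒≼ (≃-trans (⊗-cong (val-grid (suc (suc d)) j) ≃-refl) (ratio-⊗ (toℕ j) d))))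
      (≼-refl {1ᴿ}))
    (≼-trans (≃⇒≼ (≃-sym (⌜suc⌝ (toℕ j)))) (⌜⌝-mono (ℕ.≰⇒> k≰j)))) (Ceiling.strict t k (suc d) c)

  ≥⇒grid : ∀ (t : 𝕀) d k → IsCeiling k (val t * fromℕ (suc d)) →
    ∀ (j : Fin (suc (suc d))) → k ℕ.≤ toℕ j → val t ≤ val (grid (suc (suc d)) j)
  ≥⇒grid t d k c j k≤j = ≼⇒≤ (1/suc-scale d (≼-trans (Ceiling.lower t k (suc d) c) (≼-trans (⌜⌝-mono k≤j)
    (≃⇒≼ (≃-trans (≃-sym (ratio-⊗ (toℕ j) d)) (⊗-cong (≃-sym (val-grid (suc (suc d)) j)) ≃-refl))))))

  PrT≥ : ∀ (t : 𝕀) m k → 2 ℕ.≤ m → IsCeiling k (val t * fromℕ (m ∸ 1)) → PrT p m (val t ≤_) (q p m k)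
  PrT≥ t (suc (suc d)) k _ c = PrT-tail (val t ≤_) (ℕ.m≤n⇒m≤1+n (Ceiling.k≤d t k (suc d) c))
    (≥⇒grid t d k c) (grid⇒≥ t d k c) (tail≃q (suc (suc d)) k)
  PrT≥ t (suc zero) k (ℕ.s≤s ()) _

  PrT≈1 : ∀ {m} → 2 ℕ.≤ m → PrT p m (_≈ 1ℝ) (p m (m ∸ 1))
  PrT≈1 {suc (suc d)} _ = PrT-tail (_≈ 1ℝ) (ℕ.n≤1+n (suc d)) to from (tail-last (suc d))
    where
    to : ∀ j → suc d ℕ.≤ toℕ j → val (grid (suc (suc d)) j) ≈ 1ℝ
    to j d≤j = ≃1⇒≈1ℝ (≃-trans (val-grid (suc (suc d)) j)
      (subst (λ z → ratio z (suc d) ≃ 1ᴿ) (ℕ.≤-antisym d≤j (Fin.toℕ≤pred[n] j)) (ratio-self d)))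
    from : ∀ j → val (grid (suc (suc d)) j) ≈ 1ℝ → suc d ℕ.≤ toℕ j
    from j e = ⌜⌝-cancel (≃⇒≼ (≃-trans (solve 1 (λ x → x := con 1ℚ :* x) ≃-refl ⌜ suc d ⌝)
      (≃-trans (⊗-cong (≃-trans (≃-sym (≈1ℝ⇒≃1 e)) (val-grid (suc (suc d)) j)) ≃-refl) (ratio-⊗ (toℕ j) d))))
  PrT≈1 {suc zero} (ℕ.s≤s ())

-- Real ceilings between rational floors

*≤⇒≤/ : ∀ k x n → k ℕ.* suc n ℕ.≤ x → k ℕ.≤ x / suc n
*≤⇒≤/ k x n h = subst (ℕ._≤ x / suc n) (m*n/n≡m k (suc n)) (/-monoˡ-≤ (suc n) h)

≤*⇒/≤ : ∀ k x n → x ℕ.≤ k ℕ.* suc n → x / suc n ℕ.≤ k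
≤*⇒/≤ k x n h = subst (x / suc n ℕ.≤_) (m*n/n≡m k (suc n)) (/-monoˡ-≤ (suc n) h)

floor≤ : ∀ {i n} d → i ℕ.≤ suc n → i ℕ.* d / suc n ℕ.≤ d
floor≤ {i} {n} d i≤n = ≤*⇒/≤ d (i ℕ.* d) n (ℕ.≤-trans (ℕ.*-monoˡ-≤ d i≤n) (ℕ.≤-reflexive (ℕ.*-comm (suc n) d)))

Fᶠ : ℕ → ℕ → ℝ
Fᶠ n i = F (ratio i (suc n)) (0≼ratio i (suc n))

-- Here `k` is the ceiling at a late index and `k₀` that at a fixed one. The points (k₀ - 1)/(d₀ +
-- 1) and (k₀ + 1)/(d₀ + 1) enclose t; truncation at 0 and the cap at d₀ + 1 keep them in [0,1].
module Ceilings {t k d k₀ d₀} (C : IsCeiling k (val t * fromℕ d)) (C₀ : IsCeiling k₀ (val t * fromℕ (suc d₀))) where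
  private
    module C  = Ceiling t k d C
    module C₀ = Ceiling t k₀ (suc d₀) C₀

  ⌜pred⌝≼ : ⌜ k₀ ∸ 1 ⌝ ≼ val t ⊗ ⌜ suc d₀ ⌝
  ⌜pred⌝≼ = lemma k₀ C₀.upper
    where
    lemma : ∀ k → ⌜ k ⌝ ≼ val t ⊗ ⌜ suc d₀ ⌝ ⊕ 1ᴿ → ⌜ k ∸ 1 ⌝ ≼ val t ⊗ ⌜ suc d₀ ⌝
    lemma zero    _ = ≼-trans (≃⇒≼ (ratio-zero 0)) (0≼⊗ (0≼val t) (0≼⌜⌝ (suc d₀)))
    lemma (suc k) h = ≼-shift (≼-trans (≃⇒≼ (≃-sym (⌜suc⌝ k))) h)
      (solve 2 (λ x y → y :+ con 1ℚ :- (x :+ con 1ℚ) := y :- x) ≃-refl ⌜ k ⌝ (val t ⊗ ⌜ suc d₀ ⌝))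

  pred/≼t : ratio (k₀ ∸ 1) (suc d₀) ≼ val t
  pred/≼t = 1/suc-scale d₀ (≼-trans (≃⇒≼ (ratio-⊗ (k₀ ∸ 1) d₀)) ⌜pred⌝≼)

  t≼suc/ : val t ≼ ratio (suc k₀ ℕ.⊓ suc d₀) (suc d₀)
  t≼suc/ = 1/suc-scale d₀ (≼-trans (lemma (suc k₀ ℕ.⊓ suc d₀) (ℕ.⊓-sel (suc k₀) (suc d₀)))
    (≃⇒≼ (≃-sym (ratio-⊗ (suc k₀ ℕ.⊓ suc d₀) d₀))))
    where
    lemma : ∀ l → l ≡ suc k₀ ⊎ l ≡ suc d₀ → val t ⊗ ⌜ suc d₀ ⌝ ≼ ⌜ l ⌝
    lemma _ (inj₁ refl) = ≼-trans C₀.lower (⌜⌝-mono (ℕ.n≤1+n k₀))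
    lemma _ (inj₂ refl) = ≼-resp ≃-refl (solve 1 (λ x → con 1ℚ :* x := x) ≃-refl ⌜ suc d₀ ⌝)
      (⊗-monoʳ (0≼⌜⌝ (suc d₀)) (val≼1 t))

  suc/≼pred/ : ratio (suc k₀ ℕ.⊓ suc d₀) (suc d₀)
             ≼ ratio (k₀ ∸ 1) (suc d₀) ⊕ 2ᴿ ⊗ ratio 1 (suc d₀)
  suc/≼pred/ = ≼-trans (ratio-monoˡ d₀ (ℕ.≤-trans (ℕ.m⊓n≤m (suc k₀) (suc d₀)) (lemma k₀)))
    (≃⇒≼ (≃-trans (ratio-+ 2 (k₀ ∸ 1) d₀) (≃-trans (⊕-cong (ratio-+ 1 1 d₀) ≃-refl)
      (solve 2 (λ x y → x :+ x :+ y := y :+ con (fraction 2 1) :* x) ≃-refl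
        (ratio 1 (suc d₀)) (ratio (k₀ ∸ 1) (suc d₀))))))
    where
    lemma : ∀ k → suc k ℕ.≤ 2 ℕ.+ (k ∸ 1)
    lemma zero    = ℕ.s≤s ℕ.z≤n
    lemma (suc k) = ℕ.≤-refl

  floor-pred≤ : (k₀ ∸ 1) ℕ.* d / suc d₀ ℕ.≤ k
  floor-pred≤ = ≤*⇒/≤ k ((k₀ ∸ 1) ℕ.* d) d₀ (⌜⌝-cancel (≼-resp (≃-sym (⌜⌝-* (k₀ ∸ 1) d)) (≃-sym (⌜⌝-* k (suc d₀)))
    (≼-trans (⊗-monoʳ (0≼⌜⌝ d) ⌜pred⌝≼)
      (≼-trans (≃⇒≼ (solve 3 (λ t n d → t :* n :* d := t :* d :* n) ≃-refl (val t) ⌜ suc d₀ ⌝ ⌜ d ⌝))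
        (⊗-monoʳ (0≼⌜⌝ (suc d₀)) C.lower)))))

  -- The upper point uses k₀ + 1 because k may exceed t d by almost 1: k ≤ t d + 1 ≤ k₀ d / (d₀ + 1)
  -- + 1, and the last 1 is at most d / (d₀ + 1) once d₀ + 1 ≤ d.
  ≤floor-suc : suc d₀ ℕ.≤ d → k ℕ.≤ (suc k₀ ℕ.⊓ suc d₀) ℕ.* d / suc d₀
  ≤floor-suc d₀≤d = *≤⇒≤/ k ((suc k₀ ℕ.⊓ suc d₀) ℕ.* d) d₀ (lemma (suc k₀ ℕ.⊓ suc d₀) (ℕ.⊓-sel (suc k₀) (suc d₀)))
    where
    lemma : ∀ l → l ≡ suc k₀ ⊎ l ≡ suc d₀ → k ℕ.* suc d₀ ℕ.≤ l ℕ.* d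
    lemma _ (inj₂ refl) = ℕ.≤-trans (ℕ.*-monoˡ-≤ (suc d₀) C.k≤d) (ℕ.≤-reflexive (ℕ.*-comm d (suc d₀)))
    lemma _ (inj₁ refl) = ⌜⌝-cancel (≼-resp (≃-sym (⌜⌝-* k (suc d₀))) (≃-sym (⌜⌝-* (suc k₀) d))
      (≼-trans (⊗-monoʳ (0≼⌜⌝ (suc d₀)) C.upper)
        (≼-trans (≃⇒≼ (solve 3 (λ t n d → (t :* d :+ con 1ℚ) :* n := t :* n :* d :+ n) ≃-refl (val t) ⌜ suc d₀ ⌝ ⌜ d ⌝))
          (≼-trans (⊕-mono (⊗-monoʳ (0≼⌜⌝ d) C₀.lower) (⌜⌝-mono d₀≤d))
            (≃⇒≼ (≃-trans (solve 2 (λ k d → k :* d :+ d := (k :+ con 1ℚ) :* d) ≃-refl ⌜ k₀ ⌝ ⌜ d ⌝)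
              (⊗-cong (≃-sym (⌜suc⌝ k₀)) ≃-refl)))))))

module Tails (p : ℕ → ℕ → ℝ)
  (0≼p : ∀ {m} → 2 ℕ.≤ m → ∀ k → k ℕ.< m → 0ᴿ ≼ p m k)
  (tail⟶ : ∀ n i → i ℕ.≤ suc n → Lim (λ m → tail p m (i ℕ.* (m ∸ 1) / suc n)) (Fᶠ n i)) where

  tail≃ : ∀ {m k} → k ℕ.≤ m → tail p m k ≃ prefix (p m) m ⊖ prefix (p m) k
  tail≃ {m} {k} k≤m = ≃-trans (solve 2 (λ x y → y := x :+ y :- x) ≃-refl (prefix (p m) k) (tail p m k))
    (⊕-cong (≃-trans (≃-sym (prefix-+ (p m) k (m ∸ k)))
      (subst (λ z → prefix (p m) (k ℕ.+ (m ∸ k)) ≃ prefix (p m) z) (ℕ.m+[n∸m]≡n k≤m) ≃-refl)) ≃-refl)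

  tail-anti : ∀ {m k l} → 2 ℕ.≤ m → k ℕ.≤ l → l ℕ.≤ m → tail p m l ≼ tail p m k
  tail-anti {m} {k} {l} 2≤m k≤l l≤m = ≼-resp (≃-sym (tail≃ l≤m)) (≃-sym (tail≃ (ℕ.≤-trans k≤l l≤m)))
    (⊕-mono ≼-refl (⊝-anti (prefix-mono (p m) k≤l λ i i<l → 0≼p 2≤m i (ℕ.<-≤-trans i<l l≤m))))

  -- The tail at `k m` lies between those at the two floors, whose limits differ by at most 2/(n +
  -- 1) since F has slope at most 1. Half of ε pays for that gap, half for the convergence at the
  -- two grid points.
  tail-ceiling⟶ : ∀ t (k : ℕ → ℕ) → (∀ m → 2 ℕ.≤ m → IsCeiling (k m) (val t * fromℕ (m ∸ 1))) →
                  Lim (λ m → tail p m (k m)) (Fᴵ t)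
  tail-ceiling⟶ t k C ε 0<ε =
    let n , small = ⊗1/suc-small 2ᴿ (½ Rat.* ε) (0<half 0<ε)
        -- At m = n + 2 the grid has step 1/(n + 1), the mesh for which `n` was chosen.
        k₀ = k (suc (suc n))
        C₀ = C (suc (suc n)) (ℕ.s≤s (ℕ.s≤s ℕ.z≤n))
        j = k₀ ∸ 1
        l = suc k₀ ℕ.⊓ suc n
        k₀≤ = Ceiling.k≤d t k₀ (suc n) C₀
        J , hJ = tail⟶ n j (ℕ.≤-trans (ℕ.m∸n≤m k₀ 1) k₀≤) (½ Rat.* ε) (0<half 0<ε)
        L , hL = tail⟶ n l (ℕ.m⊓n≤n (suc k₀) (suc n)) (½ Rat.* ε) (0<half 0<ε)
    in suc (suc n) ℕ.⊔ (J ℕ.⊔ L) , λ m m≥ →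
      let n<m = ℕ.m⊔n≤o⇒m≤o (suc (suc n)) (J ℕ.⊔ L) m≥
          m≥′ = ℕ.m⊔n≤o⇒n≤o (suc (suc n)) (J ℕ.⊔ L) m≥
      in squeeze n m n<m C₀ (small n ℕ.≤-refl) (hJ m (ℕ.m⊔n≤o⇒m≤o J L m≥′)) (hL m (ℕ.m⊔n≤o⇒n≤o J L m≥′))
    where
    squeeze : ∀ n m {k₀} → suc (suc n) ℕ.≤ m → IsCeiling k₀ (val t * fromℕ (suc n)) →
      2ᴿ ⊗ ratio 1 (suc n) ≼ ⟨ ½ Rat.* ε ⟩ →
      ∥ tail p m ((k₀ ∸ 1) ℕ.* (m ∸ 1) / suc n) ⊖ Fᶠ n (k₀ ∸ 1) ∥ ≼ ⟨ ½ Rat.* ε ⟩ →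
      ∥ tail p m ((suc k₀ ℕ.⊓ suc n) ℕ.* (m ∸ 1) / suc n) ⊖ Fᶠ n (suc k₀ ℕ.⊓ suc n) ∥ ≼ ⟨ ½ Rat.* ε ⟩ →
      ∥ tail p m (k m) ⊖ Fᴵ t ∥ ≼ ⟨ ε ⟩
    squeeze n m {k₀} n<m C₀ small hj hl = ∥-∥≼
      (≼-trans (tail-anti 2≤m floor-pred≤ (ℕ.≤-trans C.k≤d d≤m)) (≼-trans (∥-∥≼⇒≼ hj)
        (halves (≼-trans Fj≼ (⊕-mono (F-anti (0≼val t) (0≼ratio l (suc n)) t≼suc/) ≼-refl)))))
      (≼-trans (F-anti (0≼ratio (k₀ ∸ 1) (suc n)) (0≼val t) pred/≼t) (≼-trans Fj≼
        (halves (≼-trans (∥-∥≼⇒≼ (∥-∥≼-sym hl)) (⊕-mono (tail-anti 2≤m (≤floor-suc (ℕ.∸-monoˡ-≤ 1 n<m))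
          (ℕ.≤-trans (floor≤ (m ∸ 1) (ℕ.m⊓n≤n (suc k₀) (suc n))) d≤m)) ≼-refl)))))
      where
      2≤m : 2 ℕ.≤ m
      2≤m = ℕ.≤-trans (ℕ.s≤s (ℕ.s≤s ℕ.z≤n)) n<m
      d≤m : m ∸ 1 ℕ.≤ m
      d≤m = ℕ.m∸n≤m m 1
      l : ℕ
      l = suc k₀ ℕ.⊓ suc n
      module C = Ceiling t (k m) (m ∸ 1) (C m 2≤m)
      open Ceilings {t} {k m} {m ∸ 1} {k₀} {n} (C m 2≤m) C₀
      halves : ∀ {x y} → x ≼ y ⊕ ⟨ ½ Rat.* ε ⟩ → x ⊕ ⟨ ½ Rat.* ε ⟩ ≼ y ⊕ ⟨ ε ⟩
      halves {x} {y} h = ≼-trans (⊕-mono h ≼-refl)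
        (≃⇒≼ (≃-trans (solve 2 (λ y e → y :+ e :+ e := y :+ (e :+ e)) ≃-refl y ⟨ ½ Rat.* ε ⟩) (⊕-cong ≃-refl (⟨half⟩ ε))))
      Fj≼ : Fᶠ n (k₀ ∸ 1) ≼ Fᶠ n l ⊕ ⟨ ½ Rat.* ε ⟩
      Fj≼ = ≼-trans (F-lipschitz (0≼ratio (k₀ ∸ 1) (suc n)) (0≼ratio l (suc n)) (≼-trans pred/≼t t≼suc/))
        (⊕-mono ≼-refl (≼-trans (≼-shift suc/≼pred/
          (solve 3 (λ x y z → x :+ z :- y := z :- (y :- x)) ≃-refl
            (ratio (k₀ ∸ 1) (suc n)) (ratio l (suc n)) (2ᴿ ⊗ ratio 1 (suc n)))) small))

-- Weak convergence

prefix-∸ : ∀ a {k l} → k ℕ.≤ l → prefix a l ⊖ prefix a k ≃ prefix (λ i → a (k ℕ.+ i)) (l ∸ k)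
prefix-∸ a {k} {l} k≤l = subst (λ z → prefix a z ⊖ prefix a k ≃ prefix (λ i → a (k ℕ.+ i)) (l ∸ k)) (ℕ.m+[n∸m]≡n k≤l)
  (≃-trans (⊕-cong (prefix-+ a k (l ∸ k)) ≃-refl)
    (solve 2 (λ x y → x :+ y :- x := y) ≃-refl (prefix a k) (prefix (λ i → a (k ℕ.+ i)) (l ∸ k))))

sum-telescope′ : ∀ n (G : ℕ → ℝ) → sum {n} (λ i → G (suc (toℕ i)) ⊖ G (toℕ i)) ≃ G n ⊖ G 0
sum-telescope′ n G = ≃-trans
  (sum-cong λ i → solve 2 (λ x y → y :- x := :- x :- :- y) ≃-refl (G (toℕ i)) (G (suc (toℕ i))))
  (≃-trans (sum-telescope n (λ i → ⊝ G i)) (solve 2 (λ x y → :- x :- :- y := y :- x) ≃-refl (G 0) (G n)))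

0≼x⇒∥x∥≼x : ∀ {x} → 0ᴿ ≼ x → ∥ x ∥ ≼ x
0≼x⇒∥x∥≼x {x} h = ∥x∥≼ ≼-refl (≼-trans (⊝-anti h) (≼-resp (solve 0 (con 0ℚ := :- con 0ℚ) ≃-refl) ≃-refl h))

-- Within one block, `w` holds the probabilities and `x` the values of f; replacing the values by
-- that at the tag costs the oscillation `e` times the mass of the block.
weighted-sum : ∀ {n} {w x : Fin n → ℝ} {c e} → 0ᴿ ≼ e → (∀ i → 0ᴿ ≼ w i) → (∀ i → ∥ x i ⊖ c ∥ ≼ e) →
  ∥ sum (λ i → w i ⊗ x i) ⊖ c ⊗ sum w ∥ ≼ e ⊗ sum w
weighted-sum {w = w} {x} {c} {e} 0≼e 0≼w close = ≼-resp
  (∥∥-cong (⊕-cong ≃-refl (⊝-cong (≃-trans (sum-cong λ i → ⊗-comm (w i) c) (sum-⊗ˡ c w)))))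
  (≃-trans (sum-cong λ i → ⊗-comm (w i) e) (sum-⊗ˡ e w))
  (∥sum-sum∥≼ λ i → ∥⊗-⊗∥≼ (0≼x⇒∥x∥≼x (0≼w i)) 0≼e (close i))

make𝕀 : ∀ x → 0ᴿ ≼ x → x ≼ 1ᴿ → 𝕀
make𝕀 x 0≼x x≼1 = mk𝕀 x (0≼⇒0≤ 0≼x) (≼1⇒≤1 x≼1)
  where
  opaque
    unfolding _≃_
    0≼⇒0≤ : 0ᴿ ≼ x → 0ℝ ≤ x
    0≼⇒0≤ h = h
    ≼1⇒≤1 : x ≼ 1ᴿ → x ≤ 1ℝ
    ≼1⇒≤1 h = h

opaque
  unfolding _≃_

  val-0𝕀 : val 0𝕀 ≃ 0ᴿ
  val-0𝕀 = ≃-refl {0ᴿ}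

  val-1𝕀 : val 1𝕀 ≃ 1ᴿ
  val-1𝕀 = ≃-refl {1ᴿ}

  continuous : ∀ f → Continuous f → ∀ ε → 0ℚ Rat.< ε → ∃[ δ ] 0ℚ Rat.< δ ×
    (∀ s t → ∥ val s ⊖ val t ∥ ≼ ⟨ δ ⟩ → ∥ f s ⊖ f t ∥ ≼ ⟨ ε ⟩)
  continuous f c = c

module ContinuousFunction (f : 𝕀 → ℝ) (f-continuous : Continuous f) where

  -- Respect for `≃` has to be derived from continuity: equal points are within every δ, so their
  -- values are within every ε.
  f-cong : ∀ {s t} → val s ≃ val t → f s ≃ f t
  f-cong {s} {t} e = ∥-∥≼-closed⇒≃ λ ε 0<ε → let δ , 0<δ , h = continuous f f-continuous ε 0<ε in
    h s t (≃⇒∥-∥≼ (0≼⟨⟩ 0<δ) e)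

  -- Walk from 0 to t along the points t i / n, in steps shorter than a modulus of continuity for 1.
  f-bounded : ∃[ A ] 0ᴿ ≼ A × (∀ t → ∥ f t ∥ ≼ A)
  f-bounded =
    let δ , 0<δ , h = continuous f f-continuous 1ℚ (0<1/suc 0)
        n , small = 1/suc≤ δ 0<δ
    in ∥ f 0𝕀 ∥ ⊕ ⌜ suc n ⌝ , 0≼⊕ (0≼∥x∥ (f 0𝕀)) (0≼⌜⌝ (suc n)) , λ t → bound t n (h , ratio≼⟨⟩ (small n ℕ.≤-refl))
    where
    module _ (t : 𝕀) (n : ℕ) {δ} (H : (∀ s t → ∥ val s ⊖ val t ∥ ≼ ⟨ δ ⟩ → ∥ f s ⊖ f t ∥ ≼ 1ᴿ)
                                      × ratio 1 (suc n) ≼ ⟨ δ ⟩) where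
      s : ℕ → 𝕀
      s i = make𝕀 (val t ⊗ val (point (suc n) i)) (0≼⊗ (0≼val t) (0≼val (point (suc n) i)))
        (≼-resp ≃-refl (solve 0 (con 1ℚ :* con 1ℚ := con 1ℚ) ≃-refl)
          (⊗-mono (0≼val t) 0≼1 (val≼1 t) (val≼1 (point (suc n) i))))

      step : ∀ i → suc i ℕ.≤ suc n → ∥ f (s (suc i)) ⊖ f (s i) ∥ ≼ 1ᴿ
      step i i<n = proj₁ H (s (suc i)) (s i) (≼-trans
        (∥⊗-⊗∥≼ (≼-trans (0≼x⇒∥x∥≼x (0≼val t)) (val≼1 t)) (0≼ratio 1 (suc n))
          (≼-resp (∥∥-cong (≃-sym (≃-trans
              (⊕-cong (≃-trans (val-point i<n) (ratio-+ 1 i n)) (⊝-cong (val-point (ℕ.<⇒≤ i<n))))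
              (solve 2 (λ x y → x :+ y :- y := x) ≃-refl (ratio 1 (suc n)) (ratio i (suc n))))))
            ≃-refl (0≼x⇒∥x∥≼x (0≼ratio 1 (suc n)))))
        (≼-resp (solve 1 (λ x → x := con 1ℚ :* x) ≃-refl (ratio 1 (suc n))) ≃-refl (proj₂ H)))

      walk : ∀ i → i ℕ.≤ suc n → ∥ f (s i) ⊖ f (s zero) ∥ ≼ ⌜ i ⌝
      walk zero    _   = ≃⇒∥-∥≼ (0≼⌜⌝ 0) ≃-refl
      walk (suc i) i<n = ≼-resp ≃-refl (≃-trans (solve 1 (λ x → con 1ℚ :+ x := x :+ con 1ℚ) ≃-refl ⌜ i ⌝) (≃-sym (⌜suc⌝ i)))
        (∥-∥≼-trans (step i i<n) (walk i (ℕ.<⇒≤ i<n)))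

      bound : ∥ f t ∥ ≼ ∥ f 0𝕀 ∥ ⊕ ⌜ suc n ⌝
      bound = ∥x∥≼ (≼-trans (∥-∥≼⇒≼ near) (⊕-mono (x≼∥x∥ (f 0𝕀)) ≼-refl))
        (≼-trans (≼-shift (∥-∥≼⇒≼ (∥-∥≼-sym near))
          (solve 3 (λ x y r → x :+ r :- y := :- y :+ r :- :- x) ≃-refl (f t) (f 0𝕀) ⌜ suc n ⌝))
          (⊕-mono (≼-trans (x≼∥x∥ (⊝ f 0𝕀)) (≃⇒≼ (∥⊝x∥≃∥x∥ (f 0𝕀)))) ≼-refl))
        where
        near : ∥ f t ⊖ f 0𝕀 ∥ ≼ ⌜ suc n ⌝
        near = ∥-∥≼-resp
          (f-cong (≃-trans (⊗-congˡ (val t) (≃-trans (val-point {suc n} {suc n} ℕ.≤-refl) (ratio-self n)))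
            (solve 1 (λ x → x :* con 1ℚ := x) ≃-refl (val t))))
          (f-cong (≃-trans (⊗-congˡ (val t) (≃-trans (val-point {0} {suc n} ℕ.z≤n) (ratio-zero n)))
            (≃-trans (solve 1 (λ x → x :* con 0ℚ := con 0ℚ) ≃-refl (val t)) (≃-sym val-0𝕀))))
          (walk (suc n) ℕ.≤-refl)

node≃ : ∀ n i → Subdivision.node (0≼val 0𝕀) (val≼1 0𝕀) n i ≃ ratio i (suc n)
node≃ n i = ≃-trans (⊕-cong val-0𝕀 (⊗-congˡ (ratio i (suc n)) (⊕-cong ≃-refl (⊝-cong val-0𝕀))))
  (solve 1 (λ x → con 0ℚ :+ x :* (con 1ℚ :- con 0ℚ) := x) ≃-refl (ratio i (suc n)))

-- j lies in the i-th block when ⌊i d / n⌋ ≤ j < ⌊(i + 1) d / n⌋.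
block-close : ∀ {n d i j} {ξ : 𝕀} → suc n ℕ.≤ suc d → suc i ℕ.≤ suc n →
  i ℕ.* suc d / suc n ℕ.≤ j → j ℕ.< suc i ℕ.* suc d / suc n →
  ratio i (suc n) ≼ val ξ → val ξ ≼ ratio (suc i) (suc n) →
  ∥ val (point (suc d) j) ⊖ val ξ ∥ ≼ 2ᴿ ⊗ ratio 1 (suc n)
block-close {n} {d} {i} {j} {ξ} n≤d i<n b≤j j<b′ lower upper = ∥-∥≼-resp (≃-sym (val-point (ℕ.<⇒≤ j<d))) ≃-refl (∥-∥≼
  (≼-trans (≼-trans j/d≼ (≃⇒≼ (ratio-+ 1 i n)))
    (≼-trans (⊕-mono r≼2r lower) (≃⇒≼ (solve 2 (λ x y → x :+ y := y :+ x) ≃-refl (2ᴿ ⊗ r) (val ξ)))))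
  (≼-trans upper (≼-trans (≃⇒≼ (ratio-+ 1 i n))
    (≼-trans (⊕-mono ≼-refl (≼-trans i/n≼ (≼-trans (≃⇒≼ (ratio-+ 1 j d)) (⊕-mono 1/d≼ ≼-refl))))
      (≃⇒≼ (solve 2 (λ r x → r :+ (r :+ x) := x :+ con (fraction 2 1) :* r) ≃-refl r (ratio j (suc d))))))))
  where
  r : ℝ
  r = ratio 1 (suc n)
  j<d : j ℕ.< suc d
  j<d = ℕ.<-≤-trans j<b′ (floor≤ {suc i} {n} (suc d) i<n)
  r≼2r : r ≼ 2ᴿ ⊗ r
  r≼2r = ≼-resp ≃-refl (solve 1 (λ x → x :+ x := con (fraction 2 1) :* x) ≃-refl r) (x≼x⊕y (0≼ratio 1 (suc n)))
  j/d≼ : ratio j (suc d) ≼ ratio (suc i) (suc n)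
  j/d≼ = ratio-mono j d (suc i) n
    (ℕ.≤-trans (ℕ.*-monoˡ-≤ (suc n) (ℕ.<⇒≤ j<b′)) (m/n*n≤m (suc i ℕ.* suc d) (suc n)))
  i/n≼ : ratio i (suc n) ≼ ratio (suc j) (suc d)
  i/n≼ = ratio-mono i n (suc j) d (ℕ.≤-trans
    (ℕ.≤-reflexive (m≡m%n+[m/n]*n (i ℕ.* suc d) (suc n)))
    (ℕ.+-mono-≤ (ℕ.<⇒≤ (m%n<n (i ℕ.* suc d) (suc n))) (ℕ.*-monoˡ-≤ (suc n) b≤j)))
  1/d≼ : ratio 1 (suc d) ≼ r
  1/d≼ = ratio-mono 1 d 1 n (ℕ.*-monoʳ-≤ 1 n≤d)

Lim-resp-eventually : ∀ {x y L} → Eventually (λ n → x n ≃ y n) → Lim x L → Lim y L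
Lim-resp-eventually e h ε 0<ε = eventually-zip (λ e → ∥-∥≼-resp e ≃-refl) e (h ε 0<ε)

opaque
  unfolding R

  density≡ : density ≡ Law.density μ
  density≡ = refl

  √3≡ : inverseRoot√3 ≡ 1/√3
  √3≡ = refl

opaque
  unfolding _≃_

  expectation : ∀ {f d w I} → IsIntegral 0𝕀 (λ t → f t ⊗ d t) I → Expectation (d dx+ w δ₁) f (I ⊕ f 1𝕀 ⊗ w)
  expectation {f} {d} {w} {I} int = I , isIntegral 0𝕀 {λ t → f t ⊗ d t} {I} int , ≃-refl {I ⊕ f 1𝕀 ⊗ w}

module WeakConvergence (p : ℕ → ℕ → ℝ)
  (0≼p : ∀ {m} → 2 ℕ.≤ m → ∀ k → k ℕ.< m → 0ᴿ ≼ p m k)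
  (tail⟶ : ∀ n i → i ℕ.≤ suc n → Lim (λ m → tail p m (i ℕ.* (m ∸ 1) / suc n)) (Fᶠ n i))
  (f : 𝕀 → ℝ) (f-continuous : Continuous f) where
  open Tails p 0≼p tail⟶
  open ContinuousFunction f f-continuous

  term : ℕ → ℕ → ℝ
  term m j = p m j ⊗ f (point (m ∸ 1) j)

  -- The expectation of f (Tₘ) over the event Tₘ < 1.
  body : ℕ → ℝ
  body m = prefix (term m) (m ∸ 1)

  -- The probability of the i-th block, written with tails because tails are what converges.
  mass : ℕ → ℕ → ℕ → ℝ
  mass n m i = tail p m (i ℕ.* (m ∸ 1) / suc n) ⊖ tail p m (suc i ℕ.* (m ∸ 1) / suc n)

  module Blocks {n d} (n≤d : suc n ℕ.≤ suc d) {ξ : Fin (suc n) → 𝕀} (tags : Tags 0𝕀 n ξ)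
    {δ e} (0≼e : 0ᴿ ≼ e) (small : 2ᴿ ⊗ ratio 1 (suc n) ≼ ⟨ δ ⟩)
    (f-close : ∀ s t → ∥ val s ⊖ val t ∥ ≼ ⟨ δ ⟩ → ∥ f s ⊖ f t ∥ ≼ e) where

    m : ℕ
    m = suc (suc d)

    2≤m : 2 ℕ.≤ m
    2≤m = ℕ.s≤s (ℕ.s≤s ℕ.z≤n)

    b : ℕ → ℕ
    b i = i ℕ.* suc d / suc n

    b≤bsuc : ∀ i → b i ℕ.≤ b (suc i)
    b≤bsuc i = /-monoˡ-≤ (suc n) (ℕ.m≤n+m (i ℕ.* suc d) (suc d))

    b≤m : ∀ {i} → i ℕ.≤ suc n → b i ℕ.≤ m
    b≤m {i} i≤n = ℕ.m≤n⇒m≤1+n (floor≤ {i} (suc d) i≤n)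

    -- The last block stops just before the index m - 1, so the atom at 1 belongs to no block.
    b-last : b (suc n) ≡ suc d
    b-last = trans (cong (_/ suc n) (ℕ.*-comm (suc n) (suc d))) (m*n/n≡m (suc d) (suc n))

    mass≃ : ∀ (i : Fin (suc n)) → mass n m (toℕ i)
          ≃ prefix (λ j → p m (b (toℕ i) ℕ.+ j)) (b (suc (toℕ i)) ∸ b (toℕ i))
    mass≃ i = ≃-trans
      (≃-trans (⊕-cong (tail≃ (b≤m (ℕ.<⇒≤ (Fin.toℕ<n i)))) (⊝-cong (tail≃ (b≤m (Fin.toℕ<n i)))))
        (solve 3 (λ x y z → x :- y :- (x :- z) := z :- y) ≃-refl (prefix (p m) m)
          (prefix (p m) (b (toℕ i))) (prefix (p m) (b (suc (toℕ i))))))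
      (prefix-∸ (p m) (b≤bsuc (toℕ i)))

    block : ∀ (i : Fin (suc n)) →
      ∥ (prefix (term m) (b (suc (toℕ i))) ⊖ prefix (term m) (b (toℕ i))) ⊖ f (ξ i) ⊗ mass n m (toℕ i) ∥
        ≼ e ⊗ mass n m (toℕ i)
    block i = ≼-resp
      (∥∥-cong (⊕-cong (≃-sym (prefix-∸ (term m) (b≤bsuc (toℕ i)))) (⊝-cong (⊗-congˡ (f (ξ i)) (≃-sym (mass≃ i))))))
      (⊗-congˡ e (≃-sym (mass≃ i)))
      (weighted-sum {w = λ j → p m (b (toℕ i) ℕ.+ toℕ j)} {λ j → f (point (suc d) (b (toℕ i) ℕ.+ toℕ j))} 0≼e
        (λ j → 0≼p 2≤m (b (toℕ i) ℕ.+ toℕ j) (ℕ.<-≤-trans (below j) (b≤m (Fin.toℕ<n i))))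
        (λ j → f-close (point (suc d) (b (toℕ i) ℕ.+ toℕ j)) (ξ i) (≼-trans
          (block-close {n} {d} {toℕ i} {b (toℕ i) ℕ.+ toℕ j} {ξ i} n≤d (Fin.toℕ<n i) (ℕ.m≤m+n (b (toℕ i)) (toℕ j)) (below j)
            (≼-trans (≃⇒≼ (≃-sym (node≃ n (toℕ i)))) (proj₁ (tags i)))
            (≼-trans (proj₂ (tags i)) (≃⇒≼ (node≃ n (suc (toℕ i))))))
          small)))
      where
      below : ∀ (j : Fin (b (suc (toℕ i)) ∸ b (toℕ i))) → b (toℕ i) ℕ.+ toℕ j ℕ.< b (suc (toℕ i))
      below j = subst (b (toℕ i) ℕ.+ toℕ j ℕ.<_) (ℕ.m+[n∸m]≡n (b≤bsuc (toℕ i)))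
        (ℕ.+-monoʳ-< (b (toℕ i)) (Fin.toℕ<n j))

    -- The block errors telescope to e times the difference of the tails at 0 and at m - 1, which is
    -- at most the total mass.
    body-close : tail p m 0 ≼ 2ᴿ → ∥ sum (λ i → f (ξ i) ⊗ mass n m (toℕ i)) ⊖ body m ∥ ≼ e ⊗ 2ᴿ
    body-close total = ∥-∥≼-sym (∥-∥≼-resp
      (≃-trans (sum-telescope′ (suc n) (λ i → prefix (term m) (b i)))
        (≃-trans (⊕-cong (subst (λ z → prefix (term m) (b (suc n)) ≃ prefix (term m) z) b-last ≃-refl)
          (⊝-cong (sum-zero _))) (solve 1 (λ x → x :- con 0ℚ := x) ≃-refl (body m))))
      ≃-refl
      (≼-trans (∥sum-sum∥≼ block) (≼-trans (≃⇒≼ (≃-trans (sum-⊗ˡ e (λ i → mass n m (toℕ i)))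
          (⊗-congˡ e (sum-telescope (suc n) (λ i → tail p m (b i))))))
        (⊗-monoˡ 0≼e (≼-trans (≼-shift 0≼tail
          (solve 2 (λ x y → y :- con 0ℚ := x :- (x :- y)) ≃-refl (tail p m (b 0)) (tail p m (b (suc n))))) total)))))
      where
      0≼tail : 0ᴿ ≼ tail p m (b (suc n))
      0≼tail = ≼-trans (≃⇒≼ (≃-sym (≃-trans (tail≃ {m} ℕ.≤-refl)
          (solve 1 (λ x → x :- x := con 0ℚ) ≃-refl (prefix (p m) m)))))
        (tail-anti 2≤m (b≤m {suc n} ℕ.≤-refl) ℕ.≤-refl)

  riemann-sum : ∀ n → (Fin (suc n) → 𝕀) → ℝ
  riemann-sum n ξ = sum (λ i → f (ξ i) ⊗ density (ξ i)) ⊗ Subdivision.Δ (0≼val 0𝕀) (val≼1 0𝕀) n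

  Fᶠ-sum : ∀ n → (Fin (suc n) → 𝕀) → ℝ
  Fᶠ-sum n ξ = sum λ i → f (ξ i) ⊗ (Fᶠ n (toℕ i) ⊖ Fᶠ n (suc (toℕ i)))

  riemann-close : ∀ ε → 0ℚ Rat.< ε → Eventually λ n → ∀ ξ → Tags 0𝕀 n ξ →
    ∥ riemann-sum n ξ ⊖ Fᶠ-sum n ξ ∥ ≼ ⟨ ε ⟩
  riemann-close ε 0<ε =
    let A , 0≼A , ∥f∥≼A = f-bounded
        N , small = ⊗1/suc-small A ε 0<ε
    in N , λ n n≥ ξ tags → let open Subdivision (0≼val 0𝕀) (val≼1 0𝕀) n in ∥-∥≼-resp
      (⊗-cong (sum-cong λ i → ⊗-congˡ (f (ξ i)) (≃-sym (density≃F³ᴵ (ξ i)))) ≃-refl)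
      (sum-cong λ i → ⊗-congˡ (f (ξ i)) (⊕-cong
        (F-cong (0≼node (toℕ i)) (0≼ratio (toℕ i) (suc n)) (node≃ n (toℕ i)))
        (⊝-cong (F-cong (0≼node (suc (toℕ i))) (0≼ratio (suc (toℕ i)) (suc n)) (node≃ n (suc (toℕ i)))))))
      (≼-trans (riemann-error {c = f ∘ ξ} (0≼val ∘ ξ) (proj₁ ∘ tags) (proj₂ ∘ tags) 0≼A (∥f∥≼A ∘ ξ)) (small n n≥))

  mass⟶ : ∀ n ξ → Lim (λ m → sum λ i → f (ξ i) ⊗ mass n m (toℕ i)) (Fᶠ-sum n ξ)
  mass⟶ n ξ = Lim-sum λ i → Lim-⊗ˡ (f (ξ i)) {λ m → mass n m (toℕ i)}
    (Lim-⊖ {λ m → tail p m (toℕ i ℕ.* (m ∸ 1) / suc n)} {λ m → tail p m (suc (toℕ i) ℕ.* (m ∸ 1) / suc n)}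
      (tail⟶ n (toℕ i) (ℕ.<⇒≤ (Fin.toℕ<n i))) (tail⟶ n (suc (toℕ i)) (Fin.toℕ<n i)))

  -- The tail limit at t = 0 sends the total mass to F 0 = 1; the tolerance 1 turns this into the
  -- bound 2.
  total≼2 : Eventually λ m → tail p m 0 ≼ 2ᴿ
  total≼2 = eventually-map (λ h → ≼-trans (∥-∥≼⇒≼ h) (≃⇒≼
      (≃-trans (⊕-cong (F0≃1 (0≼ratio 0 1) (ratio-zero 0)) ≃-refl)
        (solve 0 (con 1ℚ :+ con 1ℚ := con (fraction 2 1)) ≃-refl))))
    (tail⟶ 0 0 ℕ.z≤n 1ℚ (0<1/suc 0))

  mass-close : ∀ ε → 0ℚ Rat.< ε → Eventually λ n → ∀ ξ → Tags 0𝕀 n ξ →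
    Eventually λ m → ∥ (sum λ i → f (ξ i) ⊗ mass n m (toℕ i)) ⊖ body m ∥ ≼ ⟨ ε ⟩
  mass-close ε 0<ε =
    -- Oscillation ε/2, because it is multiplied by the mass bound 2.
    let δ , 0<δ , f-close = continuous f f-continuous (½ Rat.* ε) (0<half 0<ε)
        N , small = ⊗1/suc-small 2ᴿ δ 0<δ
        M , total = total≼2
    in N , λ n n≥ ξ tags → suc (suc n) ℕ.⊔ M , λ m m≥ →
      large n ξ tags (small n n≥) f-close m (ℕ.m⊔n≤o⇒m≤o (suc (suc n)) M m≥) (total m (ℕ.m⊔n≤o⇒n≤o (suc (suc n)) M m≥))
    where
    large : ∀ n ξ → Tags 0𝕀 n ξ → ∀ {δ} → 2ᴿ ⊗ ratio 1 (suc n) ≼ ⟨ δ ⟩ →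
      (∀ s t → ∥ val s ⊖ val t ∥ ≼ ⟨ δ ⟩ → ∥ f s ⊖ f t ∥ ≼ ⟨ ½ Rat.* ε ⟩) →
      ∀ m → suc (suc n) ℕ.≤ m → tail p m 0 ≼ 2ᴿ →
      ∥ (sum λ i → f (ξ i) ⊗ mass n m (toℕ i)) ⊖ body m ∥ ≼ ⟨ ε ⟩
    large n ξ tags small f-close (suc (suc d)) (ℕ.s≤s n≤d) total = ≼-trans
      (Blocks.body-close n≤d tags (0≼⟨⟩ (0<half 0<ε)) small f-close total)
      (≃⇒≼ (≃-trans (solve 1 (λ e → e :* con (fraction 2 1) := e :+ e) ≃-refl ⟨ ½ Rat.* ε ⟩) (⟨half⟩ ε)))

  -- The Riemann sum is compared with the Stieltjes sum of F (ε/2), this with the weighted block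
  -- masses (ε/4), and these with `body m` (ε/4). The inner threshold may depend on n and the tags,
  -- since only finitely many tail limits enter for fixed n.
  riemann-body-close : ∀ ε → 0ℚ Rat.< ε → Eventually λ n → ∀ ξ → Tags 0𝕀 n ξ →
    Eventually λ m → ∥ riemann-sum n ξ ⊖ body m ∥ ≼ ⟨ ε ⟩
  riemann-body-close ε 0<ε = eventually-zip
    (λ {n} r s ξ tags → eventually-zip
      (λ a b → ∥-∥≼-halves ε (r ξ tags) (∥-∥≼-halves (½ Rat.* ε) (∥-∥≼-sym a) b))
      (mass⟶ n ξ (½ Rat.* (½ Rat.* ε)) (0<half (0<half 0<ε))) (s ξ tags))
    (riemann-close (½ Rat.* ε) (0<half 0<ε)) (mass-close (½ Rat.* (½ Rat.* ε)) (0<half (0<half 0<ε)))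

  left-tags : ∀ n → Tags 0𝕀 n (λ i → point (suc n) (toℕ i))
  left-tags n i = ≃⇒≼ (≃-trans (node≃ n (toℕ i)) (≃-sym e)) ,
    ≼-trans (≃⇒≼ e) (≼-trans (ratio-monoˡ n (ℕ.n≤1+n (toℕ i))) (≃⇒≼ (≃-sym (node≃ n (suc (toℕ i))))))
    where
    e : val (point (suc n) (toℕ i)) ≃ ratio (toℕ i) (suc n)
    e = val-point (ℕ.<⇒≤ (Fin.toℕ<n i))

  opaque
    -- One fixed Riemann sum is close to all late terms, so that body is a Cauchy sequence.
    body-limit : ∃[ I ] Lim body I
    body-limit = complete λ ε 0<ε →
      let N , h = riemann-body-close (½ Rat.* ε) (0<half 0<ε)
          M , g = h N ℕ.≤-refl (λ i → point (suc N) (toℕ i)) (left-tags N)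
      in M , λ m m′ m≥ m′≥ → ∥-∥≼-halves ε (∥-∥≼-sym (g m m≥)) (g m′ m′≥)

  I : ℝ
  I = proj₁ body-limit

  -- For each n and each choice of tags, one m late enough for both estimates serves as intermediary
  -- and then drops out, so the bound is uniform in the tags.
  isIntegral-I : IsIntegral 0𝕀 (λ t → f t ⊗ density t) I
  isIntegral-I ε 0<ε =
    let N , h = riemann-body-close (½ Rat.* ε) (0<half 0<ε)
        M′ , g′ = proj₂ body-limit (½ Rat.* ε) (0<half 0<ε)
    in N , λ n n≥ ξ tags → let M , g = h n n≥ ξ tags in
      ∥-∥≼-halves ε (g (M ℕ.⊔ M′) (ℕ.m≤m⊔n M M′)) (g′ (M ℕ.⊔ M′) (ℕ.m≤n⊔m M M′))

  E : ℕ → ℝ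
  E m = sum {m} λ k → p m (toℕ k) ⊗ f (grid m k)

  body⊕last : ∀ m → 2 ℕ.≤ m → body m ⊕ f 1𝕀 ⊗ p m (m ∸ 1) ≃ E m
  body⊕last (suc (suc d)) _ = ≃-trans
    (⊕-cong ≃-refl (≃-trans (⊗-comm (f 1𝕀) (p m (suc d))) (⊗-congˡ (p m (suc d))
      (f-cong (≃-trans val-1𝕀 (≃-sym (≃-trans (val-point {suc d} ℕ.≤-refl) (ratio-self d))))))))
    (≃-trans (≃-sym (prefix-suc (term m) (suc d))) (sum-cong λ k → ⊗-congˡ (p m (toℕ k))
      (f-cong (≃-trans (val-point (Fin.toℕ≤pred[n] k)) (≃-sym (val-grid m k))))))
    where
    m : ℕ
    m = suc (suc d)
  body⊕last (suc zero) (ℕ.s≤s ())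

  E⟶ : Lim (λ m → p m (m ∸ 1)) inverseRoot√3 → Lim E (I ⊕ f 1𝕀 ⊗ inverseRoot√3)
  E⟶ h = Lim-resp-eventually (2 , body⊕last)
    (Lim-⊕ {body} {λ m → f 1𝕀 ⊗ p m (m ∸ 1)} (proj₂ body-limit) (Lim-⊗ˡ (f 1𝕀) h))

  opaque
    unfolding _≃_

    -- Stated for copies d and w of the density and the atom, because converting their definitions
    -- inside Expectation does not terminate in reasonable time.
    weak-convergence : ∀ {d w} → density ≡ d → inverseRoot√3 ≡ w → Lim (λ m → p m (m ∸ 1)) inverseRoot√3 →
      ∃[ v ] Expectation (d dx+ w δ₁) f v × (λ m → 𝔼T p m f) ⟶ v
    weak-convergence refl refl last⟶ = I ⊕ f 1𝕀 ⊗ inverseRoot√3 , expectation {f} {density} {inverseRoot√3} {I} isIntegral-I ,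
      Lim⇒⟶ {E} {I ⊕ f 1𝕀 ⊗ inverseRoot√3} (E⟶ last⟶)

-- Translation to the notions of the theorem

opaque
  unfolding R point

  ⟶⇒Lim-R : ∀ {x t} → x ⟶ 1/√[1+2 t ] → Lim x (R t)
  ⟶⇒Lim-R h = h

  Lim-R⇒⟶ : ∀ {x t} → Lim x (R t) → x ⟶ 1/√[1+2 t ]
  Lim-R⇒⟶ h = h

  ⟶⇒Lim-√3 : ∀ {x} → x ⟶ 1/√3 → Lim x inverseRoot√3
  ⟶⇒Lim-√3 h = h

  Pr≥-R : ∀ t → Pr≥ μ t 1/√[1+2 t ]
  Pr≥-R t = Pr≥-μ t {1/√[1+2 t ]} (R≃Fᴵ t)

  Pr≥-√3 : Pr≥ μ 1𝕀 1/√3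
  Pr≥-√3 = Pr≥-μ 1𝕀 {1/√3} (≃-sym {Fᴵ 1𝕀} {1/√3} (F1≃1/√3 {1ᴿ} (0≼val 1𝕀) val-1𝕀))

  -- Limits of quotients of counts are non-negative; this makes the tails antitone and the block
  -- weights admissible.
  frequencies-nonneg : ∀ {p} → LimitingFrequencies p → ∀ {m} → 2 ℕ.≤ m → ∀ k → k ℕ.< m → 0ᴿ ≼ p m k
  frequencies-nonneg {p} freq {m} 2≤m k k<m = Lim-nonneg {λ n → ι (fraction (g m n k) (gTotal m n))} {p m k}
    (λ n → ⟨⟩-mono (0≤fraction (g m n k) (gTotal m n))) (freq m 2≤m k k<m)

R-point≃ : ∀ n i → i ℕ.≤ suc n → R (point (suc n) i) ≃ Fᶠ n i
R-point≃ n i i≤n = ≃-trans (R≃Fᴵ (point (suc n) i))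
  (F-cong (0≼val (point (suc n) i)) (0≼ratio i (suc n)) (val-point i≤n))

theorem7 : (p : ℕ → ℕ → ℝ) →
    LimitingFrequencies p →
    (∀ (t : 𝕀) (k : ℕ → ℕ) →
    (∀ m → 2 ℕ.≤ m → IsFloor (k m) (val t * fromℕ (m ∸ 1))) →
    (λ m → q p m (k m)) ⟶ 1/√[1+2 t ]) →
    (∀ (t : 𝕀) → val t < 1ℝ → (k : ℕ → ℕ) →
    (∀ m → 2 ℕ.≤ m → IsCeiling (k m) (val t * fromℕ (m ∸ 1))) →
    (∀ m → 2 ℕ.≤ m → PrT p m (val t ≤_) (q p m (k m))) ×
    ((λ m → q p m (k m)) ⟶ 1/√[1+2 t ])) ×
    (∀ m → 2 ℕ.≤ m → PrT p m (_≈ 1ℝ) (p m (m ∸ 1))) ×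
    ((λ m → p m (m ∸ 1)) ⟶ 1/√3 →
    (p ⇝ μ) ×
    (∀ (t : 𝕀) → val t < 1ℝ → Pr≥ μ t 1/√[1+2 t ]) ×
    Pr≥ μ 1𝕀 1/√3)
theorem7 p freq floor-limit =
  (λ t _ k ceilings → (λ m 2≤m → PrT≥ p t m (k m) 2≤m (ceilings m 2≤m)) ,
    Lim-R⇒⟶ {λ m → q p m (k m)} {t} (Lim-resp (λ m → tail≃q p m (k m)) (≃-sym (R≃Fᴵ t))
      (Tails.tail-ceiling⟶ p 0≼p tail⟶ t k ceilings))) ,
  (λ m → PrT≈1 p) ,
  λ last⟶ →
    (λ f f-continuous → WeakConvergence.weak-convergence p 0≼p tail⟶ f f-continuous density≡ √3≡
      (⟶⇒Lim-√3 {λ m → p m (m ∸ 1)} last⟶)) ,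
    (λ t _ → Pr≥-R t) , Pr≥-√3
  where
  0≼p : ∀ {m} → 2 ℕ.≤ m → ∀ k → k ℕ.< m → 0ᴿ ≼ p m k
  0≼p = frequencies-nonneg {p} freq
  tail⟶ : ∀ n i → i ℕ.≤ suc n → Lim (λ m → tail p m (i ℕ.* (m ∸ 1) / suc n)) (Fᶠ n i)
  tail⟶ n i i≤n = Lim-resp (λ m → ≃-sym (tail≃q p m (i ℕ.* (m ∸ 1) / suc n))) (R-point≃ n i i≤n)
    (⟶⇒Lim-R {λ m → q p m (i ℕ.* (m ∸ 1) / suc n)} {point (suc n) i}
      (floor-limit (point (suc n) i) (λ m → i ℕ.* (m ∸ 1) / suc n) (λ m _ → isFloor i≤n (m ∸ 1))))
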